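{- Let $(W,S)$ be an infinite Coxeter system and let $\omega=(\omega_1,\omega_2,\omega_3,\dots)$ be a semi-infinite word in the generators $S$ in which infinitely many group elements occur as subwords. Then the $\omega$-sorting order $(P_\omega,\leq_\omega)$ is an infinite lattice that is supersolvable and join-distributive.
   Context: $\ell$ denotes the length function of $(W,S)$. A (finite) subword $\alpha\subseteq\omega$ is identified with its finite index set $I(\alpha)=\{i_1<\dots<i_k\}\subseteq I(\omega)=\{1,2,3,\dots\}$, with $\alpha=(\omega_{i_1},\dots,\omega_{i_k})$. For a word $\alpha=(\alpha_1,\dots,\alpha_k)$ write $\langle\alpha\rangle=\alpha_1\cdots\alpha_k\in W$; $\alpha$ is reduced if $k=\ell(\langle\alpha\rangle)$. The elements that occur as subwords of $\omega$ are the $\langle\alpha\rangle$ with $\alpha\subseteq\omega$ a finite subword. For finite $A,B\subseteq I(\omega)$, $A\leq_{\mathsf{lex}}B$ means $A=B$ or $\min((A\cup B)\setminus(A\cap B))\in A$. A subword $\alpha\subseteq\omega$ is $\omega$-sorted if it is reduced and $I(\alpha)=\min_{\leq_{\mathsf{lex}}}\{I(\beta):\beta\subseteq\omega\text{ is reduced and }\langle\beta\rangle=\langle\alpha\rangle\}$. $P_\omega$ is the set of $\omega$-sorted words with the order $\alpha\leq_\omega\beta$ iff $I(\alpha)\subseteq I(\beta)$. Let $P$ be a locally finite lattice (all intervals finite). An atomic interval of $P$ is an interval $[x,\bigvee_{y\in Y}y]$ where $Y$ is a set of elements covering $x$ (whose join exists). $P$ is join-distributive if every atomic interval in $P$ is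 boolean, i.e. isomorphic to the lattice of all subsets of a finite set. $P$ is supersolvable if every interval in $P$ is a supersolvable finite lattice, where a finite lattice $L$ is supersolvable if it has a maximal chain $\mathfrak{m}$ such that for every maximal chain $\mathfrak{c}$ of $L$ the sublattice generated by $\mathfrak{m}\cup\mathfrak{c}$ is distributive. -}

module Defs where

open import Level using (Level; _⊔_; suc)
open import Algebra.Bundles using (Group)
open import Data.Fin.Subset as Subset using (Subset)
open import Data.List.Base using (List; []; _∷_; _++_; map; foldr; length; concat; replicate)
open import Data.List.Membership.Propositional using () renaming (_∈_ to _∈ˡ_)
import Data.List.Relation.Binary.Subset.Propositional as ListSubset
open import Data.List.Relation.Unary.Enumerates.Setoid using (IsEnumeration)
open import Data.List.Relation.Unary.Linked using (Linked)
open import Data.Nat.Base as ℕ using (ℕ; _<_)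
open import Data.Product.Base using (_×_; _,_; ∃; Σ-syntax; ∃-syntax; proj₁)
open import Data.Sum.Base using (_⊎_)
open import Function.Base using (_on_)
open import Function.Bundles using (_⇔_)
open import Relation.Binary.Bundles using (Setoid)
open import Relation.Binary.Core using (Rel)
open import Relation.Binary.Construct.Closure.Equivalence using (EqClosure)
import Relation.Binary.Construct.On as On
open import Relation.Binary.Lattice.Bundles using (Lattice)
open import Relation.Binary.Lattice.Structures using (IsDistributiveLattice)
open import Relation.Binary.Morphism.Structures using (IsOrderIsomorphism)
open import Relation.Binary.PropositionalEquality.Core using (_≡_)
open import Relation.Nullary.Negation.Core using (¬_)
open import Relation.Unary using (Pred; _∈_; _⊆_; _∪_; _∩_; _∖_)

Finite : ∀ {c ℓ} → Setoid c ℓ → Set (c ⊔ ℓ)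
Finite A = ∃[ xs ] IsEnumeration A xs

Infinite : ∀ {c ℓ} → Setoid c ℓ → Set (c ⊔ ℓ)
Infinite A = ¬ Finite A

SubSetoid : ∀ {c ℓ p} (A : Setoid c ℓ) → Pred (Setoid.Carrier A) p → Setoid (c ⊔ p) ℓ
SubSetoid A Q = On.setoid {B = ∃ Q} A proj₁

-- The value 0 of the matrix stands for ∞; the corresponding relator is then
-- the empty word, i.e. there is no relation.
record IsCoxeterMatrix {a} {S : Set a} (m : S → S → ℕ) : Set a where
  field
    symmetric : ∀ s t → m s t ≡ m t s
    diagonal  : ∀ s t → m s t ≡ 1 ⇔ s ≡ t

module Presentation {a} {S : Set a} (m : S → S → ℕ) where

  relator : S → S → List S
  relator s t = concat (replicate (m s t) (s ∷ t ∷ []))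

  data Deletes : Rel (List S) a where
    delete : ∀ u s t v → Deletes (u ++ relator s t ++ v) (u ++ v)

  infix 4 _∼_

  _∼_ : Rel (List S) a
  _∼_ = EqClosure Deletes

-- `presented` says that W is the group ⟨ S ∣ (st)^m(s,t) = 1 ⟩.  Words in S
-- without formal inverses suffice, because s ∷ s ∷ [] is a relator.
record CoxeterSystem c ℓ a : Set (suc (c ⊔ ℓ ⊔ a)) where
  field
    W               : Group c ℓ
    S               : Set a
    gen             : S → Group.Carrier W
    m               : S → S → ℕ
    isCoxeterMatrix : IsCoxeterMatrix m

  open Group W public using (_≈_; _∙_; ε; setoid) renaming (Carrier to Element)
  open Presentation m public

  ⟨_⟩ : List S → Element
  ⟨ u ⟩ = foldr _∙_ ε (map gen u)

  field
    generated : ∀ w → ∃[ u ] ⟨ u ⟩ ≈ w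
    presented : ∀ u v → ⟨ u ⟩ ≈ ⟨ v ⟩ ⇔ u ∼ v

  -- The graph of the length function: `HasLength w k` means ℓ(w) = k.
  HasLength : Element → ℕ → Set (ℓ ⊔ a)
  HasLength w k =
    (∃[ u ] ⟨ u ⟩ ≈ w × length u ≡ k) × (∀ u → ⟨ u ⟩ ≈ w → k ℕ.≤ length u)

  Reduced : List S → Set (ℓ ⊔ a)
  Reduced u = HasLength ⟨ u ⟩ (length u)

record IndexSet : Set where
  constructor indexSet
  field
    indices    : List ℕ
    increasing : Linked _<_ indices

open IndexSet public

IsLeast : ∀ {p} → Pred ℕ p → ℕ → Set p
IsLeast Q i = i ∈ Q × (∀ j → j ∈ Q → i ℕ.≤ j)

infix 4 _≤lex_

_≤lex_ : Rel IndexSet _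
A ≤lex B =
  indices A ≡ indices B ⊎
  ∃[ i ] IsLeast ((elems A ∪ elems B) ∖ (elems A ∩ elems B)) i × i ∈ elems A
  where
  elems : IndexSet → Pred ℕ _
  elems C = _∈ˡ indices C

-- The semi-infinite word is indexed from 0: `ω i` is the letter ω_{i+1}.
module SortingOrder {c ℓ a} (X : CoxeterSystem c ℓ a) (ω : ℕ → CoxeterSystem.S X) where
  open CoxeterSystem X

  subword : IndexSet → List S
  subword A = map ω (indices A)

  Occurs : Pred Element ℓ
  Occurs w = ∃[ A ] ⟨ subword A ⟩ ≈ w

  occurring : Setoid (c ⊔ ℓ) ℓ
  occurring = SubSetoid setoid Occurs

  Sorted : Pred IndexSet (ℓ ⊔ a)
  Sorted A =
    Reduced (subword A) ×
    (∀ B → Reduced (subword B) → ⟨ subword B ⟩ ≈ ⟨ subword A ⟩ → A ≤lex B)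

  P : Set (ℓ ⊔ a)
  P = ∃ Sorted

  infix 4 _≈ω_ _≤ω_

  _≈ω_ : Rel P _
  _≈ω_ = _≡_ on λ α → indices (proj₁ α)

  _≤ω_ : Rel P _
  _≤ω_ = ListSubset._⊆_ on λ α → indices (proj₁ α)

module _ {c ℓ₁ ℓ₂} (L : Lattice c ℓ₁ ℓ₂) where
  open Lattice L

  sublattice : ∀ {q} (Q : Pred Carrier q) →
               (∀ {x y} → x ∈ Q → y ∈ Q → x ∨ y ∈ Q) →
               (∀ {x y} → x ∈ Q → y ∈ Q → x ∧ y ∈ Q) →
               Lattice (c ⊔ q) ℓ₁ ℓ₂
  sublattice Q ∨-closed ∧-closed = record
    { Carrier   = ∃ Q
    ; _≈_       = _≈_ on proj₁
    ; _≤_       = _≤_ on proj₁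
    ; _∨_       = λ (x , x∈Q) (y , y∈Q) → x ∨ y , ∨-closed x∈Q y∈Q
    ; _∧_       = λ (x , x∈Q) (y , y∈Q) → x ∧ y , ∧-closed x∈Q y∈Q
    ; isLattice = record
      { isPartialOrder = On.isPartialOrder proj₁ isPartialOrder
      ; supremum       = λ (x , _) (y , _) →
          x≤x∨y x y , y≤x∨y x y , λ _ → ∨-least
      ; infimum        = λ (x , _) (y , _) →
          x∧y≤x x y , x∧y≤y x y , λ _ → ∧-greatest
      }
    }

  interval : Carrier → Carrier → Lattice (c ⊔ ℓ₂) ℓ₁ ℓ₂
  interval x y = sublattice (λ z → x ≤ z × z ≤ y)
    (λ {u} {v} (x≤u , u≤y) (x≤v , v≤y) → trans x≤u (x≤x∨y u v) , ∨-least u≤y v≤y)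
    (λ {u} {v} (x≤u , u≤y) (x≤v , v≤y) → ∧-greatest x≤u x≤v , trans (x∧y≤x u v) u≤y)

  data Generated {q} (Q : Pred Carrier q) : Pred Carrier (c ⊔ ℓ₁ ⊔ q) where
    incl : ∀ {x} → x ∈ Q → Generated Q x
    join : ∀ {x y} → Generated Q x → Generated Q y → Generated Q (x ∨ y)
    meet : ∀ {x y} → Generated Q x → Generated Q y → Generated Q (x ∧ y)
    resp : ∀ {x y} → x ≈ y → Generated Q x → Generated Q y

  generatedSublattice : ∀ {q} → Pred Carrier q → Lattice (c ⊔ ℓ₁ ⊔ q) ℓ₁ ℓ₂
  generatedSublattice Q = sublattice (Generated Q) join meet

  LocallyFinite : Set (c ⊔ ℓ₁ ⊔ ℓ₂)
  LocallyFinite = ∀ x y → x ≤ y → Finite (Lattice.setoid (interval x y))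

  IsDistributive : Set (c ⊔ ℓ₁ ⊔ ℓ₂)
  IsDistributive = IsDistributiveLattice _≈_ _≤_ _∨_ _∧_

  IsBoolean : Set (c ⊔ ℓ₁ ⊔ ℓ₂)
  IsBoolean =
    ∃[ n ] Σ[ f ∈ (Carrier → Subset n) ] IsOrderIsomorphism _≈_ _≡_ _≤_ Subset._⊆_ f

  Sub : Set (suc (c ⊔ ℓ₁ ⊔ ℓ₂))
  Sub = Pred Carrier (c ⊔ ℓ₁ ⊔ ℓ₂)

  IsChain : Sub → Set (c ⊔ ℓ₁ ⊔ ℓ₂)
  IsChain C = ∀ x y → x ∈ C → y ∈ C → x ≤ y ⊎ y ≤ x

  IsMaximalChain : Sub → Set (suc (c ⊔ ℓ₁ ⊔ ℓ₂))
  IsMaximalChain C = IsChain C × (∀ (D : Sub) → IsChain D → C ⊆ D → D ⊆ C)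

  infix 4 _≺_ _⋖_

  _≺_ : Rel Carrier (ℓ₁ ⊔ ℓ₂)
  x ≺ y = x ≤ y × ¬ (x ≈ y)

  _⋖_ : Rel Carrier (c ⊔ ℓ₁ ⊔ ℓ₂)
  x ⋖ y = x ≺ y × ¬ (∃[ z ] x ≺ z × z ≺ y)

  IsJoin : Sub → Carrier → Set (c ⊔ ℓ₁ ⊔ ℓ₂)
  IsJoin Y j = (∀ y → y ∈ Y → y ≤ j) × (∀ z → (∀ y → y ∈ Y → y ≤ z) → j ≤ z)

-- The condition x ≤ j, needed for [x , j] to be an interval, is automatic
-- unless Y is empty.
JoinDistributive : ∀ {c ℓ₁ ℓ₂} → Lattice c ℓ₁ ℓ₂ → Set (suc (c ⊔ ℓ₁ ⊔ ℓ₂))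
JoinDistributive L =
  ∀ x (Y : Sub L) → (∀ y → y ∈ Y → _⋖_ L x y) →
  ∀ j → IsJoin L Y j → x ≤ j → IsBoolean (interval L x j)
  where open Lattice L

SupersolvableFinite : ∀ {c ℓ₁ ℓ₂} → Lattice c ℓ₁ ℓ₂ → Set (suc (c ⊔ ℓ₁ ⊔ ℓ₂))
SupersolvableFinite L =
  Finite (Lattice.setoid L) ×
  Σ[ M ∈ Sub L ] IsMaximalChain L M ×
    (∀ (C : Sub L) → IsMaximalChain L C →
      IsDistributive (generatedSublattice L (M ∪ C)))

Supersolvable : ∀ {c ℓ₁ ℓ₂} → Lattice c ℓ₁ ℓ₂ → Set (suc (c ⊔ ℓ₁ ⊔ ℓ₂))
Supersolvable L = ∀ x y → x ≤ y → SupersolvableFinite (interval L x y)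
  where open Lattice L

{-# OPTIONS --safe #-}

-- The sorted index sets form a supersolvable antimatroid: if A, B are sorted and
-- x = min (B ∖ A), then A ∪ {x} is sorted.  This makes joins unions, the sets
-- x ∪ (y ∩ [0 , k)) a modular maximal chain of [x , y], and every interval
-- generated by atoms boolean.
--
-- The antimatroid axiom rests on two facts.  A is sorted iff, for every
-- position k, prefixing ω k to the subword of A beyond k gives a reduced word;
-- and if s u x, s u v and u x v are reduced (s, x letters), so is s u x v.  The
-- latter follows from the exchange condition, which holds because the list of
-- reflections of a word is, modulo 2, an invariant of the group element.
--
-- Everything must be decided constructively, so one has to decide whether a
-- word is reduced.  Stripping letters s, t from a reduced word reduces this to
-- dihedral subgroups, where one needs that s t has order exactly m(s,t).  That
-- comes from the reflection representation, with 2cos(π/m) replaced by the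
-- adjacency operator of a path with m − 1 vertices, which makes it integral.

module Submission where

open import Defs
open import Level using (_⊔_; 0ℓ)
open import Data.Nat.Base using (ℕ)
open import Data.Product.Base using (_×_; Σ)
open import Algebra.Core using (Op₂)
open import Relation.Binary.Lattice.Bundles using (Lattice)
open import Relation.Binary.Lattice.Structures using (IsLattice)

open import Level using (Lift; lift)
open import Algebra.Bundles using (Group; CommutativeMonoid)
import Algebra.Properties.CommutativeSemigroup as CommutativeSemigroupProperties
import Algebra.Properties.Group as GroupProperties
open import Data.Bool.Base using (true; false; if_then_else_)
open import Data.Empty using (⊥; ⊥-elim)
open import Data.Empty.Polymorphic using () renaming (⊥ to ⊥ᴸ)
import Data.Fin.Base as Fin
open import Data.Fin.Properties using (any?)
open import Data.Fin.Subset as Subset using (Subset)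
import Data.Fin.Subset.Properties as Subset
open import Data.Integer.Base using (ℤ; -_; 0ℤ; 1ℤ) renaming (_+_ to _+ᶻ_; _*_ to _*ᶻ_; _-_ to _-ᶻ_)
import Data.Integer.Properties as ℤ
open import Data.Integer.Tactic.RingSolver using (solve-∀)
open import Data.List.Base
  using (List; []; _∷_; _++_; map; foldr; length; filter; upTo; lookup; concat; replicate)
import Data.List.Membership.Setoid as Membership
open import Data.List.Membership.Propositional using (_∈_; lose)
open import Data.List.Membership.Propositional.Properties
  using (∈-filter⁺; ∈-filter⁻; ∈-upTo⁺; ∈-map⁺; ∈-++⁺ˡ; ∈-++⁺ʳ; ∈-++⁻; ∈-lookup)
import Data.List.Properties as List
import Data.List.Relation.Binary.Equality.Setoid as ListEquality
import Data.List.Relation.Binary.Permutation.Setoid as Permutation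
import Data.List.Relation.Binary.Permutation.Setoid.Properties as PermutationProperties
open import Data.List.Relation.Binary.Pointwise using (Pointwise; []; _∷_)
open import Data.List.Relation.Binary.Sublist.Propositional using (_⊆_; []; _∷_; _∷ʳ_; ⊆-refl)
import Data.List.Relation.Binary.Sublist.Propositional.Properties as Sublist
open import Data.List.Relation.Unary.All as All using (All; []; _∷_)
import Data.List.Relation.Unary.All.Properties as All
open import Data.List.Relation.Unary.AllPairs as AllPairs using (AllPairs; []; _∷_)
import Data.List.Relation.Unary.AllPairs.Properties as AllPairs
open import Data.List.Relation.Unary.Any as Any using (Any; here; there)
import Data.List.Relation.Unary.Any.Properties as Any
open import Data.List.Relation.Unary.Linked as Linked using (Linked; []; _∷_)
import Data.List.Relation.Unary.Linked.Properties as Linked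
open import Data.List.Reverse using (Reverse; []; _∶_∶ʳ_; reverseView)
open import Data.Nat.Base as ℕ using (zero; suc; _+_; _*_; _∸_; _<_; _≤_; s≤s; z≤n)
open import Data.Nat.Divisibility using (_∣_; _∣?_; ∣m+n∣m⇒∣n; ∣⇒≤; ∣-refl; ∣m∣n⇒∣m+n; 0∣⇒≡0; _∣0)
import Data.Nat.Properties as ℕ
open import Data.List.Membership.DecPropositional ℕ._≟_ using (_∈?_)
open import Data.Product.Base using (_,_; ∃; ∃₂; ∃-syntax; proj₁; proj₂)
open import Data.Sum.Base using (_⊎_; inj₁; inj₂; [_,_]′)
open import Data.Vec.Base using (tabulate)
import Data.Vec.Properties as Vec
open import Function.Base using (_∘_; id; _on_)
open import Function.Bundles using (Equivalence)
open import Relation.Binary.Bundles using (Setoid)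
import Relation.Binary.Construct.Closure.Equivalence as EqClosure
open import Relation.Binary.Core using (Rel)
open import Relation.Binary.Definitions using (DecidableEquality; tri<; tri≈; tri>)
  renaming (Decidable to Decidable₂)
open import Relation.Binary.PropositionalEquality as ≡
  using (_≡_; _≢_; _≗_; refl; sym; trans; cong; cong₂; subst; module ≡-Reasoning)
open import Relation.Nullary using (¬_; Dec; yes; no; does; contradiction)
open import Relation.Nullary.Decidable using (_×-dec_; _⊎-dec_; map′; dec-true; ¬?)
open import Relation.Unary using (Pred; Decidable)

-- Sets of natural numbers

-- Decidability enters through the meet. The intersection of two sorted sets need not be sorted, so
-- the meet has to be the join of all common lower bounds, and these must be listed. Equality in W
-- is not decidable at the outset, so occurrences of a reflection in a list cannot be counted or
-- searched for: repetitions are always produced as witnesses, and reducedness is decided letter by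
-- letter through descents.
--
-- The path enters because its adjacency operator on m - 1 vertices has the eigenvalues 2cos(kπ/m),
-- 0 < k < m. Its characteristic polynomial is a Chebyshev polynomial; that this polynomial kills
-- the operator gives (st)^m = 1, and reading the lower ones at an end of the path shows that no
-- smaller power is trivial. The operators belonging to different pairs of generators need not
-- commute. This does no harm: along a word in s and t only the operator of the pair s, t is
-- iterated, while a third coordinate merely accumulates sums to which its own operators are applied
-- once.

infix 4 _∈ⁱ_ _∉ⁱ_ _⊑_

_∈ⁱ_ _∉ⁱ_ : ℕ → IndexSet → Set
i ∈ⁱ A = i ∈ indices A
i ∉ⁱ A = ¬ i ∈ⁱ A

_⊑_ : Rel IndexSet 0ℓ
A ⊑ B = ∀ {i} → i ∈ⁱ A → i ∈ⁱ B

∈⇒≥head : ∀ {x xs i} → Linked _<_ (x ∷ xs) → i ∈ x ∷ xs → x ≤ i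
∈⇒≥head _             (here refl) = ℕ.≤-refl
∈⇒≥head (x<y ∷ lnk) (there i∈)  = ℕ.≤-trans (ℕ.<⇒≤ x<y) (∈⇒≥head lnk i∈)

∈-tail⇒>head : ∀ {x xs i} → Linked _<_ (x ∷ xs) → i ∈ xs → x < i
∈-tail⇒>head (x<y ∷ lnk) i∈ = ℕ.<-≤-trans x<y (∈⇒≥head lnk i∈)

⊆-antisym-increasing : ∀ {xs ys} → Linked _<_ xs → Linked _<_ ys →
  (∀ {i} → i ∈ xs → i ∈ ys) → (∀ {i} → i ∈ ys → i ∈ xs) → xs ≡ ys
⊆-antisym-increasing {[]}     {[]}     _ _ _ _ = refl
⊆-antisym-increasing {[]}     {y ∷ ys} _ _ _ ys⊆xs with () ← ys⊆xs (here refl)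
⊆-antisym-increasing {x ∷ xs} {[]}     _ _ xs⊆ys _ with () ← xs⊆ys (here refl)
⊆-antisym-increasing {x ∷ xs} {y ∷ ys} lx ly xs⊆ys ys⊆xs
  with refl ← ℕ.≤-antisym (∈⇒≥head lx (ys⊆xs (here refl))) (∈⇒≥head ly (xs⊆ys (here refl)))
  = cong (x ∷_) (⊆-antisym-increasing (Linked.tail lx) (Linked.tail ly)
      (λ i∈ → strip (∈-tail⇒>head lx i∈) (xs⊆ys (there i∈)))
      (λ i∈ → strip (∈-tail⇒>head ly i∈) (ys⊆xs (there i∈))))
  where
  strip : ∀ {i zs} → x < i → i ∈ x ∷ zs → i ∈ zs
  strip x<i (here refl) = contradiction x<i (ℕ.<-irrefl refl)
  strip x<i (there i∈)  = i∈

⊑-antisym : ∀ {A B} → A ⊑ B → B ⊑ A → indices A ≡ indices B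
⊑-antisym {A} {B} = ⊆-antisym-increasing (increasing A) (increasing B)

bound : IndexSet → ℕ
bound A = foldr (λ i n → suc i ℕ.⊔ n) 0 (indices A)

∈⇒<bound : ∀ {i} A → i ∈ⁱ A → i < bound A
∈⇒<bound A = go (indices A)
  where
  go : ∀ {i} xs → i ∈ xs → i < foldr (λ i n → suc i ℕ.⊔ n) 0 xs
  go (x ∷ xs) (here refl) = ℕ.m≤m⊔n (suc x) (foldr (λ i n → suc i ℕ.⊔ n) 0 xs)
  go (x ∷ xs) (there i∈)  = ℕ.<-≤-trans (go xs i∈) (ℕ.m≤n⊔m (suc x) _)

lookup-injective : ∀ {xs} → Linked _<_ xs → ∀ k l → lookup xs k ≡ lookup xs l → k ≡ l
lookup-injective {_ ∷ _}  lnk Fin.zero    Fin.zero    _  = refl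
lookup-injective {_ ∷ xs} lnk Fin.zero    (Fin.suc l) eq =
  contradiction (∈-tail⇒>head lnk (∈-lookup {xs = xs} l)) (ℕ.<-irrefl eq)
lookup-injective {_ ∷ xs} lnk (Fin.suc k) Fin.zero    eq =
  contradiction (∈-tail⇒>head lnk (∈-lookup {xs = xs} k)) (ℕ.<-irrefl (sym eq))
lookup-injective {_ ∷ _}  lnk (Fin.suc k) (Fin.suc l) eq =
  cong Fin.suc (lookup-injective (Linked.tail lnk) k l eq)

upTo-increasing : ∀ n → Linked _<_ (upTo n)
upTo-increasing n = Linked.applyUpTo⁺₂ id n (λ i → ℕ.n<1+n i)

module _ {q} {Q : Pred ℕ q} (Q? : Decidable Q) where

  ⟪_⟫< : ℕ → IndexSet
  ⟪_⟫< n = indexSet (filter Q? (upTo n)) (Linked.filter⁺ Q? ℕ.<-trans (upTo-increasing n))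

  ∈-⟪⟫⁺ : ∀ {i n} → i < n → Q i → i ∈ⁱ ⟪_⟫< n
  ∈-⟪⟫⁺ i<n Qi = ∈-filter⁺ Q? (∈-upTo⁺ i<n) Qi

  ∈-⟪⟫⁻ : ∀ {i n} → i ∈ⁱ ⟪_⟫< n → Q i
  ∈-⟪⟫⁻ {n = n} i∈ = proj₂ (∈-filter⁻ Q? {xs = upTo n} i∈)

-- This is A ∪ (B ∩ [0 , k)). As k rises from 0 to `bound B` it leads from A to A ∪ B by insertions
-- in increasing order, the order that the exchange axiom requires.
grow : IndexSet → IndexSet → ℕ → IndexSet
grow A B k = ⟪ (λ i → i ∈? indices A ⊎-dec (i ∈? indices B ×-dec i ℕ.<? k)) ⟫< (bound A ℕ.⊔ bound B)

module _ {A B : IndexSet} {k i : ℕ} where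

  ∈-grow⁻ : i ∈ⁱ grow A B k → i ∈ⁱ A ⊎ (i ∈ⁱ B × i < k)
  ∈-grow⁻ = ∈-⟪⟫⁻ (λ i → i ∈? indices A ⊎-dec (i ∈? indices B ×-dec i ℕ.<? k)) {n = bound A ℕ.⊔ bound B}

  ∈-grow⁺ˡ : i ∈ⁱ A → i ∈ⁱ grow A B k
  ∈-grow⁺ˡ i∈A = ∈-⟪⟫⁺ _ (ℕ.<-≤-trans (∈⇒<bound A i∈A) (ℕ.m≤m⊔n _ _)) (inj₁ i∈A)

  ∈-grow⁺ʳ : i ∈ⁱ B → i < k → i ∈ⁱ grow A B k
  ∈-grow⁺ʳ i∈B i<k = ∈-⟪⟫⁺ _ (ℕ.<-≤-trans (∈⇒<bound B i∈B) (ℕ.m≤n⊔m (bound A) _)) (inj₂ (i∈B , i<k))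

insert : IndexSet → ℕ → IndexSet
insert A e = ⟪ (λ i → i ∈? indices A ⊎-dec i ℕ.≟ e) ⟫< (bound A ℕ.⊔ suc e)

module _ {A : IndexSet} {e : ℕ} where

  ∈-insert⁻ : ∀ {i} → i ∈ⁱ insert A e → i ∈ⁱ A ⊎ i ≡ e
  ∈-insert⁻ = ∈-⟪⟫⁻ (λ i → i ∈? indices A ⊎-dec i ℕ.≟ e) {n = bound A ℕ.⊔ suc e}

  ∈-insert⁺ˡ : A ⊑ insert A e
  ∈-insert⁺ˡ i∈A = ∈-⟪⟫⁺ _ (ℕ.<-≤-trans (∈⇒<bound A i∈A) (ℕ.m≤m⊔n _ _)) (inj₁ i∈A)

  ∈-insert⁺ʳ : e ∈ⁱ insert A e
  ∈-insert⁺ʳ = ∈-⟪⟫⁺ _ (ℕ.m≤n⊔m (bound A) (suc e)) (inj₂ refl)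

grow-mono : ∀ {A B k l} → k ≤ l → grow A B k ⊑ grow A B l
grow-mono {A} {B} k≤l i∈ with ∈-grow⁻ {A} {B} i∈
... | inj₁ i∈A         = ∈-grow⁺ˡ {A} {B} i∈A
... | inj₂ (i∈B , i<k) = ∈-grow⁺ʳ {A} {B} i∈B (ℕ.<-≤-trans i<k k≤l)

grow-suc⁻ : ∀ {A B k i} → i ∈ⁱ grow A B (suc k) → i ∈ⁱ grow A B k ⊎ (i ≡ k × k ∈ⁱ B)
grow-suc⁻ {A} {B} i∈ with ∈-grow⁻ {A} {B} i∈
... | inj₁ i∈A = inj₁ (∈-grow⁺ˡ {A} {B} i∈A)
... | inj₂ (i∈B , s≤s i≤k) with ℕ.m≤n⇒m<n∨m≡n i≤k
...   | inj₁ i<k  = inj₁ (∈-grow⁺ʳ {A} {B} i∈B i<k)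
...   | inj₂ refl = inj₂ (refl , i∈B)

module _ {p} (F : Pred IndexSet p) (F-resp : ∀ {A B} → indices A ≡ indices B → F A → F B) where

  resp-⊑ : ∀ {A B} → A ⊑ B → B ⊑ A → F A → F B
  resp-⊑ {A} {B} A⊑B B⊑A = F-resp (⊑-antisym {A} {B} A⊑B B⊑A)

  -- Raising k by one either changes nothing or inserts k, so only genuine insertions have to be
  -- treated.
  grow-induction : ∀ A B → F A →
    (∀ k → k ∈ⁱ B → k ∉ⁱ grow A B k → F (grow A B k) → F (insert (grow A B k) k)) →
    ∀ k → F (grow A B k)
  grow-induction A B FA step zero = resp-⊑ {A} {grow A B zero} (∈-grow⁺ˡ {A} {B})
    (λ i∈ → [ id , (λ ()) ]′ (∈-grow⁻ {A} {B} i∈)) FA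
  grow-induction A B FA step (suc k) with k ∈? indices B | k ∈? indices (grow A B k)
  ... | yes k∈B | no k∉ = resp-⊑ {insert G k} {grow A B (suc k)}
    (λ i∈ → [ grow-mono {A} {B} (ℕ.n≤1+n k) , (λ { refl → ∈-grow⁺ʳ {A} {B} k∈B (ℕ.n<1+n k) }) ]′ (∈-insert⁻ {G} {k} i∈))
    (λ i∈ → [ ∈-insert⁺ˡ {G} {k} , (λ { (refl , _) → ∈-insert⁺ʳ {G} {k} }) ]′ (grow-suc⁻ {A} {B} {k} i∈))
    (step k k∈B k∉ (grow-induction A B FA step k))
    where
    G : IndexSet
    G = grow A B k
  ... | yes k∈B | yes k∈ = resp-⊑ {grow A B k} {grow A B (suc k)} (grow-mono {A} {B} (ℕ.n≤1+n k))
    (λ i∈ → [ id , (λ { (refl , _) → k∈ }) ]′ (grow-suc⁻ {A} {B} {k} i∈))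
    (grow-induction A B FA step k)
  ... | no k∉B | _ = resp-⊑ {grow A B k} {grow A B (suc k)} (grow-mono {A} {B} (ℕ.n≤1+n k))
    (λ i∈ → [ id , (λ { (refl , k∈B) → contradiction k∈B k∉B }) ]′ (grow-suc⁻ {A} {B} {k} i∈))
    (grow-induction A B FA step k)

-- Listing sublists and the elements with a decidable property

subs : ∀ {a} {A : Set a} → List A → List (List A)
subs []       = [] ∷ []
subs (x ∷ xs) = map (x ∷_) (subs xs) ++ subs xs

filter∈subs : ∀ {a p} {A : Set a} {Q : Pred A p} (Q? : Decidable Q) xs → filter Q? xs ∈ subs xs
filter∈subs Q? []       = here refl
filter∈subs Q? (x ∷ xs) with does (Q? x)
... | true  = ∈-++⁺ˡ (∈-map⁺ (x ∷_) (filter∈subs Q? xs))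
... | false = ∈-++⁺ʳ (map (x ∷_) (subs xs)) (filter∈subs Q? xs)

module _ {a p} {A : Set a} {Q : Pred A p} (Q? : Decidable Q) where

  filterΣ : List A → List (∃ Q)
  filterΣ [] = []
  filterΣ (x ∷ xs) with Q? x
  ... | yes q = (x , q) ∷ filterΣ xs
  ... | no  _ = filterΣ xs

  -- R speaks of the element alone, because the proof stored by `Q?` need not be the one given.
  ∈-filterΣ : ∀ {r} {R : Pred A r} {xs} → Any (λ x → Q x × R x) xs → Any (R ∘ proj₁) (filterΣ xs)
  ∈-filterΣ {xs = x ∷ xs} any with Q? x
  ∈-filterΣ (here (_ , r)) | yes _ = here r
  ∈-filterΣ (there any)    | yes _ = there (∈-filterΣ any)
  ∈-filterΣ (here (q , _)) | no ¬q = contradiction q ¬q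
  ∈-filterΣ (there any)    | no _  = ∈-filterΣ any

-- Increasing lists

Increasing : List ℕ → Set
Increasing = Linked _<_

below above : ℕ → List ℕ → List ℕ
below k = filter (ℕ._<? k)
above k = filter (k ℕ.<?_)

below-increasing : ∀ k {xs} → Increasing xs → Increasing (below k xs)
below-increasing k = Linked.filter⁺ (ℕ._<? k) ℕ.<-trans

above-increasing : ∀ k {xs} → Increasing xs → Increasing (above k xs)
above-increasing k = Linked.filter⁺ (k ℕ.<?_) ℕ.<-trans

∈-below⁺ : ∀ {k i xs} → i ∈ xs → i < k → i ∈ below k xs
∈-below⁺ {k} = ∈-filter⁺ (ℕ._<? k)

∈-below⁻ : ∀ {k i} xs → i ∈ below k xs → i ∈ xs × i < k
∈-below⁻ {k} xs = ∈-filter⁻ (ℕ._<? k) {xs = xs}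

∈-above⁺ : ∀ {k i xs} → i ∈ xs → k < i → i ∈ above k xs
∈-above⁺ {k} = ∈-filter⁺ (k ℕ.<?_)

∈-above⁻ : ∀ {k i} xs → i ∈ above k xs → i ∈ xs × k < i
∈-above⁻ {k} xs = ∈-filter⁻ (k ℕ.<?_) {xs = xs}

above-all : ∀ {k xs} → All (k <_) xs → above k xs ≡ xs
above-all {k} = List.filter-all (k ℕ.<?_)

above-∷ : ∀ {k x} xs → x ≤ k → above k (x ∷ xs) ≡ above k xs
above-∷ {k} xs x≤k = List.filter-reject (k ℕ.<?_) (ℕ.≤⇒≯ x≤k)

increasing-head : ∀ {x xs} → Increasing (x ∷ xs) → All (x <_) xs
increasing-head lnk = All.tabulate (∈-tail⇒>head lnk)

increasing-⊆ : ∀ {xs ys} → xs ⊆ ys → Increasing ys → Increasing xs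
increasing-⊆ sub = Linked.AllPairs⇒Linked ∘ go sub ∘ Linked.Linked⇒AllPairs ℕ.<-trans
  where
  go : ∀ {xs ys} → xs ⊆ ys → AllPairs _<_ ys → AllPairs _<_ xs
  go []           _        = []
  go (_ ∷ʳ sub)   (_ ∷ ps) = go sub ps
  go (refl ∷ sub) (p ∷ ps) = Sublist.All-resp-⊆ sub p ∷ go sub ps

increasing-++∷ : ∀ {k xs ys} → Increasing xs → All (_< k) xs → Increasing ys → All (k <_) ys → Increasing (xs ++ k ∷ ys)
increasing-++∷ inc-xs xs<k inc-ys k<ys = Linked.AllPairs⇒Linked (AllPairs.++⁺
  (Linked.Linked⇒AllPairs ℕ.<-trans inc-xs) (k<ys ∷ Linked.Linked⇒AllPairs ℕ.<-trans inc-ys)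
  (All.map (λ x<k → x<k ∷ All.map (ℕ.<-trans x<k) k<ys) xs<k))

split-∈ : ∀ {k xs} → Increasing xs → k ∈ xs → xs ≡ below k xs ++ k ∷ above k xs
split-∈ {k} {xs} inc k∈ = ⊆-antisym-increasing inc
  (increasing-++∷ (below-increasing k inc) (All.tabulate (proj₂ ∘ ∈-below⁻ xs)) (above-increasing k inc) (All.tabulate (proj₂ ∘ ∈-above⁻ xs)))
  to (λ i∈ → [ proj₁ ∘ ∈-below⁻ xs , (λ { (here refl) → k∈ ; (there i∈) → proj₁ (∈-above⁻ xs i∈) }) ]′ (∈-++⁻ (below k xs) i∈))
  where
  to : ∀ {i} → i ∈ xs → i ∈ below k xs ++ k ∷ above k xs
  to {i} i∈ with ℕ.<-cmp i k
  ... | tri< i<k _ _  = ∈-++⁺ˡ (∈-below⁺ i∈ i<k)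
  ... | tri≈ _ refl _ = ∈-++⁺ʳ (below k xs) (here refl)
  ... | tri> _ _ k<i  = ∈-++⁺ʳ (below k xs) (there (∈-above⁺ i∈ k<i))

split-∉ : ∀ {k xs} → Increasing xs → ¬ k ∈ xs → xs ≡ below k xs ++ above k xs
split-∉ {k} {[]}     _   _  = refl
split-∉ {k} {x ∷ xs} inc k∉ with ℕ.<-cmp x k
... | tri≈ _ refl _ = contradiction (here refl) k∉
... | tri< x<k _ _ = ≡.trans (≡.cong (x ∷_) (split-∉ (Linked.tail inc) (k∉ ∘ there)))
  (≡.sym (≡.cong₂ _++_ (List.filter-accept (ℕ._<? k) x<k) (above-∷ xs (ℕ.<⇒≤ x<k))))
... | tri> x≮k _ k<x = ≡.sym (≡.cong₂ _++_
  (List.filter-none (ℕ._<? k) (x≮k ∷ All.map (λ x<y y<k → x≮k (ℕ.<-trans x<y y<k)) (increasing-head inc)))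
  (above-all (k<x ∷ All.map (ℕ.<-trans k<x) (increasing-head inc))))

⊆-map⁻ : ∀ {a b} {A : Set a} {B : Set b} (f : A → B) xs {ys} → ys ⊆ map f xs → ∃[ zs ] zs ⊆ xs × ys ≡ map f zs
⊆-map⁻ f []       []           = [] , [] , refl
⊆-map⁻ f (x ∷ xs) (_ ∷ʳ sub)   with zs , sub′ , eq ← ⊆-map⁻ f xs sub = zs , x ∷ʳ sub′ , eq
⊆-map⁻ f (x ∷ xs) (refl ∷ sub) with zs , sub′ , eq ← ⊆-map⁻ f xs sub = x ∷ zs , refl ∷ sub′ , ≡.cong (f x ∷_) eq

⊆-++⁻ : ∀ {a} {A : Set a} (xs : List A) {ys zs} → zs ⊆ xs ++ ys →
  ∃₂ λ xs′ ys′ → zs ≡ xs′ ++ ys′ × xs′ ⊆ xs × ys′ ⊆ ys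
⊆-++⁻ []       sub = [] , _ , refl , [] , sub
⊆-++⁻ (x ∷ xs) (.x ∷ʳ sub) with xs′ , ys′ , eq , p , q ← ⊆-++⁻ xs sub = xs′ , ys′ , eq , x ∷ʳ p , q
⊆-++⁻ (x ∷ xs) (refl ∷ sub) with xs′ , ys′ , eq , p , q ← ⊆-++⁻ xs sub =
  x ∷ xs′ , ys′ , ≡.cong (x ∷_) eq , refl ∷ p , q

⊆-length-≡ : ∀ {a} {A : Set a} {xs ys : List A} → xs ⊆ ys → length ys ≤ length xs → xs ≡ ys
⊆-length-≡ []           _  = refl
⊆-length-≡ (y ∷ʳ sub)   le = contradiction le (ℕ.<⇒≱ (s≤s (Sublist.length-mono-≤ sub)))
⊆-length-≡ (refl ∷ sub) (s≤s le) = ≡.cong (_ ∷_) (⊆-length-≡ sub le)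

-- The axiom `exchange` is what makes an antimatroid supersolvable.
module Antimatroid {p} (F : Pred IndexSet p) (F? : Decidable F)
  (F-resp   : ∀ {A B} → indices A ≡ indices B → F A → F B)
  (F-empty  : ∀ A → (∀ {i} → i ∉ⁱ A) → F A)
  (exchange : ∀ {A B} → F A → F B → ∀ x → x ∈ⁱ B → x ∉ⁱ A →
              (∀ {y} → y ∈ⁱ B → y < x → y ∈ⁱ A) → F (insert A x))
  where

  -- At stage k all elements of B below k have been added already, so a new k is the least element
  -- of B outside the current set and `exchange` applies.
  grow-F : ∀ {A B} → F A → F B → ∀ k → F (grow A B k)
  grow-F {A} {B} FA FB = grow-induction F F-resp A B FA
    λ k k∈B k∉ FG → exchange {grow A B k} {B} FG FB k k∈B k∉ λ y∈B y<k → ∈-grow⁺ʳ {A} {B} y∈B y<k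

  -- The lattice of feasible sets

  P : Set p
  P = ∃ F

  infix 4 _≈_ _≼_ _∈ᴾ_ _≼?_

  _≈_ _≼_ : Rel P 0ℓ
  _≈_ = _≡_ on (indices ∘ proj₁)
  _≼_ = (λ xs ys → ∀ {i} → i ∈ xs → i ∈ ys) on (indices ∘ proj₁)

  _∈ᴾ_ : ℕ → P → Set
  i ∈ᴾ z = i ∈ⁱ proj₁ z

  _≼?_ : Decidable₂ _≼_
  (A , _) ≼? (B , _) = map′ (λ all → All.lookup all) All.tabulate (All.all? (_∈? indices B) (indices A))

  ≼-antisym : ∀ {x y} → x ≼ y → y ≼ x → x ≈ y
  ≼-antisym {x} {y} = ⊑-antisym {proj₁ x} {proj₁ y}

  ≈⇒≼ : ∀ {x y} → x ≈ y → x ≼ y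
  ≈⇒≼ x≈y = subst (_ ∈_) x≈y

  ≼-respˡ : ∀ {w z x} → z ≈ w → z ≼ x → w ≼ x
  ≼-respˡ {w} {z} z≈w z≼x i∈w = z≼x (≈⇒≼ {w} {z} (sym z≈w) i∈w)

  infixr 6 _∨_
  infixr 7 _∧_

  _∨_ : P → P → P
  (A , FA) ∨ (B , FB) = grow A B (bound B) , grow-F FA FB (bound B)

  module _ {x y : P} {i : ℕ} where

    ∈-∨⁻ : i ∈ᴾ x ∨ y → i ∈ᴾ x ⊎ i ∈ᴾ y
    ∈-∨⁻ i∈ = [ inj₁ , inj₂ ∘ proj₁ ]′ (∈-grow⁻ {proj₁ x} {proj₁ y} i∈)

    ∈-∨⁺ˡ : i ∈ᴾ x → i ∈ᴾ x ∨ y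
    ∈-∨⁺ˡ = ∈-grow⁺ˡ {proj₁ x} {proj₁ y}

    ∈-∨⁺ʳ : i ∈ᴾ y → i ∈ᴾ x ∨ y
    ∈-∨⁺ʳ i∈ = ∈-grow⁺ʳ {proj₁ x} {proj₁ y} i∈ (∈⇒<bound (proj₁ y) i∈)

  bottom : P
  bottom = indexSet [] [] , F-empty (indexSet [] []) (λ ())

  ⋁ : List P → P
  ⋁ = foldr _∨_ bottom

  ∈-⋁⁻ : ∀ {i} zs → i ∈ᴾ ⋁ zs → Any (i ∈ᴾ_) zs
  ∈-⋁⁻ (z ∷ zs) i∈ = [ here , there ∘ ∈-⋁⁻ zs ]′ (∈-∨⁻ {z} {⋁ zs} i∈)

  ∈-⋁⁺ : ∀ {i} zs → Any (i ∈ᴾ_) zs → i ∈ᴾ ⋁ zs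
  ∈-⋁⁺ (z ∷ zs) (here i∈)  = ∈-∨⁺ˡ {z} {⋁ zs} i∈
  ∈-⋁⁺ (z ∷ zs) (there i∈) = ∈-∨⁺ʳ {z} {⋁ zs} (∈-⋁⁺ zs i∈)

  -- Comprehension over [0 , bound A) turns each sublist back into an increasing list.
  downSet : P → List P
  downSet (A , _) = filterΣ F? (map (λ xs → ⟪ _∈? xs ⟫< (bound A)) (subs (indices A)))

  downSet-complete : ∀ x z → z ≼ x → Any (z ≈_) (downSet x)
  downSet-complete (A , _) (C , FC) C⊑A =
    ∈-filterΣ F? (Any.map⁺ (lose (filter∈subs (_∈? indices C) (indices A)) (F-resp C≡ FC , C≡)))
    where
    K = filter (_∈? indices C) (indices A)
    D = ⟪ _∈? K ⟫< (bound A)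
    C≡ : indices C ≡ indices D
    C≡ = ⊑-antisym {C} {D}
      (λ i∈C → ∈-⟪⟫⁺ (_∈? K) (∈⇒<bound A (C⊑A i∈C)) (∈-filter⁺ (_∈? indices C) (C⊑A i∈C) i∈C))
      (λ i∈D → proj₂ (∈-filter⁻ (_∈? indices C) {xs = indices A} (∈-⟪⟫⁻ (_∈? K) {n = bound A} i∈D)))

  lowerBounds : ∀ x y → List (∃[ z ] z ≼ x × z ≼ y)
  lowerBounds x y = filterΣ (λ z → (z ≼? x) ×-dec (z ≼? y)) (downSet x)

  _∧_ : P → P → P
  x ∧ y = ⋁ (map proj₁ (lowerBounds x y))

  ∧-lower : ∀ x y {i} → i ∈ᴾ x ∧ y → i ∈ᴾ x × i ∈ᴾ y
  ∧-lower x y i∈ with (_ , z≼x , z≼y) , i∈z ← Any.satisfied (Any.map⁻ (∈-⋁⁻ (map proj₁ (lowerBounds x y)) i∈))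
    = z≼x i∈z , z≼y i∈z

  ∧-greatest : ∀ x y z → z ≼ x → z ≼ y → z ≼ x ∧ y
  ∧-greatest x y z z≼x z≼y {i} i∈z = ∈-⋁⁺ (map proj₁ (lowerBounds x y))
    (Any.map⁺ (∈-filterΣ (λ z → (z ≼? x) ×-dec (z ≼? y))
      (Any.map (λ {w} → lower {w}) (downSet-complete x z z≼x))))
    where
    lower : ∀ {w} → z ≈ w → (w ≼ x × w ≼ y) × i ∈ᴾ w
    lower {w} z≈w = (≼-respˡ {w} {z} {x} z≈w z≼x , ≼-respˡ {w} {z} {y} z≈w z≼y) , ≈⇒≼ {z} {w} z≈w i∈z

  isLattice : IsLattice _≈_ _≼_ _∨_ _∧_
  isLattice = record
    { isPartialOrder = record
      { isPreorder = record
        { isEquivalence = record { refl = refl ; sym = sym ; trans = trans }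
        ; reflexive = λ {x} {y} → ≈⇒≼ {x} {y}
        ; trans = λ x≼y y≼z i∈ → y≼z (x≼y i∈)
        }
      ; antisym = λ {x} {y} → ≼-antisym {x} {y}
      }
    ; supremum = λ x y → ∈-∨⁺ˡ {x} {y} , ∈-∨⁺ʳ {x} {y} ,
        λ z x≼z y≼z i∈ → [ x≼z , y≼z ]′ (∈-∨⁻ {x} {y} i∈)
    ; infimum = λ x y → proj₁ ∘ ∧-lower x y , proj₂ ∘ ∧-lower x y , ∧-greatest x y
    }

  lattice : Lattice p 0ℓ 0ℓ
  lattice = record { isLattice = isLattice }

  locallyFinite : LocallyFinite lattice
  locallyFinite x y x≼y = filterΣ (λ z → (x ≼? z) ×-dec (z ≼? y)) (downSet y) , complete
    where
    complete : ∀ z → Any (λ w → proj₁ z ≈ proj₁ w) (filterΣ (λ z → (x ≼? z) ×-dec (z ≼? y)) (downSet y))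
    complete (z , x≼z , z≼y) = ∈-filterΣ _ (Any.map (λ {w} → between {w}) (downSet-complete y z z≼y))
      where
      between : ∀ {w} → z ≈ w → (x ≼ w × w ≼ y) × z ≈ w
      between {w} z≈w = ((λ i∈x → ≈⇒≼ {z} {w} z≈w (x≼z i∈x)) , ≼-respˡ {w} {z} {y} z≈w z≼y) , z≈w

  -- Supersolvability of intervals

  module _ (x y : P) (x≼y : x ≼ y) where

    private
      I : Lattice p 0ℓ 0ℓ
      I = interval lattice x y
      module I = Lattice I

    initial : ℕ → I.Carrier
    initial k = (grow (proj₁ x) (proj₁ y) k , grow-F (proj₂ x) (proj₂ y) k) ,
      ∈-grow⁺ˡ {proj₁ x} {proj₁ y} ,
      λ i∈ → [ x≼y , proj₁ ]′ (∈-grow⁻ {proj₁ x} {proj₁ y} i∈)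

    Initial : Sub I
    Initial z = Lift p (∃[ k ] z I.≈ initial k)

    initial-mono : ∀ {k l} → k ≤ l → initial k I.≤ initial l
    initial-mono = grow-mono {proj₁ x} {proj₁ y}

    initial-isMaximalChain : IsMaximalChain I Initial
    initial-isMaximalChain = isChain , maximal
      where
      ≤ⁱ : ∀ {z w k l} → z I.≈ initial k → w I.≈ initial l → k ≤ l → z I.≤ w
      ≤ⁱ {z} {w} {k} {l} z≈ w≈ k≤l = I.trans {z} {initial k} {w} (I.reflexive {z} {initial k} z≈)
        (I.trans {initial k} {initial l} {w} (initial-mono k≤l) (I.reflexive {initial l} {w} (sym w≈)))

      isChain : IsChain I Initial
      isChain z w (lift (k , z≈)) (lift (l , w≈)) with ℕ.≤-total k l
      ... | inj₁ k≤l = inj₁ (≤ⁱ {z} {w} z≈ w≈ k≤l)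
      ... | inj₂ l≤k = inj₂ (≤ⁱ {w} {z} w≈ z≈ l≤k)

      maximal : ∀ (D : Sub I) → IsChain I D → (∀ {z} → Initial z → D z) → ∀ {z} → D z → Initial z
      maximal D chain M⊆D {z@(_ , x≼z , z≼y)} z∈D = lift (search (bound (proj₁ y)) λ i∈z →
          ∈-grow⁺ʳ {proj₁ x} {proj₁ y} (z≼y i∈z) (∈⇒<bound (proj₁ y) (z≼y i∈z)))
        where
        -- Consecutive members of the chain differ at most by the element k. So if z lies between
        -- them, whether k belongs to z decides which of the two it equals.
        search : ∀ k → z I.≤ initial k → ∃[ k ] z I.≈ initial k
        search zero z≤ = 0 , I.antisym {z} {initial 0} z≤
          λ i∈ → [ x≼z , (λ ()) ]′ (∈-grow⁻ {proj₁ x} {proj₁ y} i∈)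
        search (suc k) z≤ with chain z (initial k) z∈D (M⊆D (lift (k , refl)))
        ... | inj₁ z≤k = search k z≤k
        ... | inj₂ k≤z with k ∈? indices (proj₁ (proj₁ z))
        ...   | no k∉z = search k λ i∈z →
          [ id , (λ { (refl , _) → contradiction i∈z k∉z }) ]′ (grow-suc⁻ {proj₁ x} {proj₁ y} {k} (z≤ i∈z))
        ...   | yes k∈z = suc k , I.antisym {z} {initial (suc k)} z≤ λ i∈ →
          [ k≤z , (λ { (refl , _) → k∈z }) ]′ (grow-suc⁻ {proj₁ x} {proj₁ y} {k} i∈)

    module _ (C : Sub I) (chain : IsChain I C) where

      -- With the top y adjoined, the members x ∪ (y ∩ [0 , k)) of the initial chain are cut from a
      -- chain in the same way as the elements of C.
      C⊤ : Pred I.Carrier p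
      C⊤ c = C c ⊎ y ≼ proj₁ c

      C⊤-total : ∀ c d → C⊤ c → C⊤ d → c I.≤ d ⊎ d I.≤ c
      C⊤-total c d (inj₁ c∈) (inj₁ d∈) = chain c d c∈ d∈
      C⊤-total c d (inj₂ y≼c) _ = inj₂ λ i∈d → y≼c (proj₂ (proj₂ d) i∈d)
      C⊤-total c d _ (inj₂ y≼d) = inj₁ λ i∈c → y≼d (proj₂ (proj₂ c) i∈c)

      -- Unions of x with sets c ∩ [0 , k), c ∈ C⊤, are closed under ∪ and, C⊤
      -- being a chain, under ∩.  So they form a distributive lattice of sets.
      Block : P → ℕ → Set p
      Block z i = ∃[ c ] C⊤ c × ∃[ k ] i < k × i ∈ᴾ proj₁ c × (∀ {j} → j < k → j ∈ᴾ proj₁ c → j ∈ᴾ z)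

      Blocky : Pred P p
      Blocky z = ∀ {i} → i ∈ᴾ z → i ∈ᴾ x ⊎ Block z i

      Block-mono : ∀ {z w i} → z ≼ w → Block z i → Block w i
      Block-mono z≼w (c , c∈ , k , i<k , i∈c , c⊆z) = c , c∈ , k , i<k , i∈c , λ j<k j∈c → z≼w (c⊆z j<k j∈c)

      Block-∩ : ∀ {z w i} → Block z i → Block w i →
        ∃[ c ] C⊤ c × ∃[ k ] i < k × i ∈ᴾ proj₁ c × (∀ {j} → j < k → j ∈ᴾ proj₁ c → j ∈ᴾ z × j ∈ᴾ w)
      Block-∩ (c , c∈ , k , i<k , i∈c , c⊆z) (d , d∈ , l , i<l , i∈d , d⊆w) with C⊤-total c d c∈ d∈
      ... | inj₁ c≤d = c , c∈ , k ℕ.⊓ l , ℕ.⊓-glb i<k i<l , i∈c , λ j< j∈ →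
        c⊆z (ℕ.<-≤-trans j< (ℕ.m⊓n≤m k l)) j∈ , d⊆w (ℕ.<-≤-trans j< (ℕ.m⊓n≤n k l)) (c≤d j∈)
      ... | inj₂ d≤c = d , d∈ , k ℕ.⊓ l , ℕ.⊓-glb i<k i<l , i∈d , λ j< j∈ →
        c⊆z (ℕ.<-≤-trans j< (ℕ.m⊓n≤m k l)) (d≤c j∈) , d⊆w (ℕ.<-≤-trans j< (ℕ.m⊓n≤n k l)) j∈

      -- The set x ∪ (c ∩ [0 , k)) is itself feasible by `grow-F`. Being a common lower bound of z
      -- and w, it lies below their meet.
      block∈∧ : ∀ {z w} → x ≼ z → x ≼ w → ∀ (c : I.Carrier) {k} →
        (∀ {j} → j < k → j ∈ᴾ proj₁ c → j ∈ᴾ z × j ∈ᴾ w) →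
        ∀ {j} → j < k → j ∈ᴾ proj₁ c → j ∈ᴾ z ∧ w
      block∈∧ {z} {w} x≼z x≼w c {k} c⊆ j<k j∈c = ∧-greatest z w b
        (λ i∈ → [ x≼z , (λ (i∈c , i<k) → proj₁ (c⊆ i<k i∈c)) ]′ (∈-grow⁻ {proj₁ x} {proj₁ (proj₁ c)} i∈))
        (λ i∈ → [ x≼w , (λ (i∈c , i<k) → proj₂ (c⊆ i<k i∈c)) ]′ (∈-grow⁻ {proj₁ x} {proj₁ (proj₁ c)} i∈))
        (∈-grow⁺ʳ {proj₁ x} {proj₁ (proj₁ c)} j∈c j<k)
        where
        b : P
        b = grow (proj₁ x) (proj₁ (proj₁ c)) k , grow-F (proj₂ x) (proj₂ (proj₁ c)) k

      -- On blocky sets the meet, in general smaller, is the intersection. Both operations are then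
      -- those of sets, and distributivity is inherited.
      ∧-∩ : ∀ {z w} → x ≼ z → x ≼ w → Blocky z → Blocky w → ∀ {i} → i ∈ᴾ z → i ∈ᴾ w → i ∈ᴾ z ∧ w
      ∧-∩ {z} {w} x≼z x≼w Bz Bw i∈z i∈w with Bz i∈z | Bw i∈w
      ... | inj₁ i∈x | _        = ∧-greatest z w x x≼z x≼w i∈x
      ... | _        | inj₁ i∈x = ∧-greatest z w x x≼z x≼w i∈x
      ... | inj₂ b   | inj₂ b′ with Block-∩ {z} {w} b b′
      ...   | c , _ , k , i<k , i∈c , c⊆ = block∈∧ {z} {w} x≼z x≼w c c⊆ i<k i∈c

      Blocky-∧ : ∀ {z w} → x ≼ z → x ≼ w → Blocky z → Blocky w → Blocky (z ∧ w)
      Blocky-∧ {z} {w} x≼z x≼w Bz Bw i∈ with ∧-lower z w i∈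
      ... | i∈z , i∈w with Bz i∈z | Bw i∈w
      ...   | inj₁ i∈x | _        = inj₁ i∈x
      ...   | _        | inj₁ i∈x = inj₁ i∈x
      ...   | inj₂ b   | inj₂ b′ with Block-∩ {z} {w} b b′
      ...     | c , c∈ , k , i<k , i∈c , c⊆ =
        inj₂ (c , c∈ , k , i<k , i∈c , block∈∧ {z} {w} x≼z x≼w c c⊆)

      Blocky-∨ : ∀ {z w} → Blocky z → Blocky w → Blocky (z ∨ w)
      Blocky-∨ {z} {w} Bz Bw i∈ with ∈-∨⁻ {z} {w} i∈
      ... | inj₁ i∈z = [ inj₁ , inj₂ ∘ Block-mono {z} {z ∨ w} (∈-∨⁺ˡ {z} {w}) ]′ (Bz i∈z)
      ... | inj₂ i∈w = [ inj₁ , inj₂ ∘ Block-mono {w} {z ∨ w} (∈-∨⁺ʳ {z} {w}) ]′ (Bw i∈w)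

      generated⇒Blocky : ∀ {z} → Generated I (λ z → Initial z ⊎ C z) z → Blocky (proj₁ z)
      generated⇒Blocky (incl {z} (inj₁ (lift (k , z≈)))) i∈ with ∈-grow⁻ {proj₁ x} {proj₁ y} (subst (_ ∈_) z≈ i∈)
      ... | inj₁ i∈x = inj₁ i∈x
      ... | inj₂ (i∈y , i<k) = inj₂ ((y , x≼y , id) , inj₂ id , k , i<k , i∈y ,
        λ j<k j∈y → subst (_ ∈_) (sym z≈) (∈-grow⁺ʳ {proj₁ x} {proj₁ y} j∈y j<k))
      generated⇒Blocky (incl {z} (inj₂ z∈C)) {i} i∈ =
        inj₂ (z , inj₁ z∈C , suc i , ℕ.n<1+n i , i∈ , λ _ j∈ → j∈)
      generated⇒Blocky (join {z} {w} gz gw) = Blocky-∨ {proj₁ z} {proj₁ w} (generated⇒Blocky gz) (generated⇒Blocky gw)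
      generated⇒Blocky (meet {z} {w} gz gw) = Blocky-∧ {proj₁ z} {proj₁ w} (proj₁ (proj₂ z)) (proj₁ (proj₂ w))
        (generated⇒Blocky gz) (generated⇒Blocky gw)
      generated⇒Blocky (resp {z} {w} z≈w gz) i∈w =
        [ inj₁ , inj₂ ∘ Block-mono {proj₁ z} {proj₁ w} (≈⇒≼ {proj₁ z} {proj₁ w} z≈w) ]′
        (generated⇒Blocky gz (≈⇒≼ {proj₁ w} {proj₁ z} (sym z≈w) i∈w))

      generated-distributive : IsDistributive (generatedSublattice I (λ z → Initial z ⊎ C z))
      generated-distributive = record
        { isLattice = Lattice.isLattice (generatedSublattice I (λ z → Initial z ⊎ C z))
        ; ∧-distribˡ-∨ = λ ((u , x≼u , _) , gu) ((v , x≼v , _) , gv) ((w , x≼w , _) , gw) →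
          let Bu = generated⇒Blocky gu
              Bv = generated⇒Blocky gv
              Bw = generated⇒Blocky gw
              to : u ∧ (v ∨ w) ≼ (u ∧ v) ∨ (u ∧ w)
              to i∈ = let i∈u , i∈v∨w = ∧-lower u (v ∨ w) i∈ in
                [ (λ i∈v → ∈-∨⁺ˡ {u ∧ v} {u ∧ w} (∧-∩ {u} {v} x≼u x≼v Bu Bv i∈u i∈v))
                , (λ i∈w → ∈-∨⁺ʳ {u ∧ v} {u ∧ w} (∧-∩ {u} {w} x≼u x≼w Bu Bw i∈u i∈w)) ]′
                (∈-∨⁻ {v} {w} i∈v∨w)
              from : (u ∧ v) ∨ (u ∧ w) ≼ u ∧ (v ∨ w)
              from i∈ = ∧-greatest u (v ∨ w) ((u ∧ v) ∨ (u ∧ w))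
                (λ j∈ → [ proj₁ ∘ ∧-lower u v , proj₁ ∘ ∧-lower u w ]′ (∈-∨⁻ {u ∧ v} {u ∧ w} j∈))
                (λ j∈ → [ ∈-∨⁺ˡ {v} {w} ∘ proj₂ ∘ ∧-lower u v , ∈-∨⁺ʳ {v} {w} ∘ proj₂ ∘ ∧-lower u w ]′ (∈-∨⁻ {u ∧ v} {u ∧ w} j∈))
                i∈
          in ≼-antisym {u ∧ (v ∨ w)} {(u ∧ v) ∨ (u ∧ w)} to from
        }

    interval-supersolvable : SupersolvableFinite I
    interval-supersolvable = locallyFinite x y x≼y , Initial , initial-isMaximalChain ,
      λ C (chain , _) → generated-distributive C chain

  supersolvable : Supersolvable lattice
  supersolvable = interval-supersolvable

  -- Atomic intervals

  atoms-F : ∀ {A B} → F A → (∀ {k} → k ∈ⁱ B → k ∉ⁱ A → F (insert A k)) → ∀ k → F (grow A B k)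
  atoms-F {A} {B} FA atoms = grow-induction F F-resp A B FA λ k k∈B k∉ FG →
    -- The second feasible set is `insert A k`: its only element outside A is k, so below k it lies
    -- in the current set whatever has been added before.
    exchange FG (atoms k∈B (k∉ ∘ ∈-grow⁺ˡ {A} {B})) k (∈-insert⁺ʳ {A} {k}) k∉
      λ y∈ y<k → [ ∈-grow⁺ˡ {A} {B} , (λ { refl → contradiction y<k (ℕ.<-irrefl refl) }) ]′ (∈-insert⁻ {A} {k} y∈)

  -- The set g = x ∪ (y ∩ [0 , i)) misses i, hence is properly below y, and so equals x. Thus i is
  -- the least element of y outside x.
  cover⇒F : ∀ {x y} → _⋖_ lattice x y → ∀ {i} → i ∈ᴾ y → ¬ i ∈ᴾ x → F (insert (proj₁ x) i)
  cover⇒F {x} {y} ((x≼y , _) , nothing-between) {i} i∈y i∉x =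
    exchange (proj₂ x) (proj₂ y) i i∈y i∉x λ j∈y j<i → g≼x (∈-grow⁺ʳ {proj₁ x} {proj₁ y} j∈y j<i)
    where
    g : P
    g = proj₁ (initial x y x≼y i)
    x≼g : x ≼ g
    x≼g = proj₁ (proj₂ (initial x y x≼y i))
    g≉y : ¬ g ≈ y
    g≉y g≈y = [ i∉x , (λ (_ , i<i) → ℕ.<-irrefl refl i<i) ]′
      (∈-grow⁻ {proj₁ x} {proj₁ y} (≈⇒≼ {y} {g} (sym g≈y) i∈y))
    g≼x : g ≼ x
    g≼x with g ≼? x
    ... | yes g≼x = g≼x
    ... | no g⋠x = contradiction
      (g , ((λ {_} → x≼g) , λ x≈g → g⋠x (≈⇒≼ {g} {x} (sym x≈g))) , ((λ {_} → proj₂ (proj₂ (initial x y x≼y i))) , g≉y))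
      nothing-between

  module _ (x : P) (Y : Sub lattice) (covers : ∀ y → Y y → _⋖_ lattice x y)
           (j : P) (j-join : IsJoin lattice Y j) (x≼j : x ≼ j) where

    private
      J : Lattice p 0ℓ 0ℓ
      J = interval lattice x j
      module J = Lattice J

    atom? : Decidable (λ i → i ∈ᴾ j × F (insert (proj₁ x) i))
    atom? i = i ∈? indices (proj₁ j) ×-dec F? (insert (proj₁ x) i)

    -- Y is an arbitrary predicate, so its join cannot be computed from it. All atoms over x inside
    -- j are taken instead; their union bounds Y, hence contains j.
    atoms : IndexSet
    atoms = ⟪ atom? ⟫< (bound (proj₁ j))

    joinOfAtoms : P
    joinOfAtoms = grow (proj₁ x) atoms (bound atoms) ,
      atoms-F {proj₁ x} {atoms} (proj₂ x) (λ i∈ _ → proj₂ (∈-⟪⟫⁻ atom? {n = bound (proj₁ j)} i∈)) (bound atoms)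

    j≼joinOfAtoms : j ≼ joinOfAtoms
    j≼joinOfAtoms = proj₂ j-join joinOfAtoms upper
      where
      upper : ∀ y → Y y → y ≼ joinOfAtoms
      upper y y∈Y {i} i∈y with i ∈? indices (proj₁ x)
      ... | yes i∈x = ∈-grow⁺ˡ {proj₁ x} {atoms} i∈x
      ... | no i∉x = ∈-grow⁺ʳ {proj₁ x} {atoms} i∈atoms (∈⇒<bound atoms i∈atoms)
        where
        i∈j : i ∈ᴾ j
        i∈j = proj₁ j-join y y∈Y i∈y
        i∈atoms : i ∈ⁱ atoms
        i∈atoms = ∈-⟪⟫⁺ atom? (∈⇒<bound (proj₁ j) i∈j) (i∈j , cover⇒F {x} {y} (covers y y∈Y) i∈y i∉x)

    ∈j⇒F : ∀ {i} → i ∈ᴾ j → ¬ i ∈ᴾ x → F (insert (proj₁ x) i)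
    ∈j⇒F i∈j i∉x with ∈-grow⁻ {proj₁ x} {atoms} (j≼joinOfAtoms i∈j)
    ... | inj₁ i∈x = contradiction i∈x i∉x
    ... | inj₂ (i∈ , _) = proj₂ (∈-⟪⟫⁻ atom? {n = bound (proj₁ j)} i∈)

    new? : Decidable (λ i → ¬ i ∈ᴾ x)
    new? i = ¬? (i ∈? indices (proj₁ x))

    E : List ℕ
    E = filter new? (indices (proj₁ j))

    E-increasing : Linked _<_ E
    E-increasing = Linked.filter⁺ new? ℕ.<-trans (increasing (proj₁ j))

    E-new : ∀ k → lookup E k ∈ᴾ j × ¬ lookup E k ∈ᴾ x
    E-new k = ∈-filter⁻ new? {xs = indices (proj₁ j)} (∈-lookup {xs = E} k)

    toSubset : J.Carrier → Subset (length E)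
    toSubset (z , _) = tabulate λ k → does (lookup E k ∈? indices (proj₁ z))

    ∈-toSubset⁺ : ∀ z {k} → lookup E k ∈ᴾ proj₁ z → k Subset.∈ toSubset z
    ∈-toSubset⁺ z {k} e∈ = Vec.lookup⇒[]= k (toSubset z)
      (trans (Vec.lookup∘tabulate (λ k → does (lookup E k ∈? indices (proj₁ (proj₁ z)))) k) (dec-true (lookup E k ∈? indices (proj₁ (proj₁ z))) e∈))

    ∈-toSubset⁻ : ∀ z {k} → k Subset.∈ toSubset z → lookup E k ∈ᴾ proj₁ z
    ∈-toSubset⁻ z {k} k∈ with lookup E k ∈? indices (proj₁ (proj₁ z))
      | trans (sym (Vec.lookup∘tabulate (λ k → does (lookup E k ∈? indices (proj₁ (proj₁ z)))) k)) (Vec.[]=⇒lookup k∈)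
    ... | yes e∈ | _ = e∈

    toSubset-cancel : ∀ {z w} → toSubset z Subset.⊆ toSubset w → z J.≤ w
    toSubset-cancel {z} {w@(_ , x≼w , _)} sub {i} i∈z with i ∈? indices (proj₁ x)
    ... | yes i∈x = x≼w i∈x
    ... | no i∉x = subst (_∈ᴾ proj₁ w) (sym i≡)
      (∈-toSubset⁻ w (sub (∈-toSubset⁺ z (subst (_∈ᴾ proj₁ z) i≡ i∈z))))
      where
      i∈E : i ∈ E
      i∈E = ∈-filter⁺ new? (proj₂ (proj₂ z) i∈z) i∉x
      i≡ : i ≡ lookup E (Any.index i∈E)
      i≡ = Any.lookup-index i∈E

    module _ (s : Subset (length E)) where

      chosen? : Decidable (λ i → ∃[ k ] lookup E k ≡ i × k Subset.∈ s)
      chosen? i = any? λ k → lookup E k ℕ.≟ i ×-dec k Subset.∈? s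

      chosen : IndexSet
      chosen = ⟪ chosen? ⟫< (bound (proj₁ j))

      ∈-chosen⁻ : ∀ {i} → i ∈ⁱ chosen → ∃[ k ] lookup E k ≡ i × k Subset.∈ s
      ∈-chosen⁻ = ∈-⟪⟫⁻ chosen? {n = bound (proj₁ j)}

      -- Every element of j outside x can be adjoined to x on its own, so by `atoms-F` any selection
      -- of them can be adjoined together.
      fromSubset : J.Carrier
      fromSubset = (grow (proj₁ x) chosen (bound chosen) , atoms-F {proj₁ x} {chosen} (proj₂ x) chosen-F (bound chosen))
        , ∈-grow⁺ˡ {proj₁ x} {chosen}
        , λ i∈ → [ x≼j , chosen⊑j ∘ proj₁ ]′ (∈-grow⁻ {proj₁ x} {chosen} i∈)
        where
        chosen⊑j : chosen ⊑ proj₁ j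
        chosen⊑j i∈ with k , refl , _ ← ∈-chosen⁻ i∈ = proj₁ (E-new k)
        chosen-F : ∀ {i} → i ∈ⁱ chosen → i ∉ⁱ proj₁ x → F (insert (proj₁ x) i)
        chosen-F i∈ = ∈j⇒F (chosen⊑j i∈)

      toSubset∘fromSubset : ∀ z → z J.≈ fromSubset → toSubset z ≡ s
      toSubset∘fromSubset z z≈ = Subset.⊆-antisym to from
        where
        to : toSubset z Subset.⊆ s
        to {k} k∈ with ∈-grow⁻ {proj₁ x} {chosen} (J.reflexive {z} {fromSubset} z≈ (∈-toSubset⁻ z k∈))
        ... | inj₁ e∈x = contradiction e∈x (proj₂ (E-new k))
        ... | inj₂ (e∈ , _) with l , eq , l∈s ← ∈-chosen⁻ e∈ =
          subst (Subset._∈ s) (lookup-injective E-increasing l k eq) l∈s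
        from : s Subset.⊆ toSubset z
        from {k} k∈s = ∈-toSubset⁺ z (J.reflexive {fromSubset} {z} (sym z≈)
          (∈-grow⁺ʳ {proj₁ x} {chosen} e∈ (∈⇒<bound chosen e∈)))
          where
          e∈ : lookup E k ∈ⁱ chosen
          e∈ = ∈-⟪⟫⁺ chosen? (∈⇒<bound (proj₁ j) (proj₁ (E-new k))) (k , refl , k∈s)

    interval-boolean : IsBoolean J
    interval-boolean = length E , toSubset , record
      { isOrderMonomorphism = record
        { isOrderHomomorphism = record
          { cong = λ {z} {w} z≈w → Subset.⊆-antisym
              (toSubset-mono {z} {w} (J.reflexive {z} {w} z≈w))
              (toSubset-mono {w} {z} (J.reflexive {w} {z} (sym z≈w)))
          ; mono = λ {z} {w} → toSubset-mono {z} {w}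
          }
        ; injective = λ {z} {w} eq → J.antisym {z} {w}
            (toSubset-cancel {z} {w} (Subset.⊆-reflexive eq))
            (toSubset-cancel {w} {z} (Subset.⊆-reflexive (sym eq)))
        ; cancel = λ {z} {w} → toSubset-cancel {z} {w}
        }
      ; surjective = λ s → fromSubset s , λ {z} → toSubset∘fromSubset s z
      }
      where
      toSubset-mono : ∀ {z w} → z J.≤ w → toSubset z Subset.⊆ toSubset w
      toSubset-mono {z} {w} z≤w k∈ = ∈-toSubset⁺ w (z≤w (∈-toSubset⁻ z k∈))

  joinDistributive : JoinDistributive lattice
  joinDistributive = interval-boolean

-- The disjoint union of paths with d vertices (one infinite path if d = 0),
-- laid out along ℕ: the vertices i and i + 1 are joined unless d ∣ i + 1.
module Path (d : ℕ) where

  edge : ℕ → ℤ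
  edge i = if does (d ∣? suc i) then 0ℤ else 1ℤ

  edge-0 : ∀ {i} → d ∣ suc i → edge i ≡ 0ℤ
  edge-0 {i} d∣ with d ∣? suc i
  ... | yes _ = refl
  ... | no d∤ = contradiction d∣ d∤

  edge-1 : ∀ {i} → ¬ d ∣ suc i → edge i ≡ 1ℤ
  edge-1 {i} d∤ with d ∣? suc i
  ... | yes d∣ = contradiction d∣ d∤
  ... | no _ = refl

  adj : (ℕ → ℤ) → ℕ → ℤ
  adj f zero    = edge 0 *ᶻ f 1
  adj f (suc i) = edge i *ᶻ f i +ᶻ edge (suc i) *ᶻ f (2 + i)

  adj-cong : ∀ {f g} → f ≗ g → adj f ≗ adj g
  adj-cong f≗g zero    = cong (edge 0 *ᶻ_) (f≗g 1)
  adj-cong f≗g (suc i) = cong₂ (λ a b → edge i *ᶻ a +ᶻ edge (suc i) *ᶻ b) (f≗g i) (f≗g (2 + i))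

  adj-+ : ∀ f g i → adj (λ i → f i +ᶻ g i) i ≡ adj f i +ᶻ adj g i
  adj-+ f g zero    = ℤ.*-distribˡ-+ (edge 0) (f 1) (g 1)
  adj-+ f g (suc i) = lemma (edge i) (edge (suc i)) (f i) (f (2 + i)) (g i) (g (2 + i))
    where
    lemma : ∀ a b p q r s → a *ᶻ (p +ᶻ r) +ᶻ b *ᶻ (q +ᶻ s) ≡ (a *ᶻ p +ᶻ b *ᶻ q) +ᶻ (a *ᶻ r +ᶻ b *ᶻ s)
    lemma = solve-∀

  adj-neg : ∀ f i → adj (λ i → - f i) i ≡ - adj f i
  adj-neg f zero    = sym (ℤ.neg-distribʳ-* (edge 0) (f 1))
  adj-neg f (suc i) = lemma (edge i) (edge (suc i)) (f i) (f (2 + i))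
    where
    lemma : ∀ a b p q → a *ᶻ (- p) +ᶻ b *ᶻ (- q) ≡ - (a *ᶻ p +ᶻ b *ᶻ q)
    lemma = solve-∀

  adj-0 : ∀ i → adj (λ _ → 0ℤ) i ≡ 0ℤ
  adj-0 zero    = ℤ.*-zeroʳ (edge 0)
  adj-0 (suc i) = cong₂ _+ᶻ_ (ℤ.*-zeroʳ (edge i)) (ℤ.*-zeroʳ (edge (suc i)))

  adj-- : ∀ f g i → adj (λ i → f i -ᶻ g i) i ≡ adj f i -ᶻ adj g i
  adj-- f g i = trans (adj-+ f (λ i → - g i) i) (cong (adj f i +ᶻ_) (adj-neg g i))

  -- The Chebyshev polynomials of the second kind (U k has degree k − 1).
  U : ℕ → (ℕ → ℤ) → ℕ → ℤ
  U 0             f i = 0ℤ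
  U 1             f i = f i
  U (suc (suc k)) f i = adj (U (suc k) f) i -ᶻ U k f i

  U-cong : ∀ k {f g} → f ≗ g → U k f ≗ U k g
  U-cong 0             f≗g i = refl
  U-cong 1             f≗g i = f≗g i
  U-cong (suc (suc k)) f≗g i = cong₂ _-ᶻ_ (adj-cong (U-cong (suc k) f≗g) i) (U-cong k f≗g i)

  U-+ : ∀ k f g i → U k (λ i → f i +ᶻ g i) i ≡ U k f i +ᶻ U k g i
  U-+ 0             f g i = refl
  U-+ 1             f g i = refl
  U-+ (suc (suc k)) f g i = trans
    (cong₂ _-ᶻ_ (trans (adj-cong (U-+ (suc k) f g) i) (adj-+ (U (suc k) f) (U (suc k) g) i)) (U-+ k f g i))
    (lemma (adj (U (suc k) f) i) (adj (U (suc k) g) i) (U k f i) (U k g i))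
    where
    lemma : ∀ a b p q → (a +ᶻ b) -ᶻ (p +ᶻ q) ≡ (a -ᶻ p) +ᶻ (b -ᶻ q)
    lemma = solve-∀

  U-adj : ∀ k f i → U k (adj f) i ≡ adj (U k f) i
  U-adj 0             f i = sym (adj-0 i)
  U-adj 1             f i = refl
  U-adj (suc (suc k)) f i = trans
    (cong₂ _-ᶻ_ (adj-cong (U-adj (suc k) f) i) (U-adj k f i))
    (sym (adj-- (adj (U (suc k) f)) (U k f) i))

  -- A path starts at b.
  module _ (b : ℕ) (starts : ∀ f → adj f b ≡ edge b *ᶻ f (suc b)) (d∣b : d ∣ b) where

    private
      inner : ∀ k → suc k < d ⊎ d ≡ 0 → ¬ d ∣ suc (b + k)
      inner k (inj₁ 1+k<d) d∣ = ℕ.<⇒≱ 1+k<d (∣⇒≤ (∣m+n∣m⇒∣n (subst (d ∣_) (sym (ℕ.+-suc b k)) d∣) d∣b))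
      inner k (inj₂ refl) d∣ with () ← 0∣⇒≡0 d∣

      weaken : ∀ {k} → suc k < d ⊎ d ≡ 0 → k < d ⊎ d ≡ 0
      weaken = [ inj₁ ∘ ℕ.<⇒≤ , inj₂ ]′

      step : ∀ k f → (∀ f → U (suc k) f b ≡ f (b + k)) → (∀ f → U k f b +ᶻ edge (b + k) *ᶻ f (suc (b + k)) ≡ adj f (b + k)) →
        U (suc (suc k)) f b ≡ edge (b + k) *ᶻ f (suc (b + k))
      step k f ih adj≡ = trans
        (cong (_-ᶻ U k f b) (trans (sym (U-adj (suc k) f b)) (trans (ih (adj f)) (sym (adj≡ f)))))
        (lemma (U k f b) (edge (b + k) *ᶻ f (suc (b + k))))
        where
        lemma : ∀ a b → (a +ᶻ b) -ᶻ a ≡ b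
        lemma = solve-∀

    mutual
      -- Seen from an end of the path the Chebyshev recursion is a pure shift: applying `adj` moves
      -- one vertex on and one back, and the subtracted term removes the move back.
      U-start : ∀ k → k < d ⊎ d ≡ 0 → ∀ f → U (suc k) f b ≡ f (b + k)
      U-start zero    _   f = cong f (sym (ℕ.+-identityʳ b))
      U-start (suc k) k<d f = begin
        U (suc (suc k)) f b                ≡⟨ U-next k (weaken k<d) f ⟩
        edge (b + k) *ᶻ f (suc (b + k))    ≡⟨ cong (_*ᶻ f (suc (b + k))) (edge-1 (inner k k<d)) ⟩
        1ℤ *ᶻ f (suc (b + k))              ≡⟨ ℤ.*-identityˡ _ ⟩
        f (suc (b + k))                    ≡⟨ cong f (sym (ℕ.+-suc b k)) ⟩
        f (b + suc k)                      ∎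
        where open ≡-Reasoning

      -- The factor `edge` is kept so that the case k = d - 1 is included, where the path ends and
      -- the factor is 0.
      U-next : ∀ k → k < d ⊎ d ≡ 0 → ∀ f → U (suc (suc k)) f b ≡ edge (b + k) *ᶻ f (suc (b + k))
      U-next zero    k<d f = step 0 f (U-start 0 k<d) λ f → trans (ℤ.+-identityˡ _)
        (subst (λ c → edge c *ᶻ f (suc c) ≡ adj f c) (sym (ℕ.+-identityʳ b)) (sym (starts f)))
      U-next (suc k) k<d f = step (suc k) f (U-start (suc k) k<d) λ f →
        subst (λ c → U (suc k) f b +ᶻ edge c *ᶻ f (suc c) ≡ adj f c) (sym (ℕ.+-suc b k))
          (cong (_+ᶻ edge (suc (b + k)) *ᶻ f (2 + (b + k)))
            (trans (U-start k (weaken k<d) f) (sym (trans (cong (_*ᶻ f (b + k)) (edge-1 (inner k k<d))) (ℤ.*-identityˡ _)))))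

  U-start₀ : ∀ k → k < d ⊎ d ≡ 0 → ∀ f → U (suc k) f 0 ≡ f k
  U-start₀ = U-start 0 (λ _ → refl) (d ∣0)

  -- `U (suc d)` is the characteristic polynomial of a path with d vertices, so this is
  -- Cayley-Hamilton. It holds at the first vertex by `U-next`; it spreads to the neighbour because
  -- polynomials in `adj` commute with `adj`.
  U-vanishes : 0 < d → ∀ i f → U (suc d) f i ≡ 0ℤ
  U-vanishes 0<d = vanish d refl
    where
    vanish : ∀ d′ → d′ ≡ d → ∀ i f → U (suc d) f i ≡ 0ℤ
    vanish zero    refl i f = contradiction 0<d λ ()
    vanish (suc d′) refl = go
      where
      endpoint : ∀ b (starts : ∀ f → adj f b ≡ edge b *ᶻ f (suc b)) → d ∣ b → ∀ f → U (suc d) f b ≡ 0ℤ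
      endpoint b starts d∣b f = trans (U-next b starts d∣b d′ (inj₁ (ℕ.n<1+n d′)) f)
        (cong (_*ᶻ f (suc (b + d′))) (edge-0 (subst (d ∣_) (ℕ.+-suc b d′) (∣m∣n⇒∣m+n d∣b ∣-refl))))

      go : ∀ i f → U (suc d) f i ≡ 0ℤ
      go zero    f = endpoint 0 (λ _ → refl) (d ∣0) f
      go (suc i) f with d ∣? suc i
      ... | yes d∣ = endpoint (suc i)
        (λ f → trans (cong (λ e → e *ᶻ f i +ᶻ edge (suc i) *ᶻ f (2 + i)) (edge-0 d∣)) (ℤ.+-identityˡ _)) d∣ f
      ... | no d∤ = trans (sym (neighbour i (edge-1 d∤) (go i))) (trans (sym (U-adj (suc d) f i)) (go i (adj f)))
        where
        neighbour : ∀ i → edge i ≡ 1ℤ → (∀ f → U (suc d) f i ≡ 0ℤ) → adj (U (suc d) f) i ≡ U (suc d) f (suc i)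
        neighbour zero    e≡1 _ = trans (cong (_*ᶻ U (suc d) f 1) e≡1) (ℤ.*-identityˡ _)
        neighbour (suc i) e≡1 _ = trans
          (cong₂ _+ᶻ_ (trans (cong (edge i *ᶻ_) (go i f)) (ℤ.*-zeroʳ (edge i)))
                      (trans (cong (_*ᶻ U (suc d) f (2 + i)) e≡1) (ℤ.*-identityˡ _)))
          (ℤ.+-identityˡ _)

  -- Solutions of the discrete wave equation on paths

  module Wave (w : ℕ → ℕ → ℤ) (wave : ∀ j i → w (2 + j) i ≡ adj (w (suc j)) i -ᶻ w j i) where

    sumʷ : ℕ → ℕ → ℕ → ℤ
    sumʷ zero    j i = 0ℤ
    sumʷ (suc k) j i = w j i +ᶻ sumʷ k (2 + j) i

    sumʷ-last : ∀ k j i → sumʷ (suc k) j i ≡ sumʷ k j i +ᶻ w (k * 2 + j) i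
    sumʷ-last zero    j i = trans (ℤ.+-identityʳ (w j i)) (sym (ℤ.+-identityˡ (w j i)))
    sumʷ-last (suc k) j i = trans (cong (w j i +ᶻ_) (sumʷ-last k (2 + j) i))
      (trans (sym (ℤ.+-assoc (w j i) _ _))
        (cong (λ l → w j i +ᶻ sumʷ k (2 + j) i +ᶻ w l i) (trans (ℕ.+-suc (k * 2) (suc j)) (cong suc (ℕ.+-suc (k * 2) j)))))

    adj-w : ∀ j i → adj (w (suc j)) i ≡ w (2 + j) i +ᶻ w j i
    adj-w j i = trans (lemma (adj (w (suc j)) i) (w j i)) (cong (_+ᶻ w j i) (sym (wave j i)))
      where
      lemma : ∀ a b → a ≡ (a -ᶻ b) +ᶻ b
      lemma = solve-∀

    -- This is sin((k+1)θ)/sin θ = e^(-ikθ) + e^(-i(k-2)θ) + ⋯ + e^(ikθ) in operator form: the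
    -- Chebyshev polynomial spreads the middle term over k + 1 terms in steps of two, symmetric
    -- about it.
    U-sum : ∀ k j i → U (suc k) (w (k + j)) i ≡ sumʷ (suc k) j i
    U-sum 0 j i = sym (ℤ.+-identityʳ _)
    U-sum 1 j i = trans (ℤ.+-identityʳ _) (trans (adj-w j i)
      (trans (ℤ.+-comm (w (2 + j) i) (w j i)) (cong (w j i +ᶻ_) (sym (ℤ.+-identityʳ _)))))
    U-sum (suc (suc k)) j i = begin
      adj (U (2 + k) (w (2 + (k + j)))) i -ᶻ U (suc k) (w (2 + (k + j))) i
        ≡⟨ cong₂ _-ᶻ_ (begin
            adj (U (2 + k) (w (2 + (k + j)))) i                          ≡⟨ U-adj (2 + k) (w (2 + (k + j))) i ⟨
            U (2 + k) (adj (w (2 + (k + j)))) i                          ≡⟨ U-cong (2 + k) (adj-w (suc (k + j))) i ⟩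
            U (2 + k) (λ i → w (3 + (k + j)) i +ᶻ w (suc (k + j)) i) i   ≡⟨ U-+ (2 + k) (w (3 + (k + j))) (w (suc (k + j))) i ⟩
            U (2 + k) (w (3 + (k + j))) i +ᶻ U (2 + k) (w (suc (k + j))) i
              ≡⟨ cong₂ _+ᶻ_ (trans (cong (λ l → U (2 + k) (w (suc l)) i) (sym k+2+j)) (U-sum (suc k) (2 + j) i)) (U-sum (suc k) j i) ⟩
            sumʷ (2 + k) (2 + j) i +ᶻ sumʷ (2 + k) j i ∎)
          (trans (cong (λ l → U (suc k) (w l) i) (sym k+2+j)) (U-sum k (2 + j) i)) ⟩
      sumʷ (2 + k) (2 + j) i +ᶻ (w j i +ᶻ sumʷ (suc k) (2 + j) i) -ᶻ sumʷ (suc k) (2 + j) i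
        ≡⟨ lemma (sumʷ (2 + k) (2 + j) i) (w j i) (sumʷ (suc k) (2 + j) i) ⟩
      w j i +ᶻ sumʷ (2 + k) (2 + j) i ∎
      where
      open ≡-Reasoning
      k+2+j : k + (2 + j) ≡ 2 + (k + j)
      k+2+j = trans (ℕ.+-suc k (suc j)) (cong suc (ℕ.+-suc k j))
      lemma : ∀ a b c → a +ᶻ (b +ᶻ c) -ᶻ c ≡ b +ᶻ a
      lemma = solve-∀

    sumʷ-period : 0 < d → ∀ j i → sumʷ (suc d) j i ≡ 0ℤ
    sumʷ-period 0<d j i = trans (sym (U-sum d j i)) (U-vanishes 0<d i (w (d + j)))

    -- The sums over the windows of d + 1 terms starting at j and at j + 2 both vanish. They share d
    -- terms, so the two remaining ones agree.
    periodic : 0 < d → ∀ j i → w (suc d * 2 + j) i ≡ w j i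
    periodic 0<d j i = begin
      w (suc d * 2 + j) i          ≡⟨ cong (λ l → w l i) (sym (trans (ℕ.+-suc (d * 2) (suc j)) (cong suc (ℕ.+-suc (d * 2) j)))) ⟩
      w (d * 2 + (2 + j)) i        ≡⟨ lemma (w j i) (sumʷ d (2 + j) i) (w (d * 2 + (2 + j)) i) (sumʷ-period 0<d j i)
                                        (trans (sym (sumʷ-last d (2 + j) i)) (sumʷ-period 0<d (2 + j) i)) ⟩
      w j i                        ∎
      where
      open ≡-Reasoning
      lemma : ∀ a x b → a +ᶻ x ≡ 0ℤ → x +ᶻ b ≡ 0ℤ → b ≡ a
      lemma a x b p q = trans (l a x b) (trans (cong (_+ᶻ a) (cong₂ _-ᶻ_ q p)) (r a))
        where
        l : ∀ a x b → b ≡ ((x +ᶻ b) -ᶻ (a +ᶻ x)) +ᶻ a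
        l = solve-∀
        r : ∀ a → (0ℤ -ᶻ 0ℤ) +ᶻ a ≡ a
        r = solve-∀

    -- The recursion is symmetric under reversal of time, so j ↦ - w (n - j) is again a solution.
    -- The hypotheses say that it starts with the same two values as w.
    reflected : ∀ n → (∀ i → w 0 i ≡ 0ℤ) → (∀ i → w n i ≡ 0ℤ) → (∀ i → w (suc n) i ≡ w 1 i) →
      ∀ k j → k + j ≡ n → ∀ i → w j i ≡ - w k i
    reflected n w₀ wₙ wₙ₊₁ 0 j refl i = trans (wₙ i) (cong -_ (sym (w₀ i)))
    reflected n w₀ wₙ wₙ₊₁ 1 j refl i = trans (backwards j i)
      (trans (cong₂ _-ᶻ_ (trans (adj-cong wₙ i) (adj-0 i)) (wₙ₊₁ i)) (ℤ.+-identityˡ _))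
      where
      backwards : ∀ j i → w j i ≡ adj (w (suc j)) i -ᶻ w (2 + j) i
      backwards j i = trans (lemma (adj (w (suc j)) i) (w j i)) (cong (adj (w (suc j)) i -ᶻ_) (sym (wave j i)))
        where
        lemma : ∀ a b → b ≡ a -ᶻ (a -ᶻ b)
        lemma = solve-∀
    reflected n w₀ wₙ wₙ₊₁ (suc (suc k)) j refl i = begin
      w j i                                         ≡⟨ lemma (adj (w (suc j)) i) (w j i) ⟩
      adj (w (suc j)) i -ᶻ (adj (w (suc j)) i -ᶻ w j i)  ≡⟨ cong (adj (w (suc j)) i -ᶻ_) (sym (wave j i)) ⟩
      adj (w (suc j)) i -ᶻ w (2 + j) i
        ≡⟨ cong₂ _-ᶻ_ (trans (adj-cong (reflected n w₀ wₙ wₙ₊₁ (suc k) (suc j) (ℕ.+-suc (suc k) j)) i) (adj-neg (w (suc k)) i))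
                      (reflected n w₀ wₙ wₙ₊₁ k (2 + j) (trans (ℕ.+-suc k (suc j)) (cong suc (ℕ.+-suc k j))) i) ⟩
      - adj (w (suc k)) i -ᶻ (- w k i)               ≡⟨ lemma′ (adj (w (suc k)) i) (w k i) ⟩
      - (adj (w (suc k)) i -ᶻ w k i)                 ≡⟨ cong -_ (sym (wave k i)) ⟩
      - w (2 + k) i                                  ∎
      where
      open ≡-Reasoning
      lemma : ∀ a b → b ≡ a -ᶻ (a -ᶻ b)
      lemma = solve-∀
      lemma′ : ∀ a b → - a -ᶻ (- b) ≡ - (a -ᶻ b)
      lemma′ = solve-∀

    wave-U : (∀ i → w 0 i ≡ 0ℤ) → ∀ k i → w k i ≡ U k (w 1) i
    wave-U w₀ 0             i = w₀ i
    wave-U w₀ 1             i = refl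
    wave-U w₀ (suc (suc k)) i = trans (wave k i) (cong₂ _-ᶻ_ (adj-cong (wave-U w₀ (suc k)) i) (wave-U w₀ k i))

-- The reflection representation, with the scalar 2cos(π/m) replaced by the
-- adjacency operator of paths with m − 1 vertices.
module Reflection {a} {S : Set a} (m : S → S → ℕ) (isCoxeterMatrix : IsCoxeterMatrix m) where
  open IsCoxeterMatrix isCoxeterMatrix
  open Presentation m

  infix 4 _≟_

  -- The diagonal entries of the matrix are its only entries 1, so the matrix decides equality of
  -- generators.
  _≟_ : DecidableEquality S
  s ≟ t = map′ (Equivalence.to (diagonal s t)) (Equivalence.from (diagonal s t)) (m s t ℕ.≟ 1)

  -- For m = 0, which stands for ∞, truncated subtraction gives 0, and that encodes the infinite
  -- path.
  vertices : S → S → ℕ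
  vertices s t = m s t ∸ 1

  open module P s t = Path (vertices s t) using () renaming (adj to A)

  V : Set a
  V = S → ℕ → ℤ

  infix 4 _≈ⱽ_
  _≈ⱽ_ : V → V → Set a
  x ≈ⱽ y = ∀ u i → x u i ≡ y u i

  -- This is the contragredient form: x u is the value of a functional at the simple root of u. Only
  -- the coordinate of s is fed into the others, each through the operator of its own pair.
  act : S → V → V
  act s x u i with s ≟ u
  ... | yes _ = - x u i
  ... | no _  = x u i +ᶻ A s u (x s) i

  act-self : ∀ s x i → act s x s i ≡ - x s i
  act-self s x i with s ≟ s
  ... | yes _ = refl
  ... | no s≢s = contradiction refl s≢s

  act-other : ∀ {s u} → s ≢ u → ∀ x i → act s x u i ≡ x u i +ᶻ A s u (x s) i
  act-other {s} {u} s≢u x i with s ≟ u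
  ... | yes s≡u = contradiction s≡u s≢u
  ... | no _ = refl

  act-cong : ∀ s {x y} → x ≈ⱽ y → act s x ≈ⱽ act s y
  act-cong s x≈y u i with s ≟ u
  ... | yes _ = cong -_ (x≈y u i)
  ... | no _  = cong₂ _+ᶻ_ (x≈y u i) (P.adj-cong s u (x≈y s) i)

  acts : List S → V → V
  acts u x = foldr act x u

  acts-cong : ∀ u {x y} → x ≈ⱽ y → acts u x ≈ⱽ acts u y
  acts-cong []      x≈y = x≈y
  acts-cong (s ∷ u) x≈y = act-cong s (acts-cong u x≈y)

  acts-++ : ∀ u v x → acts (u ++ v) x ≡ acts u (acts v x)
  acts-++ []      v x = refl
  acts-++ (s ∷ u) v x = cong (act s) (acts-++ u v x)

  act-involutive : ∀ s x → act s (act s x) ≈ⱽ x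
  act-involutive s x u i with s ≟ u
  ... | yes refl = trans (cong -_ (act-self s x i)) (ℤ.neg-involutive (x s i))
  ... | no s≢u = begin
    act s x u i +ᶻ A s u (act s x s) i              ≡⟨ cong₂ _+ᶻ_ (act-other s≢u x i) (trans (P.adj-cong s u (act-self s x) i) (P.adj-neg s u (x s) i)) ⟩
    x u i +ᶻ A s u (x s) i +ᶻ - A s u (x s) i       ≡⟨ lemma (x u i) (A s u (x s) i) ⟩
    x u i                                           ∎
    where
    open ≡-Reasoning
    lemma : ∀ a b → a +ᶻ b +ᶻ - b ≡ a
    lemma = solve-∀

  rotation : S → S → ℕ → List S
  rotation s t n = concat (replicate n (s ∷ t ∷ []))

  module Rotation {s t : S} (s≢t : s ≢ t) (x : V) where

    t≢s : t ≢ s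
    t≢s = s≢t ∘ sym

    -- The coordinates of s and t, recorded alternately while the letters t and s act, form a single
    -- wave; the sign of the s-coordinate is chosen to make the recursion uniform.
    w : ℕ → ℕ → ℤ
    w 0             i = - x s i
    w 1             i = x t i
    w (suc (suc j)) i = A s t (w (suc j)) i -ᶻ w j i

    open Path.Wave (vertices s t) w (λ _ _ → refl) public

    A-sym : ∀ f i → A t s f i ≡ A s t f i
    A-sym f i = cong (λ n → Path.adj (n ∸ 1) f i) (symmetric t s)

    acts-s : ∀ k i → acts (rotation s t k) x s i ≡ - w (k * 2) i
    acts-t : ∀ k i → acts (rotation s t k) x t i ≡ w (k * 2 + 1) i

    module Step (k : ℕ) where
      y : V
      y = acts (rotation s t k) x

      y₁-t : ∀ i → act t y t i ≡ - w (k * 2 + 1) i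
      y₁-t i = trans (act-self t y i) (cong -_ (acts-t k i))

      y₁-s : ∀ i → act t y s i ≡ w (suc k * 2) i
      y₁-s i = begin
        act t y s i                                   ≡⟨ act-other t≢s y i ⟩
        y s i +ᶻ A t s (y t) i                        ≡⟨ cong₂ _+ᶻ_ (acts-s k i) (trans (P.adj-cong t s (acts-t k) i) (A-sym (w (k * 2 + 1)) i)) ⟩
        - w (k * 2) i +ᶻ A s t (w (k * 2 + 1)) i      ≡⟨ ℤ.+-comm (- w (k * 2) i) _ ⟩
        A s t (w (k * 2 + 1)) i -ᶻ w (k * 2) i        ≡⟨ cong (λ l → A s t (w l) i -ᶻ w (k * 2) i) (ℕ.+-comm (k * 2) 1) ⟩
        w (2 + k * 2) i                               ∎
        where open ≡-Reasoning

    acts-s zero    i = sym (ℤ.neg-involutive (x s i))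
    acts-s (suc k) i = trans (act-self s (act t y) i) (cong -_ (y₁-s i))
      where open Step k
    acts-t zero    i = refl
    acts-t (suc k) i = begin
      act s (act t y) t i                                     ≡⟨ act-other s≢t (act t y) i ⟩
      act t y t i +ᶻ A s t (act t y s) i                      ≡⟨ cong₂ _+ᶻ_ (y₁-t i) (P.adj-cong s t y₁-s i) ⟩
      - w (k * 2 + 1) i +ᶻ A s t (w (2 + k * 2)) i            ≡⟨ ℤ.+-comm (- w (k * 2 + 1) i) _ ⟩
      A s t (w (2 + k * 2)) i -ᶻ w (k * 2 + 1) i              ≡⟨ cong (λ l → A s t (w (suc l)) i -ᶻ w (k * 2 + 1) i) (ℕ.+-comm 1 (k * 2)) ⟩
      w (2 + (k * 2 + 1)) i                                   ∎
      where
      open ≡-Reasoning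
      open Step k

    -- A third coordinate collects the odd and the even terms of the wave separately. Over a full
    -- period both sums are zero by `sumʷ-period`.
    acts-u : ∀ {u} → s ≢ u → t ≢ u → ∀ k i →
      acts (rotation s t k) x u i ≡ x u i +ᶻ A t u (sumʷ k 1) i +ᶻ A s u (sumʷ k 2) i
    acts-u {u} s≢u t≢u zero i = sym (trans
      (cong₂ (λ a b → x u i +ᶻ a +ᶻ b) (P.adj-0 t u i) (P.adj-0 s u i))
      (trans (ℤ.+-identityʳ _) (ℤ.+-identityʳ _)))
    acts-u {u} s≢u t≢u (suc k) i = begin
      act s (act t y) u i                                     ≡⟨ act-other s≢u (act t y) i ⟩
      act t y u i +ᶻ A s u (act t y s) i                      ≡⟨ cong₂ _+ᶻ_ (act-other t≢u y i) (P.adj-cong s u y₁-s i) ⟩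
      y u i +ᶻ A t u (y t) i +ᶻ A s u (w (suc k * 2)) i       ≡⟨ cong (_+ᶻ A s u (w (suc k * 2)) i) (cong₂ _+ᶻ_ (acts-u s≢u t≢u k i) (P.adj-cong t u (acts-t k) i)) ⟩
      x u i +ᶻ A t u (sumʷ k 1) i +ᶻ A s u (sumʷ k 2) i +ᶻ A t u (w (k * 2 + 1)) i +ᶻ A s u (w (suc k * 2)) i
        ≡⟨ lemma (x u i) (A t u (sumʷ k 1) i) (A s u (sumʷ k 2) i) _ _ ⟩
      x u i +ᶻ (A t u (sumʷ k 1) i +ᶻ A t u (w (k * 2 + 1)) i) +ᶻ (A s u (sumʷ k 2) i +ᶻ A s u (w (suc k * 2)) i)
        ≡⟨ cong₂ (λ a b → x u i +ᶻ a +ᶻ b) (merge t 1) (trans (cong (λ l → A s u (sumʷ k 2) i +ᶻ A s u (w l) i) (ℕ.+-comm 2 (k * 2))) (merge s 2)) ⟩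
      x u i +ᶻ A t u (sumʷ (suc k) 1) i +ᶻ A s u (sumʷ (suc k) 2) i ∎
      where
      open ≡-Reasoning
      open Step k
      merge : ∀ r j → A r u (sumʷ k j) i +ᶻ A r u (w (k * 2 + j)) i ≡ A r u (sumʷ (suc k) j) i
      merge r j = trans (sym (P.adj-+ r u (sumʷ k j) (w (k * 2 + j)) i)) (P.adj-cong r u (λ i → sym (sumʷ-last k j i)) i)
      lemma : ∀ a b c d e → a +ᶻ b +ᶻ c +ᶻ d +ᶻ e ≡ a +ᶻ (b +ᶻ d) +ᶻ (c +ᶻ e)
      lemma = solve-∀

    acts-period : 0 < vertices s t → acts (rotation s t (suc (vertices s t))) x ≈ⱽ x
    acts-period 0<d u i = cases (s ≟ u) (t ≟ u)
      where
      n : ℕ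
      n = suc (vertices s t)
      cases : Dec (s ≡ u) → Dec (t ≡ u) → acts (rotation s t n) x u i ≡ x u i
      cases (yes refl) _ = begin
        acts (rotation s t n) x s i   ≡⟨ acts-s n i ⟩
        - w (n * 2) i                 ≡⟨ cong (λ l → - w l i) (ℕ.+-identityʳ (n * 2)) ⟨
        - w (n * 2 + 0) i             ≡⟨ cong -_ (periodic 0<d 0 i) ⟩
        - - x s i                     ≡⟨ ℤ.neg-involutive (x s i) ⟩
        x s i                         ∎
        where open ≡-Reasoning
      cases (no _) (yes refl) = trans (acts-t n i) (periodic 0<d 1 i)
      cases (no s≢u) (no t≢u) = begin
        acts (rotation s t n) x u i                                ≡⟨ acts-u s≢u t≢u n i ⟩
        x u i +ᶻ A t u (sumʷ n 1) i +ᶻ A s u (sumʷ n 2) i          ≡⟨ cong₂ (λ a b → x u i +ᶻ a +ᶻ b) (A-sum t 1) (A-sum s 2) ⟩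
        x u i +ᶻ 0ℤ +ᶻ 0ℤ                                          ≡⟨ trans (ℤ.+-identityʳ _) (ℤ.+-identityʳ _) ⟩
        x u i                                                      ∎
        where
        open ≡-Reasoning
        A-sum : ∀ r j → A r u (sumʷ n j) i ≡ 0ℤ
        A-sum r j = trans (P.adj-cong r u (sumʷ-period 0<d j) i) (P.adj-0 r u i)

  acts-relator : ∀ s t x → acts (relator s t) x ≈ⱽ x
  acts-relator s t x u i = cases (s ≟ t) (m s t) refl
    where
    cases : Dec (s ≡ t) → ∀ n → m s t ≡ n → acts (relator s t) x u i ≡ x u i
    cases (yes refl) _ _ = trans (cong (λ n → acts (rotation s s n) x u i) (Equivalence.from (diagonal s s) refl)) (act-involutive s x u i)
    cases (no s≢t) 0 mst≡ = cong (λ n → acts (rotation s t n) x u i) mst≡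
    cases (no s≢t) 1 mst≡ = contradiction (Equivalence.to (diagonal s t) mst≡) s≢t
    cases (no s≢t) (suc (suc n)) mst≡ = trans
      (cong (λ n → acts (rotation s t n) x u i) (trans mst≡ (sym (cong (λ n → suc (n ∸ 1)) mst≡))))
      (Rotation.acts-period s≢t x (subst (0 <_) (sym (cong (_∸ 1) mst≡)) (s≤s z≤n)) u i)

  acts-∼ : ∀ {u v} → u ∼ v → ∀ x → acts u x ≈ⱽ acts v x
  acts-∼ = EqClosure.fold record
    { refl  = λ _ _ _ → refl
    ; sym   = λ p x u i → sym (p x u i)
    ; trans = λ p q x u i → trans (p x u i) (q x u i)
    } acts-deletes
    where
    acts-deletes : ∀ {u v} → Deletes u v → ∀ x → acts u x ≈ⱽ acts v x
    acts-deletes (delete u s t v) x r i = begin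
      acts (u ++ relator s t ++ v) x r i           ≡⟨ cong (λ y → y r i) (acts-++ u (relator s t ++ v) x) ⟩
      acts u (acts (relator s t ++ v) x) r i       ≡⟨ cong (λ y → acts u y r i) (acts-++ (relator s t) v x) ⟩
      acts u (acts (relator s t) (acts v x)) r i   ≡⟨ acts-cong u (acts-relator s t (acts v x)) r i ⟩
      acts u (acts v x) r i                        ≡⟨ cong (λ y → y r i) (sym (acts-++ u v x)) ⟩
      acts (u ++ v) x r i                          ∎
      where open ≡-Reasoning

  -- If (st)^k = 1, then w is odd about k, so w k = − w k, whereas w k 0 = 1.
  rotation-order : ∀ {s t} → s ≢ t → ∀ k → 0 < k → k < m s t ⊎ m s t ≡ 0 → ¬ rotation s t k ∼ []
  rotation-order {s} {t} s≢t (suc k) _ k<m rel = contradiction (trans (sym one) (trans (reflected (suc k * 2) w₀ wₙ wₙ₊₁ (suc k) (suc k) (sym 2k) 0) (cong -_ one))) λ ()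
    where
    -- The t-coordinate is constantly 1, so whichever vertex `U-start₀` reads, the value is 1.
    x : V
    x u i with t ≟ u
    ... | yes _ = 1ℤ
    ... | no _  = 0ℤ
    open Rotation s≢t x
    x-t : ∀ i → x t i ≡ 1ℤ
    x-t i with t ≟ t
    ... | yes _ = refl
    ... | no t≢t = contradiction refl t≢t
    x-s : ∀ i → x s i ≡ 0ℤ
    x-s i with t ≟ s
    ... | yes t≡s = contradiction t≡s t≢s
    ... | no _ = refl
    w₀ : ∀ i → w 0 i ≡ 0ℤ
    w₀ i = cong -_ (x-s i)
    wₙ : ∀ i → w (suc k * 2) i ≡ 0ℤ
    wₙ i = trans (sym (ℤ.neg-involutive _)) (cong -_ (trans (sym (acts-s (suc k) i)) (trans (acts-∼ rel x s i) (x-s i))))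
    wₙ₊₁ : ∀ i → w (suc (suc k * 2)) i ≡ w 1 i
    wₙ₊₁ i = trans (cong (λ l → w l i) (ℕ.+-comm 1 (suc k * 2))) (trans (sym (acts-t (suc k) i)) (acts-∼ rel x t i))
    2k : suc k * 2 ≡ suc k + suc k
    2k = trans (ℕ.*-comm (suc k) 2) (cong (λ l → suc k + l) (ℕ.+-identityʳ (suc k)))
    k<vertices : k < vertices s t ⊎ vertices s t ≡ 0
    k<vertices = [ inj₁ ∘ ℕ.∸-monoˡ-≤ 1 , inj₂ ∘ cong (_∸ 1) ]′ k<m
    one : w (suc k) 0 ≡ 1ℤ
    one = trans (wave-U w₀ (suc k) 0) (trans (P.U-start₀ s t k k<vertices (w 1)) (x-t k))

-- Multisets modulo 2
module Parity {c ℓ} (A : Setoid c ℓ) where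
  private module A = Setoid A
  open A using (_≈_; Carrier)
  open Membership A using () renaming (_∈_ to _∈ᵍ_)
  open Permutation A
  open PermutationProperties A
  open CommutativeSemigroupProperties (CommutativeMonoid.commutativeSemigroup ++-commutativeMonoid) using (interchange)

  -- A half M is given in place of multiplicities, which could be counted only with decidable
  -- equality.
  Even : List Carrier → Set (c ⊔ ℓ)
  Even L = ∃[ M ] L ↭ M ++ M

  ∈⇒↭∷ : ∀ {t L} → t ∈ᵍ L → ∃[ L′ ] L ↭ t ∷ L′
  ∈⇒↭∷ {L = x ∷ L} (here t≈x) = L , prep (A.sym t≈x) ↭-refl
  ∈⇒↭∷ {t} {x ∷ L} (there t∈) with L′ , p ← ∈⇒↭∷ t∈ = x ∷ L′ , ↭-trans (prep A.refl p) (swap A.refl A.refl ↭-refl)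

  Even-resp-↭ : ∀ {L K} → L ↭ K → Even L → Even K
  Even-resp-↭ L↭K (M , p) = M , ↭-trans (↭-sym L↭K) p

  Even-++ : ∀ {L K} → Even L → Even K → Even (L ++ K)
  Even-++ (M , p) (M′ , q) = M ++ M′ , ↭-trans (++⁺ p q) (interchange M M M′ M′)

  Even-self : ∀ L → Even (L ++ L)
  Even-self L = L , ↭-refl

  -- An element of M ++ M occurs in both halves; removing the two copies keeps the halves equal.
  partner : ∀ {t L} → Even (t ∷ L) → ∃[ L′ ] L ↭ t ∷ L′ × Even L′
  partner {t} {L} (M , p) with M′ , q ← ∈⇒↭∷ ([ id , id ]′ (Any.++⁻ M (∈-resp-↭ p (here A.refl)))) =
    M′ ++ M′ , ↭-trans (drop-∷ (↭-trans p (++⁺ q q))) (↭-shift M′ M′) , M′ , ↭-refl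

  Even-cancel₂ : ∀ {t L} → Even (t ∷ t ∷ L) → Even L
  Even-cancel₂ even with L′ , p , even′ ← partner even = Even-resp-↭ (↭-sym (drop-∷ p)) even′

  Even-cancel : ∀ K {L} → Even ((K ++ K) ++ L) → Even L
  Even-cancel []      even = even
  Even-cancel (x ∷ K) {L} even = Even-cancel K (Even-cancel₂ (Even-resp-↭ (prep A.refl (++⁺ʳ L (↭-shift K K))) even))

  infix 4 _≈₂_
  _≈₂_ : List Carrier → List Carrier → Set (c ⊔ ℓ)
  L ≈₂ K = Even (L ++ K)

  ≈₂-sym : ∀ {L K} → L ≈₂ K → K ≈₂ L
  ≈₂-sym {L} {K} = Even-resp-↭ (++-comm L K)

  ≈₂-trans : ∀ {L K J} → L ≈₂ K → K ≈₂ J → L ≈₂ J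
  ≈₂-trans {L} {K} {J} p q = Even-cancel K
    (Even-resp-↭ (↭-trans (++⁺ʳ (K ++ J) (++-comm L K)) (interchange K L K J)) (Even-++ p q))

  Dup : List Carrier → Set (c ⊔ ℓ)
  Dup []      = ⊥ᴸ
  Dup (x ∷ L) = x ∈ᵍ L ⊎ Dup L

  Dup-resp-≋ : ∀ {L K} → Pointwise _≈_ L K → Dup L → Dup K
  Dup-resp-≋ (x≈y ∷ ps) (inj₁ x∈L) = inj₁ (Any-resp x≈y ps x∈L)
    where
    Any-resp : ∀ {x y L K} → x ≈ y → Pointwise _≈_ L K → x ∈ᵍ L → y ∈ᵍ K
    Any-resp x≈y (p ∷ ps) (here x≈)  = here (A.trans (A.sym x≈y) (A.trans x≈ p))
    Any-resp x≈y (p ∷ ps) (there x∈) = there (Any-resp x≈y ps x∈)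
  Dup-resp-≋ (x≈y ∷ ps) (inj₂ dup) = inj₂ (Dup-resp-≋ ps dup)

  ≈₂-∷⁻ : ∀ {x L K} → (x ∷ L) ≈₂ K → x ∈ᵍ L ⊎ ∃[ K′ ] K ↭ x ∷ K′ × L ≈₂ K′
  ≈₂-∷⁻ {x} {L} {K} even with J , p , even′ ← partner even
    with Any.++⁻ L (∈-resp-↭ (↭-sym p) (here A.refl))
  ... | inj₁ x∈L = inj₁ x∈L
  ... | inj₂ x∈K with K′ , q ← ∈⇒↭∷ x∈K =
    inj₂ (K′ , q , Even-resp-↭ (drop-∷ (↭-trans (↭-sym p) (↭-trans (++⁺ˡ L q) (↭-shift L K′)))) even′)

  -- Each entry of L cancels against a later entry of L or uses up one of K. As K is shorter, the
  -- first case must occur.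
  pigeonhole : ∀ L {K} → L ≈₂ K → length K < length L → Dup L
  pigeonhole (x ∷ L) {K} even lt with ≈₂-∷⁻ even
  ... | inj₁ x∈L = inj₁ x∈L
  ... | inj₂ (K′ , q , even′) = inj₂ (pigeonhole L even′ (ℕ.≤-pred (≡.subst (_< suc (length L)) (xs↭ys⇒|xs|≡|ys| q) lt)))

  ∈-≈₂ : ∀ {t} L {K} → L ≈₂ K → t ∈ᵍ L → Dup L ⊎ t ∈ᵍ K
  ∈-≈₂ (x ∷ L) even t∈ with ≈₂-∷⁻ even
  ... | inj₁ x∈L = inj₁ (inj₁ x∈L)
  ... | inj₂ (K′ , q , even′) with t∈
  ...   | here t≈x = inj₂ (∈-resp-↭ (↭-sym q) (here t≈x))
  ...   | there t∈L = [ inj₁ ∘ inj₂ , inj₂ ∘ ∈-resp-↭ (↭-sym q) ∘ there ]′ (∈-≈₂ L even′ t∈L)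

module Coxeter {c ℓ a} (X : CoxeterSystem c ℓ a) where
  open CoxeterSystem X
  private module G = Group W
  open G using (∙-congˡ; ∙-congʳ; assoc; identityˡ; identityʳ)
  open GroupProperties W using (∙-cancelˡ; ∙-cancelʳ)
  open import Relation.Binary.Reasoning.Setoid setoid
  open Membership setoid using () renaming (_∈_ to _∈ᵍ_)
  open Parity setoid
  open ListEquality setoid using (_≋_; ≋-trans; ≋-sym)
  private module Perm = PermutationProperties setoid
  open Permutation setoid using (_↭_; prep; ↭-refl; ↭-trans; ↭-sym; ↭-reflexive-≋)
  open Reflection m isCoxeterMatrix using (_≟_; rotation; rotation-order)
  open IsCoxeterMatrix isCoxeterMatrix

  ⟨⟩-++ : ∀ u v → ⟨ u ++ v ⟩ ≈ ⟨ u ⟩ ∙ ⟨ v ⟩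
  ⟨⟩-++ []      v = G.sym (identityˡ _)
  ⟨⟩-++ (s ∷ u) v = G.trans (∙-congˡ (⟨⟩-++ u v)) (G.sym (assoc _ _ _))

  ⟨⟩-++ˡ : ∀ u {v w} → ⟨ v ⟩ ≈ ⟨ w ⟩ → ⟨ u ++ v ⟩ ≈ ⟨ u ++ w ⟩
  ⟨⟩-++ˡ []      v≈w = v≈w
  ⟨⟩-++ˡ (s ∷ u) v≈w = ∙-congˡ (⟨⟩-++ˡ u v≈w)

  ⟨⟩-++ʳ : ∀ {u v} w → ⟨ u ⟩ ≈ ⟨ v ⟩ → ⟨ u ++ w ⟩ ≈ ⟨ v ++ w ⟩
  ⟨⟩-++ʳ {u} {v} w u≈v = begin
    ⟨ u ++ w ⟩      ≈⟨ ⟨⟩-++ u w ⟩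
    ⟨ u ⟩ ∙ ⟨ w ⟩   ≈⟨ ∙-congʳ u≈v ⟩
    ⟨ v ⟩ ∙ ⟨ w ⟩   ≈⟨ ⟨⟩-++ v w ⟨
    ⟨ v ++ w ⟩      ∎

  relator≈ε : ∀ s t → ⟨ relator s t ⟩ ≈ ε
  relator≈ε s t = Equivalence.from (presented (relator s t) [])
    (≡.subst (_∼ []) (List.++-identityʳ (relator s t)) (EqClosure.return (delete [] s t [])))

  gen-involutive : ∀ s x → gen s ∙ (gen s ∙ x) ≈ x
  gen-involutive s x = begin
    gen s ∙ (gen s ∙ x)        ≈⟨ assoc _ _ _ ⟨
    (gen s ∙ gen s) ∙ x        ≈⟨ ∙-congʳ (∙-congˡ (identityʳ _)) ⟨
    ⟨ s ∷ s ∷ [] ⟩ ∙ x         ≡⟨ ≡.cong (λ n → ⟨ rotation s s n ⟩ ∙ x) (Equivalence.from (diagonal s s) refl) ⟨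
    ⟨ relator s s ⟩ ∙ x        ≈⟨ ∙-congʳ (relator≈ε s s) ⟩
    ε ∙ x                      ≈⟨ identityˡ x ⟩
    x                          ∎

  gen-transpose : ∀ {s x y} → gen s ∙ x ≈ y → x ≈ gen s ∙ y
  gen-transpose {s} {x} eq = G.trans (G.sym (gen-involutive s x)) (∙-congˡ eq)

  -- Reflections

  conj : S → Element → Element
  conj s x = gen s ∙ (x ∙ gen s)

  conj-cong : ∀ s {x y} → x ≈ y → conj s x ≈ conj s y
  conj-cong s x≈y = ∙-congˡ (∙-congʳ x≈y)

  conj-∙ : ∀ s x y → conj s x ∙ (gen s ∙ y) ≈ gen s ∙ (x ∙ y)
  conj-∙ s x y = begin
    (gen s ∙ (x ∙ gen s)) ∙ (gen s ∙ y)    ≈⟨ assoc _ _ _ ⟩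
    gen s ∙ ((x ∙ gen s) ∙ (gen s ∙ y))    ≈⟨ ∙-congˡ (assoc _ _ _) ⟩
    gen s ∙ (x ∙ (gen s ∙ (gen s ∙ y)))    ≈⟨ ∙-congˡ (∙-congˡ (gen-involutive s y)) ⟩
    gen s ∙ (x ∙ y)                        ∎

  conj-involutive : ∀ s x → conj s (conj s x) ≈ x
  conj-involutive s x = begin
    gen s ∙ (conj s x ∙ gen s)            ≈⟨ ∙-congˡ (∙-congˡ (identityʳ _)) ⟨
    gen s ∙ (conj s x ∙ (gen s ∙ ε))      ≈⟨ ∙-congˡ (conj-∙ s x ε) ⟩
    gen s ∙ (gen s ∙ (x ∙ ε))             ≈⟨ gen-involutive s _ ⟩
    x ∙ ε                                 ≈⟨ identityʳ x ⟩
    x                                     ∎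

  conj-transpose : ∀ s {x y} → x ≈ conj s y → conj s x ≈ y
  conj-transpose s {x} {y} eq = G.trans (conj-cong s eq) (conj-involutive s y)

  conj-gen : ∀ s → conj s (gen s) ≈ gen s
  conj-gen s = G.trans (gen-involutive s (gen s)) G.refl

  -- The reflections t_i = s₁ ⋯ s_i ⋯ s₁ of the word s₁ ⋯ s_k.
  N : List S → List Element
  N []      = []
  N (s ∷ u) = gen s ∷ map (conj s) (N u)

  length-N : ∀ u → length (N u) ≡ length u
  length-N []      = refl
  length-N (s ∷ u) = ≡.cong suc (≡.trans (List.length-map (conj s) (N u)) (length-N u))

  conj* : List S → Element → Element
  conj* u x = foldr conj x u

  N-++ : ∀ u v → N (u ++ v) ≡ N u ++ map (conj* u) (N v)
  N-++ []      v = ≡.sym (List.map-id (N v))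
  N-++ (s ∷ u) v = ≡.cong (gen s ∷_) (≡.trans (≡.cong (map (conj s)) (N-++ u v))
    (≡.trans (List.map-++ (conj s) (N u) _) (≡.cong (map (conj s) (N u) ++_) (≡.sym (List.map-∘ (N v))))))

  -- The equation conj* u x = u x u⁻¹, written without inverses.
  conj*-∙ : ∀ u x → conj* u x ∙ ⟨ u ⟩ ≈ ⟨ u ⟩ ∙ x
  conj*-∙ []      x = G.trans (identityʳ x) (G.sym (identityˡ x))
  conj*-∙ (s ∷ u) x = begin
    conj s (conj* u x) ∙ (gen s ∙ ⟨ u ⟩)   ≈⟨ conj-∙ s _ _ ⟩
    gen s ∙ (conj* u x ∙ ⟨ u ⟩)            ≈⟨ ∙-congˡ (conj*-∙ u x) ⟩
    gen s ∙ (⟨ u ⟩ ∙ x)                    ≈⟨ assoc _ _ _ ⟨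
    (gen s ∙ ⟨ u ⟩) ∙ x                    ∎

  ∈N-∷⁻ : ∀ {x s u} → x ∈ᵍ N (s ∷ u) → x ≈ gen s ⊎ conj s x ∈ᵍ N u
  ∈N-∷⁻ (here x≈s) = inj₁ x≈s
  ∈N-∷⁻ {s = s} (there x∈) = inj₂ (Any.map (conj-transpose s) (Any.map⁻ x∈))

  ∈N-∷⁺ : ∀ {x s u} → conj s x ∈ᵍ N u → x ∈ᵍ N (s ∷ u)
  ∈N-∷⁺ {x} {s} cx∈ = there (Any.map⁺ (Any.map (λ cx≈y → G.trans (G.sym (conj-involutive s x)) (conj-cong s cx≈y)) cx∈))

  ∈N-++⁻ : ∀ u v {x} → x ∈ᵍ N (u ++ v) → x ∈ᵍ N u ⊎ ∃[ y ] y ∈ᵍ N v × x ∙ ⟨ u ⟩ ≈ ⟨ u ⟩ ∙ y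
  ∈N-++⁻ []      v {x} x∈ = inj₂ (x , x∈ , G.trans (identityʳ x) (G.sym (identityˡ x)))
  ∈N-++⁻ (s ∷ u) v {x} x∈ with ∈N-∷⁻ x∈
  ... | inj₁ x≈s = inj₁ (here x≈s)
  ... | inj₂ cx∈ with ∈N-++⁻ u v cx∈
  ...   | inj₁ cx∈u = inj₁ (∈N-∷⁺ cx∈u)
  ...   | inj₂ (y , y∈ , eq) = inj₂ (y , y∈ , (begin
    x ∙ (gen s ∙ ⟨ u ⟩)                   ≈⟨ ∙-congʳ (conj-involutive s x) ⟨
    conj s (conj s x) ∙ (gen s ∙ ⟨ u ⟩)   ≈⟨ conj-∙ s _ _ ⟩
    gen s ∙ (conj s x ∙ ⟨ u ⟩)            ≈⟨ ∙-congˡ eq ⟩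
    gen s ∙ (⟨ u ⟩ ∙ y)                   ≈⟨ assoc _ _ _ ⟨
    (gen s ∙ ⟨ u ⟩) ∙ y                   ∎))

  conj*∈N : ∀ u s v → conj* u (gen s) ∈ᵍ N (u ++ s ∷ v)
  conj*∈N u s v = ≡.subst (conj* u (gen s) ∈ᵍ_) (≡.sym (N-++ u (s ∷ v))) (Any.++⁺ʳ (N u) (here G.refl))

  -- Alternating words

  alt : S → S → ℕ → List S
  alt s t zero    = []
  alt s t (suc k) = s ∷ alt t s k

  length-alt : ∀ s t k → length (alt s t k) ≡ k
  length-alt s t zero    = refl
  length-alt s t (suc k) = ≡.cong suc (length-alt t s k)

  alt-even : ∀ s t n k → alt s t (n * 2 + k) ≡ alt s t (n * 2) ++ alt s t k
  alt-even s t zero    k = refl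
  alt-even s t (suc n) k = ≡.cong (λ u → s ∷ t ∷ u) (alt-even s t n k)

  rotation≡alt : ∀ s t n → rotation s t n ≡ alt s t (n * 2)
  rotation≡alt s t zero    = refl
  rotation≡alt s t (suc n) = ≡.cong (λ u → s ∷ t ∷ u) (rotation≡alt s t n)

  -- The reflection (st)^k s of the dihedral subgroup.
  ρ : S → S → ℕ → Element
  ρ s t k = ⟨ alt s t (suc (k * 2)) ⟩

  conj-ρ : ∀ s t k → conj s (ρ t s k) ≈ ρ s t (suc k)
  conj-ρ s t k = ∙-congˡ (begin
    ρ t s k ∙ gen s                           ≈⟨ ∙-congˡ (identityʳ _) ⟨
    ρ t s k ∙ ⟨ s ∷ [] ⟩                      ≈⟨ ⟨⟩-++ (alt t s (suc (k * 2))) (s ∷ []) ⟨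
    ⟨ alt t s (suc (k * 2)) ++ s ∷ [] ⟩       ≡⟨ ≡.cong ⟨_⟩ (snoc t s k) ⟨
    ⟨ alt t s (2 + k * 2) ⟩                   ∎)
    where
    snoc : ∀ s t k → alt s t (2 + k * 2) ≡ alt s t (suc (k * 2)) ++ t ∷ []
    snoc s t zero    = refl
    snoc s t (suc k) = ≡.cong (λ u → s ∷ t ∷ u) (snoc s t k)

  ρ-+ : ∀ s t n k → ρ s t (n + k) ≈ ⟨ alt s t (n * 2) ⟩ ∙ ρ s t k
  ρ-+ s t n k = begin
    ⟨ alt s t (suc ((n + k) * 2)) ⟩              ≡⟨ ≡.cong (λ l → ⟨ alt s t l ⟩) (≡.trans (≡.cong suc (ℕ.*-distribʳ-+ 2 n k)) (≡.sym (ℕ.+-suc (n * 2) (k * 2)))) ⟩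
    ⟨ alt s t (n * 2 + suc (k * 2)) ⟩            ≡⟨ ≡.cong ⟨_⟩ (alt-even s t n (suc (k * 2))) ⟩
    ⟨ alt s t (n * 2) ++ alt s t (suc (k * 2)) ⟩  ≈⟨ ⟨⟩-++ (alt s t (n * 2)) _ ⟩
    ⟨ alt s t (n * 2) ⟩ ∙ ρ s t k                ∎

  ρs : S → S → ℕ → ℕ → List Element
  ρs s t j zero    = []
  ρs s t j (suc k) = ρ s t j ∷ ρs s t (suc j) k

  conj-ρs : ∀ s t j k → map (conj s) (ρs t s j k) ≋ ρs s t (suc j) k
  conj-ρs s t j zero    = []
  conj-ρs s t j (suc k) = conj-ρ s t j ∷ conj-ρs s t (suc j) k

  map-conj-≋ : ∀ s {L K} → L ≋ K → map (conj s) L ≋ map (conj s) K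
  map-conj-≋ s []       = []
  map-conj-≋ s (p ∷ ps) = conj-cong s p ∷ map-conj-≋ s ps

  N-alt : ∀ s t k → N (alt s t k) ≋ ρs s t 0 k
  N-alt s t zero    = []
  N-alt s t (suc k) = G.sym (identityʳ _) ∷ ≋-trans (map-conj-≋ s (N-alt t s k)) (conj-ρs s t 0 k)

  ρs-++ : ∀ s t j k l → ρs s t j (k + l) ≡ ρs s t j k ++ ρs s t (j + k) l
  ρs-++ s t j zero    l = ≡.cong (λ j → ρs s t j l) (≡.sym (ℕ.+-identityʳ j))
  ρs-++ s t j (suc k) l = ≡.cong (ρ s t j ∷_) (≡.trans (ρs-++ s t (suc j) k l)
    (≡.cong (λ i → ρs s t (suc j) k ++ ρs s t i l) (≡.sym (ℕ.+-suc j k))))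

  ρs-period : ∀ s t n → ⟨ alt s t (n * 2) ⟩ ≈ ε → ∀ j k → ρs s t (n + j) k ≋ ρs s t j k
  ρs-period s t n eq j zero    = []
  ρs-period s t n eq j (suc k) = G.trans (ρ-+ s t n j) (G.trans (∙-congʳ eq) (identityˡ _))
    ∷ ≡.subst (λ i → ρs s t i k ≋ ρs s t (suc j) k) (ℕ.+-suc n j) (ρs-period s t n eq (suc j) k)

  alt-m≈ε : ∀ s t → ⟨ alt s t (m s t * 2) ⟩ ≈ ε
  alt-m≈ε s t = G.trans (G.reflexive (≡.cong ⟨_⟩ (≡.sym (rotation≡alt s t (m s t))))) (relator≈ε s t)

  -- The reflections of (st)^m are ρ 0, ..., ρ (2m - 1). Since (st)^m = 1, the second m of them
  -- repeat the first m.
  N-relator : ∀ s t → Even (N (relator s t))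
  N-relator s t = ρs s t 0 n , ↭-reflexive-≋ (≡.subst (λ L → N (relator s t) ≋ L) eq
      (≡.subst (λ u → N u ≋ ρs s t 0 (n * 2)) (≡.sym (rotation≡alt s t n)) (N-alt s t (n * 2))))
    ⟨↭⟩ Perm.++⁺ˡ (ρs s t 0 n) (↭-reflexive-≋ (≡.subst (λ i → ρs s t i n ≋ ρs s t 0 n) (ℕ.+-identityʳ n)
      (ρs-period s t n (alt-m≈ε s t) 0 n)))
    where
    n = m s t
    _⟨↭⟩_ = ↭-trans
    eq : ρs s t 0 (n * 2) ≡ ρs s t 0 n ++ ρs s t n n
    eq = ≡.trans (≡.cong (ρs s t 0) (≡.trans (ℕ.*-comm n 2) (≡.cong (n +_) (ℕ.+-identityʳ n)))) (ρs-++ s t 0 n n)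

  Even-conj : ∀ s {L K} → L ≈₂ K → map (conj s) L ≈₂ map (conj s) K
  Even-conj s {L} {K} (M , p) = map (conj s) M ,
    ≡.subst₂ _↭_ (List.map-++ (conj s) L K) (List.map-++ (conj s) M M) (Perm.map⁺ setoid (conj-cong s) p)

  -- A relator contributes an even list and conjugates the reflections after it trivially. Letters
  -- in front conjugate both sides alike.
  N-deletes : ∀ {u v} → Deletes u v → N u ≈₂ N v
  N-deletes (delete [] s t v) = ≡.subst (λ L → Even (L ++ N v)) (≡.sym (N-++ (relator s t) v))
    (≡.subst Even (≡.sym (List.++-assoc (N (relator s t)) _ (N v)))
      (Even-++ (N-relator s t) (Even-resp-↭ (Perm.++⁺ʳ (N v) (↭-reflexive-≋ (≋-sym conj≋))) (Even-self (N v)))))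
    where
    conj≈ : ∀ x → conj* (relator s t) x ≈ x
    conj≈ x = begin
      conj* (relator s t) x                        ≈⟨ identityʳ _ ⟨
      conj* (relator s t) x ∙ ε                    ≈⟨ ∙-congˡ (relator≈ε s t) ⟨
      conj* (relator s t) x ∙ ⟨ relator s t ⟩      ≈⟨ conj*-∙ (relator s t) x ⟩
      ⟨ relator s t ⟩ ∙ x                          ≈⟨ ∙-congʳ (relator≈ε s t) ⟩
      ε ∙ x                                        ≈⟨ identityˡ x ⟩
      x                                            ∎
    conj≋ : ∀ {L} → map (conj* (relator s t)) L ≋ L
    conj≋ {[]}    = []
    conj≋ {x ∷ L} = conj≈ x ∷ conj≋
  N-deletes (delete (r ∷ u) s t v) = Even-resp-↭
    (prep G.refl (↭-sym (Perm.↭-shift (map (conj r) (N (u ++ relator s t ++ v))) (map (conj r) (N (u ++ v))))))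
    (Even-++ {L = gen r ∷ gen r ∷ []} (gen r ∷ [] , ↭-refl) (Even-conj r {N (u ++ relator s t ++ v)} {N (u ++ v)} (N-deletes (delete u s t v))))

  N-≈ : ∀ u v → ⟨ u ⟩ ≈ ⟨ v ⟩ → N u ≈₂ N v
  N-≈ u v = EqClosure.fold record
    { refl  = λ {u} → Even-self (N u)
    ; sym   = λ {u} {v} → ≈₂-sym {N u} {N v}
    ; trans = λ {u} {v} {w} → ≈₂-trans {N u} {N v} {N w}
    } N-deletes ∘ Equivalence.to (presented u v)

  -- Deletion and exchange

  -- Multiplying by s₁ ⋯ s_i ⋯ s₁ on the left cancels the letter s_i.
  delete-reflection : ∀ u {x} → x ∈ᵍ N u → ∃[ u′ ] u′ ⊆ u × suc (length u′) ≡ length u × ⟨ u′ ⟩ ≈ x ∙ ⟨ u ⟩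
  delete-reflection (s ∷ u) {x} x∈ with ∈N-∷⁻ x∈
  ... | inj₁ x≈s = u , s ∷ʳ ⊆-refl , refl , (begin
    ⟨ u ⟩                        ≈⟨ gen-involutive s _ ⟨
    gen s ∙ (gen s ∙ ⟨ u ⟩)      ≈⟨ ∙-congʳ x≈s ⟨
    x ∙ (gen s ∙ ⟨ u ⟩)          ∎)
  ... | inj₂ cx∈ with u′ , sub , len , eq ← delete-reflection u cx∈ =
    s ∷ u′ , refl ∷ sub , ≡.cong suc len , (begin
    gen s ∙ ⟨ u′ ⟩                          ≈⟨ ∙-congˡ eq ⟩
    gen s ∙ (conj s x ∙ ⟨ u ⟩)              ≈⟨ conj-∙ s _ _ ⟨
    conj s (conj s x) ∙ (gen s ∙ ⟨ u ⟩)     ≈⟨ ∙-congʳ (conj-involutive s x) ⟩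
    x ∙ (gen s ∙ ⟨ u ⟩)                     ∎)

  Dup-N-∷⁻ : ∀ {s u} → Dup (N (s ∷ u)) → gen s ∈ᵍ N u ⊎ Dup (N u)
  Dup-N-∷⁻ {s} {u} (inj₁ s∈) = inj₁ (Any.map (λ s≈cx → G.trans (G.sym (conj-gen s)) (conj-transpose s s≈cx)) (Any.map⁻ s∈))
  Dup-N-∷⁻ {s} {u} (inj₂ dup) = inj₂ (Dup-conj (N u) dup)
    where
    Dup-conj : ∀ L → Dup (map (conj s) L) → Dup L
    Dup-conj (x ∷ L) (inj₁ x∈) = inj₁ (Any.map (λ {y} cx≈cy → G.trans (G.sym (conj-involutive s x)) (conj-transpose s cx≈cy)) (Any.map⁻ x∈))
    Dup-conj (x ∷ L) (inj₂ dup) = inj₂ (Dup-conj L dup)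

  -- After a common prefix is removed, the repetition says that the first letter s is a reflection
  -- of the remaining word; s then cancels against the letter that this reflection deletes.
  delete-pair : ∀ u → Dup (N u) → ∃[ u′ ] u′ ⊆ u × length u′ < length u × ⟨ u′ ⟩ ≈ ⟨ u ⟩
  delete-pair (s ∷ u) dup with Dup-N-∷⁻ {s} {u} dup
  ... | inj₁ s∈ with u′ , sub , len , eq ← delete-reflection u s∈ =
    u′ , s ∷ʳ sub , ℕ.≤-trans (ℕ.≤-reflexive len) (ℕ.n≤1+n _) , eq
  ... | inj₂ dup′ with u′ , sub , lt , eq ← delete-pair u dup′ = s ∷ u′ , refl ∷ sub , s≤s lt , ∙-congˡ eq

  shorter⇒Dup : ∀ u v → ⟨ v ⟩ ≈ ⟨ u ⟩ → length v < length u → Dup (N u)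
  shorter⇒Dup u v v≈u lt = pigeonhole (N u) (N-≈ u v (G.sym v≈u))
    (≡.subst₂ _<_ (≡.sym (length-N v)) (≡.sym (length-N u)) lt)

  deletion : ∀ u v → ⟨ v ⟩ ≈ ⟨ u ⟩ → length v < length u → ∃[ u′ ] u′ ⊆ u × length u′ < length u × ⟨ u′ ⟩ ≈ ⟨ u ⟩
  deletion u v v≈u lt = delete-pair u (shorter⇒Dup u v v≈u lt)

  -- The informative half of `Reduced`. Since it is a record, u can be recovered by unification,
  -- which ⟨ u ⟩ alone would not allow.
  record Red (u : List S) : Set (ℓ ⊔ a) where
    constructor mkRed
    field shortest : ∀ v → ⟨ v ⟩ ≈ ⟨ u ⟩ → length u ≤ length v
  open Red public

  Red⇒Reduced : ∀ {u} → Red u → Reduced u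
  Red⇒Reduced {u} red = (u , G.refl , refl) , shortest red

  Reduced⇒Red : ∀ {u} → Reduced u → Red u
  Reduced⇒Red = mkRed ∘ proj₂

  Red-[] : Red []
  Red-[] = mkRed λ _ _ → z≤n

  ¬Dup⇒Red : ∀ u → ¬ Dup (N u) → Red u
  ¬Dup⇒Red u ¬dup = mkRed λ v v≈u → ℕ.≮⇒≥ (¬dup ∘ shorter⇒Dup u v v≈u)

  Red⇒¬Dup : ∀ {u} → Red u → ¬ Dup (N u)
  Red⇒¬Dup {u} red dup with u′ , _ , lt , eq ← delete-pair u dup = ℕ.<⇒≱ lt (shortest red u′ eq)

  Red-resp : ∀ {u v} → Red u → ⟨ u ⟩ ≈ ⟨ v ⟩ → length v ≤ length u → Red v
  Red-resp red u≈v v≤u = mkRed λ w w≈v → ℕ.≤-trans v≤u (shortest red w (G.trans w≈v (G.sym u≈v)))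

  Red-++ʳ : ∀ u {v} → Red (u ++ v) → Red v
  Red-++ʳ u {v} red = mkRed λ w w≈v → ℕ.+-cancelˡ-≤ (length u) _ _
    (≡.subst₂ _≤_ (List.length-++ u) (List.length-++ u) (shortest red (u ++ w) (⟨⟩-++ˡ u {w} {v} w≈v)))

  Red-++ˡ : ∀ u {v} → Red (u ++ v) → Red u
  Red-++ˡ u {v} red = mkRed λ w w≈u → ℕ.+-cancelʳ-≤ (length v) _ _
    (≡.subst₂ _≤_ (List.length-++ u) (List.length-++ w) (shortest red (w ++ v) (⟨⟩-++ʳ {w} {u} v w≈u)))

  -- The reflections of s u repeat, those of the reduced u do not, so the repeated one is s.
  exchange : ∀ {s u} → Red u → ∀ v → ⟨ v ⟩ ≈ ⟨ s ∷ u ⟩ → length v ≤ length u → gen s ∈ᵍ N u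
  exchange {s} {u} red v v≈su v≤u = [ id , (λ dup → contradiction dup (Red⇒¬Dup {u} red)) ]′
    (Dup-N-∷⁻ {s} {u} (shorter⇒Dup (s ∷ u) v v≈su (s≤s v≤u)))

  Red-∷ : ∀ {s u} → Red u → ¬ gen s ∈ᵍ N u → Red (s ∷ u)
  Red-∷ red s∉ = mkRed λ v v≈su → ℕ.≰⇒> (s∉ ∘ exchange red v v≈su)

  Red-∷⇒∉N : ∀ {s u} → Red (s ∷ u) → ¬ gen s ∈ᵍ N u
  Red-∷⇒∉N {s} {u} red s∈ = Red⇒¬Dup {s ∷ u} red (inj₁ (Any.map⁺ (Any.map (λ {x} s≈x → G.trans (G.sym (conj-gen s)) (conj-cong s s≈x)) s∈)))

  ∈N-≈ : ∀ u v → ⟨ u ⟩ ≈ ⟨ v ⟩ → Red u → ∀ {x} → x ∈ᵍ N u → x ∈ᵍ N v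
  ∈N-≈ u v u≈v red x∈ = [ (λ dup → contradiction dup (Red⇒¬Dup {u} red)) , id ]′ (∈-≈₂ (N u) (N-≈ u v u≈v) x∈)

  -- Dihedral subgroups

  alt-order : ∀ {s t} → s ≢ t → ∀ n → 0 < n → n < m s t ⊎ m s t ≡ 0 → ¬ ⟨ alt s t (n * 2) ⟩ ≈ ε
  alt-order {s} {t} s≢t n 0<n n<m eq = rotation-order s≢t n 0<n n<m
    (≡.subst (_∼ []) (≡.sym (rotation≡alt s t n)) (Equivalence.to (presented (alt s t (n * 2)) []) eq))

  -- From ρ i = ρ (n + i) and ρ (n + i) = (st)^n ρ i it follows that (st)^n = 1.
  Dup-ρs : ∀ s t j k → Dup (ρs s t j k) → ∃[ n ] 0 < n × n < k × ⟨ alt s t (n * 2) ⟩ ≈ ε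
  Dup-ρs s t j (suc k) (inj₂ dup) with n , 0<n , n<k , eq ← Dup-ρs s t (suc j) k dup =
    n , 0<n , ℕ.m<n⇒m<1+n n<k , eq
  Dup-ρs s t j (suc k) (inj₁ ρ∈) = let n , n<k , eq = find 1 k ρ∈ in
    suc n , s≤s z≤n , s≤s n<k , ∙-cancelʳ (ρ s t j) _ _ (begin
      ⟨ alt s t (suc n * 2) ⟩ ∙ ρ s t j   ≈⟨ ρ-+ s t (suc n) j ⟨
      ρ s t (suc n + j)                   ≡⟨ ≡.cong (λ i → ρ s t (suc i)) (ℕ.+-comm n j) ⟩
      ρ s t (suc (j + n))                 ≈⟨ eq ⟨
      ρ s t j                             ≈⟨ identityˡ _ ⟨
      ε ∙ ρ s t j                         ∎)
    where
    find : ∀ i k → ρ s t j ∈ᵍ ρs s t (i + j) k → ∃[ n ] n < k × ρ s t j ≈ ρ s t (i + (j + n))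
    find i (suc k) (here eq) = 0 , s≤s z≤n , G.trans eq (G.reflexive (≡.cong (λ l → ρ s t (i + l)) (≡.sym (ℕ.+-identityʳ j))))
    find i (suc k) (there ρ∈) with n , n<k , eq ← find (suc i) k ρ∈ =
      suc n , s≤s n<k , G.trans eq (G.reflexive (≡.cong (ρ s t) (≡.trans (≡.sym (ℕ.+-suc i (j + n))) (≡.cong (i +_) (≡.sym (ℕ.+-suc j n))))))

  alt-Red : ∀ {s t} → s ≢ t → ∀ k → k ≤ m s t ⊎ m s t ≡ 0 → Red (alt s t k)
  alt-Red {s} {t} s≢t k k≤m = ¬Dup⇒Red (alt s t k) λ dup →
    let n , 0<n , n<k , eq = Dup-ρs s t 0 k (Dup-resp-≋ (N-alt s t k) dup)
    in alt-order s≢t n 0<n ([ inj₁ ∘ ℕ.<-≤-trans n<k , inj₂ ]′ k≤m) eq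

  next : S → S → ℕ → S
  next s t zero    = s
  next s t (suc k) = next t s k

  alt-snoc : ∀ s t k → alt s t (suc k) ≡ alt s t k ++ next s t k ∷ []
  alt-snoc s t zero    = refl
  alt-snoc s t (suc k) = ≡.cong (s ∷_) (alt-snoc t s k)

  next-even : ∀ s t n → next s t (n * 2) ≡ s
  next-even s t zero    = refl
  next-even s t (suc n) = next-even s t n

  alt-cancel : ∀ s t j k → ⟨ alt s t (j + k) ⟩ ∙ ⟨ alt (next t s (j + k)) (next s t (j + k)) j ⟩ ≈ ⟨ alt s t k ⟩
  alt-cancel s t zero    k = identityʳ _
  alt-cancel s t (suc j) k = begin
    ⟨ alt s t (suc (j + k)) ⟩ ∙ (gen r ∙ ⟨ w ⟩)              ≡⟨ ≡.cong (λ u → ⟨ u ⟩ ∙ (gen r ∙ ⟨ w ⟩)) (alt-snoc s t (j + k)) ⟩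
    ⟨ alt s t (j + k) ++ r ∷ [] ⟩ ∙ (gen r ∙ ⟨ w ⟩)          ≈⟨ ∙-congʳ (⟨⟩-++ (alt s t (j + k)) (r ∷ [])) ⟩
    (⟨ alt s t (j + k) ⟩ ∙ (gen r ∙ ε)) ∙ (gen r ∙ ⟨ w ⟩)    ≈⟨ assoc _ _ _ ⟩
    ⟨ alt s t (j + k) ⟩ ∙ ((gen r ∙ ε) ∙ (gen r ∙ ⟨ w ⟩))    ≈⟨ ∙-congˡ (∙-congʳ (identityʳ _)) ⟩
    ⟨ alt s t (j + k) ⟩ ∙ (gen r ∙ (gen r ∙ ⟨ w ⟩))          ≈⟨ ∙-congˡ (gen-involutive r _) ⟩
    ⟨ alt s t (j + k) ⟩ ∙ ⟨ w ⟩                              ≈⟨ alt-cancel s t j k ⟩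
    ⟨ alt s t k ⟩                                            ∎
    where
    r = next s t (j + k)
    w = alt (next t s (j + k)) (next s t (j + k)) j

  -- Prefix the trivial word (ts)^m to the left side: its last m letters cancel against `alt s t m`
  -- and leave its first m.
  alt-braid : ∀ s t → ⟨ alt s t (m s t) ⟩ ≈ ⟨ alt t s (m s t) ⟩
  alt-braid s t = begin
    ⟨ alt s t n ⟩                                        ≈⟨ identityˡ _ ⟨
    ε ∙ ⟨ alt s t n ⟩                                    ≈⟨ ∙-congʳ (alt-m≈ε t s) ⟨
    ⟨ alt t s (m t s * 2) ⟩ ∙ ⟨ alt s t n ⟩              ≡⟨ ≡.cong (λ k → ⟨ alt t s (k * 2) ⟩ ∙ ⟨ alt s t n ⟩) (symmetric t s) ⟩
    ⟨ alt t s (n * 2) ⟩ ∙ ⟨ alt s t n ⟩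
      ≡⟨ ≡.cong₂ (λ p q → ⟨ alt t s (n * 2) ⟩ ∙ ⟨ alt p q n ⟩) (next-even s t n) (next-even t s n) ⟨
    ⟨ alt t s (n * 2) ⟩ ∙ ⟨ alt (next s t (n * 2)) (next t s (n * 2)) n ⟩
      ≡⟨ ≡.cong (λ k → ⟨ alt t s k ⟩ ∙ ⟨ alt (next s t k) (next t s k) n ⟩) (≡.trans (ℕ.*-comm n 2) (≡.cong (n +_) (ℕ.+-identityʳ n))) ⟩
    ⟨ alt t s (n + n) ⟩ ∙ ⟨ alt (next s t (n + n)) (next t s (n + n)) n ⟩   ≈⟨ alt-cancel t s n n ⟩
    ⟨ alt t s n ⟩                                        ∎
    where n = m s t

  alt-++-prefix : ∀ s t j k → ∃[ u ] alt s t (j + k) ≡ alt s t j ++ u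
  alt-++-prefix s t zero    k = alt s t k , refl
  alt-++-prefix s t (suc j) k with u , eq ← alt-++-prefix t s j k = u , ≡.cong (s ∷_) eq

  -- Already the prefix of length m + 1 fails: a braid move behind its first letter produces t t,
  -- leaving a word of length m - 1.
  alt-long-not-Red : ∀ s t → 0 < m s t → ∀ j → m s t ≤ j → ¬ Red (alt t s (suc j))
  alt-long-not-Red s t 0<m j m≤j red = go (m s t) refl 0<m
    where
    prefix-Red : Red (alt t s (suc (m s t)))
    prefix-Red with u , eq ← alt-++-prefix t s (suc (m s t)) (j ℕ.∸ m s t) = Red-++ˡ (alt t s (suc (m s t)))
      (≡.subst Red (≡.trans (≡.cong (alt t s) (≡.cong suc (≡.sym (ℕ.m+[n∸m]≡n m≤j)))) eq) red)
    go : ∀ n → m s t ≡ n → 0 < n → ⊥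
    go (suc n) m≡ _ = ℕ.<⇒≱ (ℕ.n≤1+n _) (≡.subst (λ k → suc k ≤ n) m≡ (≡.subst₂ _≤_
      (length-alt t s (suc (m s t))) (length-alt s t n) (shortest prefix-Red (alt s t n) (begin
        ⟨ alt s t n ⟩                            ≈⟨ gen-involutive t _ ⟨
        gen t ∙ ⟨ alt t s (suc n) ⟩              ≡⟨ ≡.cong (λ k → gen t ∙ ⟨ alt t s k ⟩) m≡ ⟨
        gen t ∙ ⟨ alt t s (m s t) ⟩              ≈⟨ ∙-congˡ (alt-braid s t) ⟨
        gen t ∙ ⟨ alt s t (m s t) ⟩              ∎))))

  -- Decidability of reducedness

  left-inverse : ∀ {p} {Q : S → Set p} {u} → All Q u → ∃[ v ] All Q v × ⟨ v ⟩ ∙ ⟨ u ⟩ ≈ ε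
  left-inverse [] = [] , [] , identityʳ ε
  left-inverse {u = s ∷ u} (q ∷ qs) with v , qs′ , eq ← left-inverse qs = v ++ s ∷ [] , All.++⁺ qs′ (q ∷ []) , (begin
    ⟨ v ++ s ∷ [] ⟩ ∙ (gen s ∙ ⟨ u ⟩)            ≈⟨ ∙-congʳ (⟨⟩-++ v (s ∷ [])) ⟩
    (⟨ v ⟩ ∙ (gen s ∙ ε)) ∙ (gen s ∙ ⟨ u ⟩)      ≈⟨ assoc _ _ _ ⟩
    ⟨ v ⟩ ∙ ((gen s ∙ ε) ∙ (gen s ∙ ⟨ u ⟩))      ≈⟨ ∙-congˡ (∙-congʳ (identityʳ _)) ⟩
    ⟨ v ⟩ ∙ (gen s ∙ (gen s ∙ ⟨ u ⟩))            ≈⟨ ∙-congˡ (gen-involutive s _) ⟩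
    ⟨ v ⟩ ∙ ⟨ u ⟩                                ≈⟨ eq ⟩
    ε                                            ∎)

  -- An element x without descents in Q is shortest in its coset of the
  -- subgroup generated by Q.
  coset-shortest : ∀ {p} (Q : S → Set p) {x} → Red x → (∀ {r} → Q r → Red (r ∷ x)) →
    ∀ n z x′ → length (z ++ x′) ≤ n → All Q z → ⟨ x ⟩ ≈ ⟨ z ++ x′ ⟩ → length x ≤ length x′
  coset-shortest Q {x} red no-descent zero [] x′ _ _ eq = shortest red x′ (G.sym eq)
  coset-shortest Q {x} red no-descent (suc n) z x′ le Qz eq with length (z ++ x′) ℕ.≤? length x
  coset-shortest Q {x} red no-descent (suc n) []      x′ le _ eq        | yes _ = shortest red x′ (G.sym eq)
  coset-shortest Q {x} red no-descent (suc n) (r ∷ z) x′ le (Qr ∷ _) eq | yes zx≤x = contradiction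
    (shortest (no-descent Qr) (z ++ x′) (gen-transpose (G.sym eq))) (ℕ.<⇒≱ (ℕ.m<n⇒m<1+n zx≤x))
  -- A word for x longer than x can be shortened by deletion. The letters lost come from z or from
  -- x′, so what remains has the same shape with an x″ no longer than x′.
  ... | no zx≰x with u , sub , lt , eq′ ← deletion (z ++ x′) x eq (ℕ.≰⇒> zx≰x)
    with z″ , x″ , refl , z″⊆z , x″⊆x′ ← ⊆-++⁻ z sub = ℕ.≤-trans
      (coset-shortest Q red no-descent n z″ x″ (ℕ.≤-pred (ℕ.≤-trans lt le)) (Sublist.All-resp-⊆ z″⊆z Qz) (G.trans eq (G.sym eq′)))
      (Sublist.length-mono-≤ x″⊆x′)

  record Descent (s : S) (u : List S) : Set (ℓ ⊔ a) where
    constructor mkDescent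
    field
      rest   : List S
      ≈∷rest : ⟨ u ⟩ ≈ ⟨ s ∷ rest ⟩
      len    : suc (length rest) ≡ length u

    ∷rest-Red : Red u → Red (s ∷ rest)
    ∷rest-Red red = Red-resp red ≈∷rest (ℕ.≤-reflexive len)

  alt-letters : ∀ s t k → All (λ r → r ≡ s ⊎ r ≡ t) (alt s t k)
  alt-letters s t zero    = []
  alt-letters s t (suc k) = inj₁ refl ∷ All.map [ inj₂ , inj₁ ]′ (alt-letters t s k)

  -- By deletion a shorter word would be z x′ with subwords z and x′ of the two factors. As x is
  -- shortest in its coset, x′ is x; cancelling x then contradicts the reducedness of the
  -- alternating word.
  Red-alt-++ : ∀ {s t} → s ≢ t → ∀ k → k ≤ m s t ⊎ m s t ≡ 0 →
    ∀ {x} → Red x → Red (s ∷ x) → Red (t ∷ x) → Red (alt s t k ++ x)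
  Red-alt-++ {s} {t} s≢t k k≤m {x} red red-s red-t = mkRed λ v v≈ → ℕ.≮⇒≥ λ v< →
    let u , sub , lt , eq = deletion (alt s t k ++ x) v v≈ v<
        z , x′ , u≡ , z⊆ , x′⊆x = ⊆-++⁻ (alt s t k) sub
    in not-shorter z x′ z⊆ x′⊆x (≡.subst (λ u → length u < _) u≡ lt) (≡.subst (λ u → ⟨ u ⟩ ≈ _) u≡ eq)
    where
    Q : S → Set a
    Q r = r ≡ s ⊎ r ≡ t
    no-descent : ∀ {r} → Q r → Red (r ∷ x)
    no-descent (inj₁ refl) = red-s
    no-descent (inj₂ refl) = red-t
    not-shorter : ∀ z x′ → z ⊆ alt s t k → x′ ⊆ x → length (z ++ x′) < length (alt s t k ++ x) →
      ¬ ⟨ z ++ x′ ⟩ ≈ ⟨ alt s t k ++ x ⟩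
    not-shorter z x′ z⊆ x′⊆x lt eq = ℕ.<⇒≱ z<alt alt≤z
      where
      x′≡x : x′ ≡ x
      x′≡x = let y , Qy , inv = left-inverse (alt-letters s t k) in ⊆-length-≡ x′⊆x
        (coset-shortest Q red no-descent _ (y ++ z) x′ ℕ.≤-refl (All.++⁺ Qy (Sublist.All-resp-⊆ z⊆ (alt-letters s t k))) (begin
          ⟨ x ⟩                                     ≈⟨ identityˡ _ ⟨
          ε ∙ ⟨ x ⟩                                 ≈⟨ ∙-congʳ inv ⟨
          (⟨ y ⟩ ∙ ⟨ alt s t k ⟩) ∙ ⟨ x ⟩           ≈⟨ assoc _ _ _ ⟩
          ⟨ y ⟩ ∙ (⟨ alt s t k ⟩ ∙ ⟨ x ⟩)           ≈⟨ ∙-congˡ (⟨⟩-++ (alt s t k) x) ⟨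
          ⟨ y ⟩ ∙ ⟨ alt s t k ++ x ⟩                ≈⟨ ∙-congˡ eq ⟨
          ⟨ y ⟩ ∙ ⟨ z ++ x′ ⟩                       ≈⟨ ⟨⟩-++ y (z ++ x′) ⟨
          ⟨ y ++ z ++ x′ ⟩                          ≡⟨ ≡.cong ⟨_⟩ (List.++-assoc y z x′) ⟨
          ⟨ (y ++ z) ++ x′ ⟩                        ∎))
      z<alt : length z < length (alt s t k)
      z<alt = ℕ.+-cancelʳ-< (length x) _ _ (≡.subst₂ _<_
        (≡.trans (List.length-++ z) (≡.cong (λ x → length z + length x) x′≡x)) (List.length-++ (alt s t k)) lt)
      alt≤z : length (alt s t k) ≤ length z
      alt≤z = shortest (alt-Red s≢t k k≤m) z (∙-cancelʳ ⟨ x ⟩ _ _ (begin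
        ⟨ z ⟩ ∙ ⟨ x ⟩               ≡⟨ ≡.cong (λ x → ⟨ z ⟩ ∙ ⟨ x ⟩) x′≡x ⟨
        ⟨ z ⟩ ∙ ⟨ x′ ⟩              ≈⟨ ⟨⟩-++ z x′ ⟨
        ⟨ z ++ x′ ⟩                 ≈⟨ eq ⟩
        ⟨ alt s t k ++ x ⟩          ≈⟨ ⟨⟩-++ (alt s t k) x ⟩
        ⟨ alt s t k ⟩ ∙ ⟨ x ⟩       ∎))

  -- x = alt r r′ j · y with y shortest in its coset of the subgroup ⟨r , r′⟩
  record Stripped (r r′ : S) (x : List S) : Set (ℓ ⊔ a) where
    field
      {j}     : ℕ
      {y}     : List S
      factor  : ⟨ x ⟩ ≈ ⟨ alt r r′ j ++ y ⟩
      len     : j + length y ≡ length x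
      red-y   : Red y
      red-r   : Red (r ∷ y)
      red-r′  : Red (r′ ∷ y)

  mutual
    -- For a word t u with t ≠ s, write u as `alt s t j` followed by y. If j + 2 ≤ m or m = ∞, then
    -- s t u is reduced by `Red-alt-++`. If j + 1 = m, a braid move brings s to the front. If j + 1
    -- > m, then t u was not reduced.
    descent? : ∀ n s u → length u ≤ n → Red u → Descent s u ⊎ Red (s ∷ u)
    descent? n s [] _ red = inj₂ (Red-∷ red λ ())
    descent? (suc n) s (t ∷ u) (s≤s u≤n) red with s ≟ t
    ... | yes refl = inj₁ (mkDescent u G.refl refl)
    ... | no s≢t = decide (strip n (length u) s t u ℕ.≤-refl u≤n (Red-++ʳ (t ∷ []) red) red)
      where
      decide : Stripped s t u → Descent s (t ∷ u) ⊎ Red (s ∷ t ∷ u)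
      decide st = by-cases (m s t) refl
        where
        open Stripped st
        len′ : length (alt s t j ++ y) ≡ length u
        len′ = ≡.trans (List.length-++ (alt s t j)) (≡.trans (≡.cong (_+ length y) (length-alt s t j)) len)
        not-descent : 2 + j ≤ m s t ⊎ m s t ≡ 0 → Red (s ∷ t ∷ u)
        not-descent j≤m = Red-resp (Red-alt-++ s≢t (2 + j) j≤m red-y red-r red-r′)
          (∙-congˡ (∙-congˡ (G.sym factor))) (ℕ.≤-reflexive (≡.cong (2 +_) (≡.sym len′)))
        by-cases : ∀ n → m s t ≡ n → Descent s (t ∷ u) ⊎ Red (s ∷ t ∷ u)
        by-cases zero    m≡ = inj₂ (not-descent (inj₂ m≡))
        by-cases (suc n) m≡ with ℕ.<-cmp j n
        ... | tri< j<n _ _ = inj₂ (not-descent (inj₁ (≡.subst (2 + j ≤_) (≡.sym m≡) (s≤s j<n))))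
        ... | tri> _ _ n<j = contradiction
          (Red-++ˡ (alt t s (suc j)) (Red-resp red (∙-congˡ factor) (ℕ.≤-reflexive (≡.cong suc len′))))
          (alt-long-not-Red s t (≡.subst (0 <_) (≡.sym m≡) (s≤s z≤n)) j (≡.subst (_≤ j) (≡.sym m≡) n<j))
        ... | tri≈ _ refl _ = inj₁ (mkDescent (alt t s j ++ y) (begin
            gen t ∙ ⟨ u ⟩                          ≈⟨ ∙-congˡ factor ⟩
            ⟨ alt t s (suc j) ++ y ⟩               ≈⟨ ⟨⟩-++ʳ {alt t s (suc j)} {alt s t (suc j)} y
                (≡.subst (λ k → ⟨ alt t s k ⟩ ≈ ⟨ alt s t k ⟩) m≡ (G.sym (alt-braid s t))) ⟩
            ⟨ alt s t (suc j) ++ y ⟩               ∎)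
          (≡.cong suc (≡.trans (List.length-++ (alt t s j)) (≡.trans (≡.cong (_+ length y) (length-alt t s j)) len))))

    -- The letter r′ is known not to be a descent, having just been taken off, so only r is tested
    -- before the roles are exchanged. k bounds the letters still to be taken off, n the words
    -- handed to `descent?`.
    strip : ∀ n k r r′ x → length x ≤ k → length x ≤ n → Red x → Red (r′ ∷ x) → Stripped r r′ x
    strip n k r r′ x x≤k x≤n red red′ with descent? n r x x≤n red
    ... | inj₂ red-r = record { j = 0 ; y = x ; factor = G.refl ; len = refl ; red-y = red ; red-r = red-r ; red-r′ = red′ }
    strip n zero r r′ [] x≤k x≤n red red′ | inj₁ (mkDescent _ _ ())
    strip n (suc k) r r′ x x≤k x≤n red red′ | inj₁ desc@(mkDescent v x≈rv len) =
      record
      { j = suc St.j ; y = St.y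
      ; factor = G.trans x≈rv (∙-congˡ St.factor)
      ; len = ≡.trans (≡.cong suc St.len) len
      ; red-y = St.red-y ; red-r = St.red-r′ ; red-r′ = St.red-r
      }
      where
      v<x : length v < length x
      v<x = ℕ.≤-reflexive len
      module St = Stripped (strip n k r′ r v (ℕ.≤-pred (ℕ.<-≤-trans v<x x≤k)) (ℕ.≤-trans (ℕ.<⇒≤ v<x) x≤n)
        (Red-++ʳ (r ∷ []) (Descent.∷rest-Red desc red)) (Descent.∷rest-Red desc red))

  descent⊎Red : ∀ s {u} → Red u → Descent s u ⊎ Red (s ∷ u)
  descent⊎Red s {u} = descent? (length u) s u ℕ.≤-refl

  Descent⇒¬Red : ∀ {s u} → Descent s u → ¬ Red (s ∷ u)
  Descent⇒¬Red {s} {u} (mkDescent v u≈sv len) red = ℕ.<⇒≱ (s≤s (ℕ.≤-trans (ℕ.n≤1+n _) (ℕ.≤-reflexive len)))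
    (shortest red v (G.trans (G.sym (gen-involutive s ⟨ v ⟩)) (∙-congˡ (G.sym u≈sv))))

  red? : ∀ u → Dec (Red u)
  red? [] = yes Red-[]
  red? (s ∷ u) with red? u
  ... | no ¬red = no (¬red ∘ Red-++ʳ (s ∷ []))
  ... | yes red = [ no ∘ Descent⇒¬Red , yes ]′ (descent⊎Red s red)

  -- Suppose s w is reduced and s w = w q, where w = u x v.  Then the
  -- inversions of w are stable under conjugation by s, hence s u v q, which
  -- is s t s w for the inversion t = u x u⁻¹ of w, is not reduced.
  not-conjugate : ∀ {s u x v q} → Red (s ∷ u ++ x ∷ v) → Red (s ∷ (u ++ v) ++ q ∷ []) →
    ¬ (gen s ∙ ⟨ u ++ x ∷ v ⟩ ≈ ⟨ u ++ x ∷ v ⟩ ∙ gen q)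
  not-conjugate {s} {u} {x} {v} {q} red-sw red-suvq sw≈wq = ℕ.<⇒≱ w′<suvq (shortest red-suvq w′ w′≈suvq)
    where
    w = u ++ x ∷ v
    t = conj* u (gen x)
    t∈ : t ∈ᵍ N w
    t∈ = conj*∈N u x v
    tw≈uv : t ∙ ⟨ w ⟩ ≈ ⟨ u ++ v ⟩
    tw≈uv = begin
      t ∙ ⟨ w ⟩                           ≈⟨ ∙-congˡ (⟨⟩-++ u (x ∷ v)) ⟩
      t ∙ (⟨ u ⟩ ∙ (gen x ∙ ⟨ v ⟩))       ≈⟨ assoc _ _ _ ⟨
      (t ∙ ⟨ u ⟩) ∙ (gen x ∙ ⟨ v ⟩)       ≈⟨ ∙-congʳ (conj*-∙ u (gen x)) ⟩
      (⟨ u ⟩ ∙ gen x) ∙ (gen x ∙ ⟨ v ⟩)   ≈⟨ assoc _ _ _ ⟩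
      ⟨ u ⟩ ∙ (gen x ∙ (gen x ∙ ⟨ v ⟩))   ≈⟨ ∙-congˡ (gen-involutive x _) ⟩
      ⟨ u ⟩ ∙ ⟨ v ⟩                       ≈⟨ ⟨⟩-++ u v ⟨
      ⟨ u ++ v ⟩                          ∎
    sts : Element
    sts = conj s t
    sts∈sw : sts ∈ᵍ N (s ∷ w)
    sts∈sw = there (Any.map⁺ (Any.map (conj-cong s) t∈))
    sw≈wq′ : ⟨ s ∷ w ⟩ ≈ ⟨ w ++ q ∷ [] ⟩
    sw≈wq′ = G.trans sw≈wq (G.trans (∙-congˡ (G.sym (identityʳ _))) (G.sym (⟨⟩-++ w (q ∷ []))))
    sts∈w : sts ∈ᵍ N w
    sts∈w = cases (∈N-++⁻ w (q ∷ []) (∈N-≈ (s ∷ w) (w ++ q ∷ []) sw≈wq′ red-sw sts∈sw))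
      where
      cases : sts ∈ᵍ N w ⊎ (∃[ y ] y ∈ᵍ N (q ∷ []) × sts ∙ ⟨ w ⟩ ≈ ⟨ w ⟩ ∙ y) → sts ∈ᵍ N w
      cases (inj₁ ∈w) = ∈w
      -- The new reflection of w q is w q w⁻¹ = s. If s t s were this one, then t = s would be a
      -- reflection of w, although s w is reduced.
      cases (inj₂ (y , here y≈q , eq)) = contradiction (Any.map (G.trans s≈t) t∈) (Red-∷⇒∉N red-sw)
        where
        sts≈s : sts ≈ gen s
        sts≈s = ∙-cancelʳ ⟨ w ⟩ _ _ (G.trans eq (G.trans (∙-congˡ y≈q) (G.sym sw≈wq)))
        s≈t : gen s ≈ t
        s≈t = G.trans (G.sym (conj-gen s)) (conj-transpose s (G.sym sts≈s))
    deleted = delete-reflection w sts∈w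
    w′ = proj₁ deleted
    len-w′ : suc (length w′) ≡ length w
    len-w′ = proj₁ (proj₂ (proj₂ deleted))
    len-suvq : length (s ∷ (u ++ v) ++ q ∷ []) ≡ suc (length w)
    len-suvq = ≡.cong suc (≡.trans (List.length-++ (u ++ v)) (≡.trans (ℕ.+-comm _ 1) (≡.trans
      (≡.cong suc (List.length-++ u)) (≡.trans (≡.sym (ℕ.+-suc (length u) (length v))) (≡.sym (List.length-++ u))))))
    w′<suvq : length w′ < length (s ∷ (u ++ v) ++ q ∷ [])
    w′<suvq = ≡.subst (length w′ <_) (≡.sym len-suvq) (s≤s (ℕ.≤-trans (ℕ.n≤1+n _) (ℕ.≤-reflexive len-w′)))
    w′≈suvq : ⟨ w′ ⟩ ≈ ⟨ s ∷ (u ++ v) ++ q ∷ [] ⟩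
    w′≈suvq = begin
      ⟨ w′ ⟩                                     ≈⟨ proj₂ (proj₂ (proj₂ deleted)) ⟩
      sts ∙ ⟨ w ⟩                                ≈⟨ ∙-congˡ (gen-involutive s _) ⟨
      sts ∙ (gen s ∙ (gen s ∙ ⟨ w ⟩))            ≈⟨ conj-∙ s t _ ⟩
      gen s ∙ (t ∙ (gen s ∙ ⟨ w ⟩))              ≈⟨ ∙-congˡ (∙-congˡ sw≈wq) ⟩
      gen s ∙ (t ∙ (⟨ w ⟩ ∙ gen q))              ≈⟨ ∙-congˡ (assoc _ _ _) ⟨
      gen s ∙ ((t ∙ ⟨ w ⟩) ∙ gen q)              ≈⟨ ∙-congˡ (∙-congʳ tw≈uv) ⟩
      gen s ∙ (⟨ u ++ v ⟩ ∙ gen q)               ≈⟨ ∙-congˡ (∙-congˡ (identityʳ _)) ⟨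
      gen s ∙ (⟨ u ++ v ⟩ ∙ ⟨ q ∷ [] ⟩)          ≈⟨ ∙-congˡ (⟨⟩-++ (u ++ v) (q ∷ [])) ⟨
      ⟨ s ∷ (u ++ v) ++ q ∷ [] ⟩                 ∎

  -- Appending q adds only the reflection u q u⁻¹, so s can become a descent only by being equal to
  -- it.
  Red-∷ʳ : ∀ {s u q} → Red (s ∷ u) → Red (u ++ q ∷ []) → ¬ gen s ∙ ⟨ u ⟩ ≈ ⟨ u ⟩ ∙ gen q → Red (s ∷ u ++ q ∷ [])
  Red-∷ʳ {s} {u} {q} red-su red-uq su≉uq = Red-∷ red-uq
    ([ Red-∷⇒∉N red-su , (λ { (y , here y≈q , eq) → su≉uq (G.trans eq (∙-congˡ y≈q)) }) ]′ ∘ ∈N-++⁻ u (q ∷ []))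

  -- v is built up from the right, one letter q at a time. The only obstruction is s w = w q for w =
  -- u x v, and `not-conjugate` excludes it.
  Red-insert : ∀ s u x v → Red (s ∷ u ++ x ∷ []) → Red (s ∷ u ++ v) → Red (u ++ x ∷ v) → Red (s ∷ u ++ x ∷ v)
  Red-insert s u x v red-sux = go (reverseView v)
    where
    go : ∀ {v} → Reverse v → Red (s ∷ u ++ v) → Red (u ++ x ∷ v) → Red (s ∷ u ++ x ∷ v)
    go [] _ _ = red-sux
    go (v ∶ r ∶ʳ q) red-suvq red-uxvq = ≡.subst (Red ∘ (s ∷_)) (List.++-assoc u (x ∷ v) (q ∷ []))
      (Red-∷ʳ red-suxv red-uxvq′ (not-conjugate {u = u} red-suxv red-suvq′))
      where
      red-suvq′ : Red (s ∷ (u ++ v) ++ q ∷ [])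
      red-suvq′ = ≡.subst (Red ∘ (s ∷_)) (≡.sym (List.++-assoc u v (q ∷ []))) red-suvq
      red-uxvq′ : Red ((u ++ x ∷ v) ++ q ∷ [])
      red-uxvq′ = ≡.subst Red (≡.sym (List.++-assoc u (x ∷ v) (q ∷ []))) red-uxvq
      red-suxv : Red (s ∷ u ++ x ∷ v)
      red-suxv = go r (Red-++ˡ (s ∷ u ++ v) red-suvq′) (Red-++ˡ (u ++ x ∷ v) red-uxvq′)

-- Greedy description of sorted index sets

module Sorting {c ℓ a} (X : CoxeterSystem c ℓ a) (ω : ℕ → CoxeterSystem.S X) where
  open CoxeterSystem X
  private module G = Group W
  open Coxeter X
  open SortingOrder X ω
  open GroupProperties W using (∙-cancelˡ)
  open import Relation.Binary.Reasoning.Setoid setoid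

  wordOf : List ℕ → List S
  wordOf = map ω

  -- For k ∈ xs this only says that a suffix of the word is reduced; for k ∉ xs
  -- it says that ω k is not a descent of what remains, so that skipping
  -- position k was forced.
  Greedy : ℕ → List ℕ → Set (ℓ ⊔ a)
  Greedy p xs = ∀ k → p ≤ k → Red (ω k ∷ wordOf (above k xs))

  Red-letter : ∀ s → Red (s ∷ [])
  Red-letter s = Red-∷ Red-[] λ ()

  Greedy⇒Red : ∀ {p xs} → Increasing xs → All (p ≤_) xs → Greedy p xs → Red (wordOf xs)
  Greedy⇒Red {xs = []}     _   _         _  = Red-[]
  Greedy⇒Red {xs = x ∷ xs} inc (p≤x ∷ _) gr = ≡.subst (λ ys → Red (ω x ∷ wordOf ys))
    (≡.trans (above-∷ xs ℕ.≤-refl) (above-all (increasing-head inc))) (gr x p≤x)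

  Greedy-tail : ∀ {p x xs} → p ≤ x → Greedy p (x ∷ xs) → Greedy (suc x) xs
  Greedy-tail {p} {x} {xs} p≤x gr k x<k = ≡.subst (λ ys → Red (ω k ∷ wordOf ys)) (above-∷ xs (ℕ.<⇒≤ x<k))
    (gr k (ℕ.≤-trans p≤x (ℕ.<⇒≤ x<k)))

  Greedy-∷ : ∀ {p xs} → All (p <_) xs → Greedy (suc p) xs → Red (ω p ∷ wordOf xs) →
    Greedy p xs × Greedy p (p ∷ xs)
  Greedy-∷ {p} {xs} p<xs gr red = without , with-p
    where
    without : Greedy p xs
    without k p≤k with ℕ.m≤n⇒m<n∨m≡n p≤k
    ... | inj₁ p<k  = gr k p<k
    ... | inj₂ refl = ≡.subst (λ ys → Red (ω k ∷ wordOf ys)) (≡.sym (above-all p<xs)) red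
    with-p : Greedy p (p ∷ xs)
    with-p k p≤k = ≡.subst (λ ys → Red (ω k ∷ wordOf ys)) (≡.sym (above-∷ xs p≤k)) (without k p≤k)

  -- A descent realised on positions: s times the word of xs is spelled by positions of xs, from
  -- which competing index sets can be built.
  record Deleted (s : S) (xs : List ℕ) : Set ℓ where
    field
      rest     : List ℕ
      rest⊆    : rest ⊆ xs
      len      : suc (length rest) ≡ length xs
      rest≈    : ⟨ wordOf rest ⟩ ≈ ⟨ s ∷ wordOf xs ⟩

  deleted : ∀ {s xs} → Red (wordOf xs) → Descent s (wordOf xs) → Deleted s xs
  deleted {s} {xs} red (mkDescent v eq len) =
    let u , u⊆ , len-u , u≈ = delete-reflection (wordOf xs) (exchange red v
          (G.trans (G.sym (gen-involutive s ⟨ v ⟩)) (G.∙-congˡ (G.sym eq)))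
          (ℕ.≤-trans (ℕ.n≤1+n _) (ℕ.≤-reflexive len)))
        zs , zs⊆ , u≡ = ⊆-map⁻ ω xs u⊆
    in record
      { rest = zs ; rest⊆ = zs⊆
      ; len = ≡.trans (≡.cong suc (≡.trans (≡.sym (List.length-map ω zs)) (≡.cong length (≡.sym u≡))))
                (≡.trans len-u (List.length-map ω xs))
      ; rest≈ = G.trans (G.reflexive (≡.cong ⟨_⟩ (≡.sym u≡))) u≈
      }

  SymDiff : List ℕ → List ℕ → Pred ℕ 0ℓ
  SymDiff xs ys i = (i ∈ xs ⊎ i ∈ ys) × ¬ (i ∈ xs × i ∈ ys)

  -- At the first difference ys cannot come earlier: its first letter ω y is a descent of the common
  -- element, whereas greediness of xs at the skipped position y says that it is not.
  Greedy⇒lex-least : ∀ {p xs ys} → Increasing xs → Increasing ys → All (p ≤_) xs → All (p ≤_) ys →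
    Greedy p xs → Red (wordOf ys) → ⟨ wordOf ys ⟩ ≈ ⟨ wordOf xs ⟩ →
    xs ≡ ys ⊎ ∃[ i ] IsLeast (SymDiff xs ys) i × i ∈ xs
  Greedy⇒lex-least {xs = []} {[]} _ _ _ _ _ _ _ = inj₁ refl
  Greedy⇒lex-least {xs = []} {y ∷ ys} _ _ _ _ _ red eq with () ← shortest red [] (G.sym eq)
  Greedy⇒lex-least {xs = x ∷ xs} {[]} inc-x _ p≤x _ gr _ eq with () ← shortest (Greedy⇒Red inc-x p≤x gr) [] eq
  Greedy⇒lex-least {p} {x ∷ xs} {y ∷ ys} inc-x inc-y (p≤x ∷ p≤xs) (p≤y ∷ p≤ys) gr red eq with ℕ.<-cmp x y
  ... | tri< x<y _ _ = inj₂ (x , ((inj₁ (here refl) , x∉) , least) , here refl)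
    where
    x∉ : ¬ (x ∈ x ∷ xs × x ∈ y ∷ ys)
    x∉ (_ , x∈) = ℕ.<⇒≱ x<y (∈⇒≥head inc-y x∈)
    least : ∀ j → SymDiff (x ∷ xs) (y ∷ ys) j → x ≤ j
    least j (inj₁ j∈ , _) = ∈⇒≥head inc-x j∈
    least j (inj₂ j∈ , _) = ℕ.≤-trans (ℕ.<⇒≤ x<y) (∈⇒≥head inc-y j∈)
  ... | tri> _ _ y<x = contradiction
    (shortest (≡.subst (λ zs → Red (ω y ∷ wordOf zs)) (above-all (y<x ∷ All.map (ℕ.<-trans y<x) (increasing-head inc-x))) (gr y p≤y))
      (wordOf ys) (gen-transpose eq))
    (ℕ.<⇒≱ (ℕ.m<n⇒m<1+n (shortest red (wordOf (x ∷ xs)) (G.sym eq))))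
  ... | tri≈ _ refl _ with Greedy⇒lex-least (Linked.tail inc-x) (Linked.tail inc-y) (increasing-head inc-x) (increasing-head inc-y)
        (Greedy-tail p≤x gr) (Red-++ʳ (ω x ∷ []) red) (∙-cancelˡ (gen (ω x)) _ _ eq)
  ...   | inj₁ xs≡ys = inj₁ (≡.cong (x ∷_) xs≡ys)
  ...   | inj₂ (i , ((i∈ , i∉) , least) , i∈xs) = inj₂ (i , ((inj₁ (there i∈xs) , i∉′) , least′) , there i∈xs)
    where
    uncons : ∀ {j zs} → x < j → j ∈ x ∷ zs → j ∈ zs
    uncons x<j (here refl) = contradiction x<j (ℕ.<-irrefl refl)
    uncons x<j (there j∈)  = j∈
    i∉′ : ¬ (i ∈ x ∷ xs × i ∈ x ∷ ys)
    i∉′ (_ , i∈y) = i∉ (i∈xs , uncons (∈-tail⇒>head inc-x i∈xs) i∈y)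
    least′ : ∀ j → SymDiff (x ∷ xs) (x ∷ ys) j → i ≤ j
    least′ j (inj₁ (here refl) , j∉) = contradiction (here refl , here refl) j∉
    least′ j (inj₂ (here refl) , j∉) = contradiction (here refl , here refl) j∉
    least′ j (inj₁ (there j∈) , j∉) = least j (inj₁ j∈ , λ (p , q) → j∉ (there p , there q))
    least′ j (inj₂ (there j∈) , j∉) = least j (inj₂ j∈ , λ (p , q) → j∉ (there p , there q))

  Greedy⇒Sorted : ∀ A → Greedy 0 (indices A) → Sorted A
  Greedy⇒Sorted A gr = Red⇒Reduced (Greedy⇒Red (increasing A) (All.tabulate (λ _ → z≤n)) gr) ,
    λ B red eq → Greedy⇒lex-least (increasing A) (increasing B) (All.tabulate (λ _ → z≤n)) (All.tabulate (λ _ → z≤n))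
      gr (Reduced⇒Red red) eq

  Sorted⇒Greedy : ∀ A → Sorted A → Greedy 0 (indices A)
  Sorted⇒Greedy A (reduced , lex-least) k _ = cases (k ∈? xs)
    where
    xs = indices A
    red : Red (wordOf xs)
    red = Reduced⇒Red reduced
    cases : Dec (k ∈ xs) → Red (ω k ∷ wordOf (above k xs))
    cases (yes k∈) = Red-++ʳ (wordOf (below k xs)) (≡.subst Red
      (≡.trans (≡.cong wordOf (split-∈ (increasing A) k∈)) (List.map-++ ω (below k xs) _)) red)
    cases (no k∉) = [ (λ desc → ⊥-elim (impossible (deleted red-above desc))) , id ]′ (descent⊎Red (ω k) red-above)
      where
      xs≡ : wordOf xs ≡ wordOf (below k xs) ++ wordOf (above k xs)
      xs≡ = ≡.trans (≡.cong wordOf (split-∉ (increasing A) k∉)) (List.map-++ ω (below k xs) _)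
      red-above : Red (wordOf (above k xs))
      red-above = Red-++ʳ (wordOf (below k xs)) (≡.subst Red xs≡ red)
      -- Otherwise below k xs ∪ {k} ∪ rest would be smaller than A.
      impossible : ¬ Deleted (ω k) (above k xs)
      impossible del = not-least (lex-least B (Red⇒Reduced {wordOf (indices B)} (Red-resp red (G.sym B≈A) B≤A)) B≈A)
        where
        open Deleted del
        B : IndexSet
        B = indexSet (below k xs ++ k ∷ rest) (increasing-++∷ (below-increasing k (increasing A))
          (All.tabulate (proj₂ ∘ ∈-below⁻ xs)) (increasing-⊆ rest⊆ (above-increasing k (increasing A)))
          (Sublist.All-resp-⊆ rest⊆ (All.tabulate (proj₂ ∘ ∈-above⁻ xs))))
        wordB : wordOf (indices B) ≡ wordOf (below k xs) ++ ω k ∷ wordOf rest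
        wordB = List.map-++ ω (below k xs) _
        B≈A : ⟨ wordOf (indices B) ⟩ ≈ ⟨ wordOf xs ⟩
        B≈A = begin
          ⟨ wordOf (indices B) ⟩                                ≡⟨ ≡.cong ⟨_⟩ wordB ⟩
          ⟨ wordOf (below k xs) ++ ω k ∷ wordOf rest ⟩          ≈⟨ ⟨⟩-++ˡ (wordOf (below k xs)) {ω k ∷ wordOf rest} {wordOf (above k xs)}
              (G.trans (G.∙-congˡ rest≈) (gen-involutive (ω k) _)) ⟩
          ⟨ wordOf (below k xs) ++ wordOf (above k xs) ⟩        ≡⟨ ≡.cong ⟨_⟩ xs≡ ⟨
          ⟨ wordOf xs ⟩                                         ∎
        B≤A : length (wordOf (indices B)) ≤ length (wordOf xs)
        B≤A = ℕ.≤-reflexive (≡.trans (≡.cong length wordB) (≡.trans (List.length-++ (wordOf (below k xs)))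
          (≡.trans (≡.cong (length (wordOf (below k xs)) +_) (≡.trans (≡.cong suc (List.length-map ω rest))
            (≡.trans len (≡.sym (List.length-map ω (above k xs))))))
          (≡.trans (≡.sym (List.length-++ (wordOf (below k xs)))) (≡.cong length (≡.sym xs≡))))))
        k∈B : k ∈ indices B
        k∈B = ∈-++⁺ʳ (below k xs) (here refl)
        not-least : ¬ A ≤lex B
        not-least (inj₁ xs≡B) = k∉ (≡.subst (k ∈_) (≡.sym xs≡B) k∈B)
        not-least (inj₂ (i , ((_ , i∉) , least) , i∈A)) with ℕ.m≤n⇒m<n∨m≡n (least k (inj₂ k∈B , k∉ ∘ proj₁))
        ... | inj₁ i<k  = i∉ (i∈A , ∈-++⁺ˡ (∈-below⁺ i∈A i<k))
        ... | inj₂ refl = k∉ i∈A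

  Sorted-resp : ∀ {A B} → indices A ≡ indices B → Sorted A → Sorted B
  Sorted-resp {A} {B} A≡B sorted = Greedy⇒Sorted B (≡.subst (Greedy 0) A≡B (Sorted⇒Greedy A sorted))

  Sorted-empty : ∀ A → (∀ {i} → i ∉ⁱ A) → Sorted A
  Sorted-empty (indexSet []       inc) _     = Greedy⇒Sorted (indexSet [] inc) λ k _ → Red-letter (ω k)
  Sorted-empty (indexSet (x ∷ xs) inc) empty = contradiction (here refl) empty

  -- Lexicographic minimality ranges over all index sets, the greedy condition only over positions;
  -- from `bound A` on it concerns a single letter and holds.
  sorted? : Decidable Sorted
  sorted? A = map′
    (λ all → Greedy⇒Sorted A λ k _ → extend all k (k ℕ.<? bound A))
    (λ sorted → All.tabulate λ {k} _ → Sorted⇒Greedy A sorted k z≤n)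
    (All.all? (λ k → red? (ω k ∷ wordOf (above k (indices A)))) (upTo (bound A)))
    where
    extend : All (λ k → Red (ω k ∷ wordOf (above k (indices A)))) (upTo (bound A)) →
      ∀ k → Dec (k < bound A) → Red (ω k ∷ wordOf (above k (indices A)))
    extend all k (yes k<) = All.lookup all (∈-upTo⁺ k<)
    extend all k (no k≮) = ≡.subst (λ ys → Red (ω k ∷ wordOf ys))
      (≡.sym (List.filter-none (k ℕ.<?_) (All.tabulate λ i∈ k<i → k≮ (ℕ.<-trans k<i (∈⇒<bound A i∈)))))
      (Red-letter (ω k))

  -- The exchange axiom for sorted index sets

  mid : ℕ → ℕ → IndexSet → List ℕ
  mid k x A = below x (above k (indices A))

  mid-increasing : ∀ k x A → Increasing (mid k x A)
  mid-increasing k x A = below-increasing x (above-increasing k (increasing A))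

  ∈-mid⁺ : ∀ {k x i} A → i ∈ⁱ A → k < i → i < x → i ∈ mid k x A
  ∈-mid⁺ A i∈ k<i i<x = ∈-below⁺ (∈-above⁺ i∈ k<i) i<x

  ∈-mid⁻ : ∀ {k x i} A → i ∈ mid k x A → i ∈ⁱ A × k < i × i < x
  ∈-mid⁻ {k} A i∈ = let i∈′ , i<x = ∈-below⁻ (above k (indices A)) i∈
                        i∈A , k<i = ∈-above⁻ (indices A) i∈′
                    in i∈A , k<i , i<x

  mid-cong : ∀ {k x A B} → (∀ {i} → i < x → i ∈ⁱ A → i ∈ⁱ B) → (∀ {i} → i < x → i ∈ⁱ B → i ∈ⁱ A) →
    mid k x A ≡ mid k x B
  mid-cong {k} {x} {A} {B} to from = ⊆-antisym-increasing (mid-increasing k x A) (mid-increasing k x B)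
    (λ i∈ → let i∈A , k<i , i<x = ∈-mid⁻ A i∈ in ∈-mid⁺ B (to i<x i∈A) k<i i<x)
    (λ i∈ → let i∈B , k<i , i<x = ∈-mid⁻ B i∈ in ∈-mid⁺ A (from i<x i∈B) k<i i<x)

  above-cong : ∀ {k A B} → (∀ {i} → k < i → i ∈ⁱ A → i ∈ⁱ B) → (∀ {i} → k < i → i ∈ⁱ B → i ∈ⁱ A) →
    above k (indices A) ≡ above k (indices B)
  above-cong {k} {A} {B} to from = ⊆-antisym-increasing (above-increasing k (increasing A)) (above-increasing k (increasing B))
    (λ i∈ → let i∈A , k<i = ∈-above⁻ (indices A) i∈ in ∈-above⁺ (to k<i i∈A) k<i)
    (λ i∈ → let i∈B , k<i = ∈-above⁻ (indices B) i∈ in ∈-above⁺ (from k<i i∈B) k<i)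

  above-above : ∀ {k x} A → k < x → above x (above k (indices A)) ≡ above x (indices A)
  above-above {k} {x} A k<x = ⊆-antisym-increasing
    (above-increasing x (above-increasing k (increasing A))) (above-increasing x (increasing A))
    (λ i∈ → let i∈′ , x<i = ∈-above⁻ (above k (indices A)) i∈ in ∈-above⁺ (proj₁ (∈-above⁻ (indices A) i∈′)) x<i)
    (λ i∈ → let i∈A , x<i = ∈-above⁻ (indices A) i∈ in ∈-above⁺ (∈-above⁺ i∈A (ℕ.<-trans k<x x<i)) x<i)

  above-∉ : ∀ {k x} A → k < x → x ∉ⁱ A →
    wordOf (above k (indices A)) ≡ wordOf (mid k x A) ++ wordOf (above x (indices A))
  above-∉ {k} {x} A k<x x∉ = ≡.trans
    (≡.cong wordOf (≡.trans (split-∉ (above-increasing k (increasing A)) (x∉ ∘ proj₁ ∘ ∈-above⁻ (indices A)))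
      (≡.cong (mid k x A ++_) (above-above A k<x))))
    (List.map-++ ω (mid k x A) _)

  above-∈ : ∀ {k x} A → k < x → x ∈ⁱ A →
    wordOf (above k (indices A)) ≡ wordOf (mid k x A) ++ ω x ∷ wordOf (above x (indices A))
  above-∈ {k} {x} A k<x x∈ = ≡.trans
    (≡.cong wordOf (≡.trans (split-∈ (above-increasing k (increasing A)) (∈-above⁺ x∈ k<x))
      (≡.cong (λ ys → mid k x A ++ x ∷ ys) (above-above A k<x))))
    (List.map-++ ω (mid k x A) _)

  Greedyˢ : Pred IndexSet (ℓ ⊔ a)
  Greedyˢ A = Greedy 0 (indices A)

  Greedyˢ-resp : ∀ {A B} → indices A ≡ indices B → Greedyˢ A → Greedyˢ B
  Greedyˢ-resp = ≡.subst (Greedy 0)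

  initialSegment : ℕ → IndexSet → IndexSet
  initialSegment x A = indexSet (below x (indices A)) (below-increasing x (increasing A))

  -- Cutting A at x replaces each of the reduced words by a prefix of it.
  Greedy-initial : ∀ x A → Greedyˢ A → Greedyˢ (initialSegment x A)
  Greedy-initial x A gr k _ = ≡.subst (λ ys → Red (ω k ∷ wordOf ys)) swap
    (prefix (x ∈? above k (indices A)))
    where
    swap : below x (above k (indices A)) ≡ above k (below x (indices A))
    swap = ⊆-antisym-increasing (mid-increasing k x A) (above-increasing k (below-increasing x (increasing A)))
      (λ i∈ → let i∈A , k<i , i<x = ∈-mid⁻ A i∈ in ∈-above⁺ (∈-below⁺ i∈A i<x) k<i)
      (λ i∈ → let i∈′ , k<i = ∈-above⁻ (below x (indices A)) i∈
                  i∈A , i<x = ∈-below⁻ (indices A) i∈′ in ∈-mid⁺ A i∈A k<i i<x)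
    inc = above-increasing k (increasing A)
    prefix : Dec (x ∈ above k (indices A)) → Red (ω k ∷ wordOf (mid k x A))
    prefix (yes x∈) = Red-++ˡ (ω k ∷ wordOf (mid k x A)) (≡.subst (Red ∘ (ω k ∷_))
      (≡.trans (≡.cong wordOf (split-∈ inc x∈)) (List.map-++ ω (mid k x A) _)) (gr k z≤n))
    prefix (no x∉) = Red-++ˡ (ω k ∷ wordOf (mid k x A)) (≡.subst (Red ∘ (ω k ∷_))
      (≡.trans (≡.cong wordOf (split-∉ inc x∉)) (List.map-++ ω (mid k x A) _)) (gr k z≤n))

  -- By induction on x, first A ∩ [0 , x) ∪ {x} is greedy, being reached from
  -- B ∩ [0 , x] by adding elements of A smaller than x; then Red-insert
  -- allows us to put the elements of A beyond x back.
  Greedy-exchange : ∀ n x → x < n → ∀ {A B} → Greedyˢ A → Greedyˢ B → x ∈ⁱ B → x ∉ⁱ A →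
    (∀ {y} → y ∈ⁱ B → y < x → y ∈ⁱ A) → Greedyˢ (insert A x)
  Greedy-exchange (suc n) x (s≤s x≤n) {A} {B} grA grB x∈B x∉A B⊆A k _ = cases (k ℕ.<? x)
    where
    B≤x A<x AB : IndexSet
    B≤x = initialSegment (suc x) B
    A<x = initialSegment x A
    AB = grow B≤x A<x x

    ∈-A<x⁻ : ∀ {i} → i ∈ⁱ A<x → i ∈ⁱ A × i < x
    ∈-A<x⁻ = ∈-below⁻ (indices A)

    greedy-AB : Greedyˢ AB
    greedy-AB = grow-induction Greedyˢ (λ {A} {B} → Greedyˢ-resp {A} {B}) B≤x A<x (Greedy-initial (suc x) B grB)
      (λ j j∈ j∉ gr → Greedy-exchange n j (ℕ.<-≤-trans (proj₂ (∈-A<x⁻ j∈)) x≤n) {grow B≤x A<x j} {A<x} gr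
        (Greedy-initial x A grA) j∈ j∉ (λ y∈ y<j → ∈-grow⁺ʳ {B≤x} {A<x} y∈ y<j))
      x

    ∈-AB⁻ : ∀ {i} → i ∈ⁱ AB → (i ∈ⁱ A × i < x) ⊎ i ≡ x
    ∈-AB⁻ i∈ with ∈-grow⁻ {B≤x} {A<x} i∈
    ... | inj₂ (i∈A<x , _) = inj₁ (∈-A<x⁻ i∈A<x)
    ... | inj₁ i∈B≤x with ∈-below⁻ (indices B) i∈B≤x
    ...   | i∈B , s≤s i≤x with ℕ.m≤n⇒m<n∨m≡n i≤x
    ...     | inj₁ i<x = inj₁ (B⊆A i∈B i<x , i<x)
    ...     | inj₂ i≡x = inj₂ i≡x

    x∈AB : x ∈ⁱ AB
    x∈AB = ∈-grow⁺ˡ {B≤x} {A<x} (∈-below⁺ x∈B (ℕ.n<1+n x))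

    above-AB : above x (indices AB) ≡ []
    above-AB = List.filter-none (x ℕ.<?_) (All.tabulate λ i∈ x<i →
      [ (λ (_ , i<x) → ℕ.<-asym x<i i<x) , (λ { refl → ℕ.<-irrefl refl x<i }) ]′ (∈-AB⁻ i∈))

    mid-AB : ∀ k → mid k x AB ≡ mid k x A
    mid-AB k = mid-cong {k} {x} {AB} {A}
      (λ i<x i∈ → [ proj₁ , (λ { refl → contradiction i<x (ℕ.<-irrefl refl) }) ]′ (∈-AB⁻ i∈))
      (λ i<x i∈ → ∈-grow⁺ʳ {B≤x} {A<x} (∈-below⁺ i∈ i<x) i<x)

    red-k-mid-x : ∀ k → k < x → Red (ω k ∷ wordOf (mid k x A) ++ ω x ∷ [])
    red-k-mid-x k k<x = ≡.subst (Red ∘ (ω k ∷_))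
      (≡.trans (above-∈ AB k<x x∈AB) (≡.cong₂ (λ ys zs → wordOf ys ++ ω x ∷ wordOf zs) (mid-AB k) above-AB))
      (greedy-AB k z≤n)

    red-k-mid-above : ∀ k → k < x → Red (ω k ∷ wordOf (mid k x A) ++ wordOf (above x (indices A)))
    red-k-mid-above k k<x = ≡.subst (Red ∘ (ω k ∷_)) (above-∉ A k<x x∉A) (grA k z≤n)

    -- `Red-insert` also asks for the word without its first letter ω k. That word begins at the
    -- next position j of A below x, where the claim holds by recursion, or at x, where greediness
    -- of A suffices. The fuel f dominates x - k, which decreases from k to j.
    inserted : ∀ f k → x ≤ f + k → k < x → Red (ω k ∷ wordOf (mid k x A) ++ ω x ∷ wordOf (above x (indices A)))
    inserted zero    k x≤k   k<x = contradiction x≤k (ℕ.<⇒≱ k<x)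
    inserted (suc f) k x≤f+k k<x = Red-insert (ω k) (wordOf (mid k x A)) (ω x) (wordOf (above x (indices A)))
      (red-k-mid-x k k<x) (red-k-mid-above k k<x) (tail (mid k x A) refl)
      where
      tail : ∀ ys → mid k x A ≡ ys → Red (wordOf ys ++ ω x ∷ wordOf (above x (indices A)))
      tail []       _   = grA x z≤n
      tail (j ∷ ys) mid≡ = ≡.subst (λ ys → Red (ω j ∷ wordOf ys ++ ω x ∷ wordOf (above x (indices A)))) mid-j
        (inserted f j (ℕ.≤-trans x≤f+k (ℕ.≤-trans (ℕ.≤-reflexive (≡.sym (ℕ.+-suc f k))) (ℕ.+-monoʳ-≤ f k<j))) j<x)
        where
        inc : Increasing (j ∷ ys)
        inc = ≡.subst Increasing mid≡ (mid-increasing k x A)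
        ∈mid : ∀ {i} → i ∈ j ∷ ys → i ∈ⁱ A × k < i × i < x
        ∈mid i∈ = ∈-mid⁻ A (≡.subst (_ ∈_) (≡.sym mid≡) i∈)
        k<j = proj₁ (proj₂ (∈mid (here refl)))
        j<x = proj₂ (proj₂ (∈mid (here refl)))
        mid-j : mid j x A ≡ ys
        mid-j = ⊆-antisym-increasing (mid-increasing j x A) (Linked.tail inc)
          (λ i∈ → let i∈A , j<i , i<x = ∈-mid⁻ A i∈ in
            beyond j<i (≡.subst (_ ∈_) mid≡ (∈-mid⁺ A i∈A (ℕ.<-trans k<j j<i) i<x)))
          (λ i∈ → let i∈A , _ , i<x = ∈mid (there i∈) in ∈-mid⁺ A i∈A (∈-tail⇒>head inc i∈) i<x)
          where
          beyond : ∀ {i} → j < i → i ∈ j ∷ ys → i ∈ ys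
          beyond j<i (here refl) = contradiction j<i (ℕ.<-irrefl refl)
          beyond j<i (there i∈)  = i∈

    C = insert A x

    above-C : ∀ {k} → x ≤ k → above k (indices C) ≡ above k (indices A)
    above-C {k} x≤k = above-cong {k} {C} {A}
      (λ k<i i∈ → [ id , (λ { refl → contradiction x≤k (ℕ.<⇒≱ k<i) }) ]′ (∈-insert⁻ {A} {x} i∈))
      (λ _ → ∈-insert⁺ˡ {A} {x})

    cases : Dec (k < x) → Red (ω k ∷ wordOf (above k (indices C)))
    cases (no k≮x) = ≡.subst (λ ys → Red (ω k ∷ wordOf ys)) (≡.sym (above-C (ℕ.≮⇒≥ k≮x))) (grA k z≤n)
    cases (yes k<x) = ≡.subst (Red ∘ (ω k ∷_))
      (≡.sym (≡.trans (above-∈ C k<x (∈-insert⁺ʳ {A} {x})) (≡.cong₂ (λ ys zs → wordOf ys ++ ω x ∷ wordOf zs)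
        (mid-cong {k} {x} {C} {A}
          (λ i<x i∈ → [ id , (λ { refl → contradiction i<x (ℕ.<-irrefl refl) }) ]′ (∈-insert⁻ {A} {x} i∈))
          (λ _ → ∈-insert⁺ˡ {A} {x}))
        (above-C ℕ.≤-refl))))
      (inserted x k (ℕ.m≤m+n x k) k<x)

  Sorted-exchange : ∀ {A B} → Sorted A → Sorted B → ∀ x → x ∈ⁱ B → x ∉ⁱ A →
    (∀ {y} → y ∈ⁱ B → y < x → y ∈ⁱ A) → Sorted (insert A x)
  Sorted-exchange {A} {B} sA sB x x∈B x∉A B⊆A = Greedy⇒Sorted (insert A x)
    (Greedy-exchange (suc x) x (ℕ.n<1+n x) {A} {B} (Sorted⇒Greedy A sA) (Sorted⇒Greedy B sB) x∈B x∉A B⊆A)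

  -- Every occurring element has a sorted word

  record GreedyWord (p n : ℕ) (w : Element) : Set (ℓ ⊔ a) where
    field
      word   : List ℕ
      inc    : Increasing word
      p≤     : All (p ≤_) word
      <p+n   : All (_< p + n) word
      greedy : Greedy p word
      ≈w     : ⟨ wordOf word ⟩ ≈ w

    red : Red (wordOf word)
    red = Greedy⇒Red inc p≤ greedy

  -- A greedy word beyond p is corrected at p, which is put in front exactly when ω p is a descent
  -- of the element wanted. n counts the positions still available.
  greedyWord : ∀ n p xs → Increasing xs → All (p ≤_) xs → All (_< p + n) xs → GreedyWord p n ⟨ wordOf xs ⟩
  greedyWord zero p [] _ _ _ = record
    { word = [] ; inc = [] ; p≤ = [] ; <p+n = [] ; greedy = λ k _ → Red-letter (ω k) ; ≈w = G.refl }
  greedyWord zero p (x ∷ xs) _ (p≤x ∷ _) (x< ∷ _) = contradiction p≤x (ℕ.<⇒≱ (≡.subst (x <_) (ℕ.+-identityʳ p) x<))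
  greedyWord (suc n) p = split
    where
    ih : ∀ xs → Increasing xs → All (suc p ≤_) xs → All (_< p + suc n) xs → GreedyWord (suc p) n ⟨ wordOf xs ⟩
    ih xs inc p< <p = greedyWord n (suc p) xs inc p< (All.map (λ {i} → ≡.subst (i <_) (ℕ.+-suc p n)) <p)

    widen : ∀ {xs} → All (_< suc p + n) xs → All (_< p + suc n) xs
    widen = All.map (λ {i} → ≡.subst (i <_) (≡.sym (ℕ.+-suc p n)))

    without-p : ∀ {w} (g : GreedyWord (suc p) n w) → Red (ω p ∷ wordOf (GreedyWord.word g)) → GreedyWord p (suc n) w
    without-p g red-p = record
      { word = word ; inc = inc ; p≤ = All.map ℕ.<⇒≤ p≤ ; <p+n = widen <p+n
      ; greedy = proj₁ (Greedy-∷ p≤ greedy red-p) ; ≈w = ≈w }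
      where open GreedyWord g

    with-p : ∀ {w} (g : GreedyWord (suc p) n w) → Red (ω p ∷ wordOf (GreedyWord.word g)) → GreedyWord p (suc n) (gen (ω p) ∙ w)
    with-p g red-p = record
      { word = p ∷ word ; inc = increasing-++∷ [] [] inc p≤
      ; p≤ = ℕ.≤-refl ∷ All.map ℕ.<⇒≤ p≤ ; <p+n = ℕ.m<m+n p (s≤s z≤n) ∷ widen <p+n
      ; greedy = proj₂ (Greedy-∷ p≤ greedy red-p) ; ≈w = G.∙-congˡ ≈w }
      where open GreedyWord g

    respʷ : ∀ {w w′} → w ≈ w′ → GreedyWord p (suc n) w → GreedyWord p (suc n) w′
    respʷ w≈w′ g = record { GreedyWord g ; ≈w = G.trans (GreedyWord.≈w g) w≈w′ }

    -- If ω p is a descent of w, then the word of ω p · w does not have it.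
    flip : ∀ {w} (g : GreedyWord (suc p) n w) → Descent (ω p) (wordOf (GreedyWord.word g)) →
      ∃[ h ] Red (ω p ∷ wordOf (GreedyWord.word {suc p} {n} {gen (ω p) ∙ w} h))
    flip {w} g desc = h , Red-resp red (G.trans (G.sym (gen-involutive (ω p) _))
        (G.∙-congˡ (G.sym (G.trans h′.≈w rest≈)))) (≡.subst₂ _≤_ refl (≡.trans len (≡.sym (List.length-map ω word)))
          (s≤s (ℕ.≤-trans (shortest h′.red (wordOf rest) (G.sym h′.≈w)) (ℕ.≤-reflexive (List.length-map ω rest)))))
      where
      open GreedyWord g
      open Deleted (deleted red desc)
      h′ : GreedyWord (suc p) n ⟨ wordOf rest ⟩
      h′ = greedyWord n (suc p) rest (increasing-⊆ rest⊆ inc) (Sublist.All-resp-⊆ rest⊆ p≤) (Sublist.All-resp-⊆ rest⊆ <p+n)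
      module h′ = GreedyWord h′
      h : GreedyWord (suc p) n (gen (ω p) ∙ w)
      h = record { h′ ; ≈w = G.trans h′.≈w (G.trans rest≈ (G.∙-congˡ ≈w)) }

    -- Exactly one of w and ω p · w lacks the descent ω p. Its greedy word beyond p serves for both
    -- elements, with p in front for the other one.
    skip : ∀ {w} → GreedyWord (suc p) n w → GreedyWord p (suc n) w
    skip {w} g = [ (λ desc → respʷ (gen-involutive (ω p) w) (let h , red-h = flip g desc in with-p h red-h)) , without-p g ]′
      (descent⊎Red (ω p) (GreedyWord.red g))
    take : ∀ {w} → GreedyWord (suc p) n w → GreedyWord p (suc n) (gen (ω p) ∙ w)
    take g = [ (λ desc → let h , red-h = flip g desc in without-p h red-h) , with-p g ]′
      (descent⊎Red (ω p) (GreedyWord.red g))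

    split : ∀ xs → Increasing xs → All (p ≤_) xs → All (_< p + suc n) xs → GreedyWord p (suc n) ⟨ wordOf xs ⟩
    split []       inc _         _   = skip (ih [] inc [] [])
    split (x ∷ xs) inc (p≤x ∷ _) xs< with ℕ.m≤n⇒m<n∨m≡n p≤x
    ... | inj₁ p<x  = skip (ih (x ∷ xs) inc (p<x ∷ All.map (ℕ.<-trans p<x) (increasing-head inc)) xs<)
    ... | inj₂ refl = take (ih xs (Linked.tail inc) (increasing-head inc) (All.tail xs<))

  sortedWord : ∀ A → ∃[ α ] ⟨ subword (proj₁ {B = Sorted} α) ⟩ ≈ ⟨ subword A ⟩
  sortedWord A = (B , Greedy⇒Sorted B greedy) , ≈w
    where
    open GreedyWord (greedyWord (bound A) 0 (indices A) (increasing A) (All.tabulate (λ _ → z≤n)) (All.tabulate (∈⇒<bound A)))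
    B = indexSet word inc

theorem5p2 : ∀ {c ℓ a} (X : CoxeterSystem c ℓ a) (ω : ℕ → CoxeterSystem.S X) →
    let open SortingOrder X ω in
    Infinite (CoxeterSystem.setoid X) →
    Infinite occurring →
    Σ (Op₂ P) λ _∨_ → Σ (Op₂ P) λ _∧_ →
    Σ (IsLattice _≈ω_ _≤ω_ _∨_ _∧_) λ isLattice →
    let L : Lattice (ℓ ⊔ a) 0ℓ 0ℓ
        L = record { isLattice = isLattice }
    in Infinite (Lattice.setoid L) × LocallyFinite L × Supersolvable L × JoinDistributive L
theorem5p2 X ω _ infinite =
  _∨_ , _∧_ , isLattice , infinite-P , locallyFinite , supersolvable , joinDistributive
  where
  open CoxeterSystem X using (_≈_; ⟨_⟩; setoid)
  open SortingOrder X ω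
  open Sorting X ω
  open Antimatroid Sorted sorted? (λ {A} {B} → Sorted-resp {A} {B}) Sorted-empty (λ {A} {B} → Sorted-exchange {A} {B})
    hiding (P; _≈_)

  -- Every occurring element is spelled by a sorted word, so a finite list of all sorted words would
  -- enumerate the occurring elements.
  infinite-P : Infinite (Lattice.setoid lattice)
  infinite-P (αs , complete) = infinite (map word αs , enumerates)
    where
    word : P → Σ _ Occurs
    word (A , _) = ⟨ subword A ⟩ , A , Setoid.refl setoid
    enumerates : ∀ w → Any (λ v → proj₁ w ≈ proj₁ v) (map word αs)
    enumerates (w , A , A≈w) = let α , α≈A = sortedWord A in
      Any.map⁺ (Any.map (λ α≡β → Setoid.trans setoid (Setoid.sym setoid A≈w)
        (Setoid.trans setoid (Setoid.sym setoid α≈A) (Setoid.reflexive setoid (≡.cong (λ xs → ⟨ map ω xs ⟩) α≡β)))) (complete α))
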